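{- Let $T$ be a tree of order $n$ and let $D = D(T)$. Then the Seidel energy of $T$ satisfies $$\mathcal{E}(S(T)) \geq 2n - 6 + \sqrt{2(n-D)}.$$
   Context: All graphs are simple and finite. For a graph $G$ with vertex set $\{v_1,\dots,v_n\}$, the Seidel matrix $S(G)$ is the $n\times n$ matrix with zero diagonal, whose $(i,j)$ entry ($i\neq j$) is $-1$ if $v_i$ and $v_j$ are adjacent and $1$ otherwise. For a Hermitian matrix $A$, its energy $\mathcal{E}(A)$ is the sum of the absolute values of its eigenvalues; the Seidel energy of $G$ is $\mathcal{E}(S(G))$. For a tree $T$, $D(T)$ denotes the maximum, over vertices $w$ of $T$, of the number of leaves of $T$ adjacent to $w$. -}

module Defs where

open import Algebra.Bundles.Raw using (RawRing)
import Algebra.Definitions.RawMonoid as RawMonoidDefs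
import Algebra.Definitions.RawSemiring as RawSemiringDefs
open import Data.Bool.Base using (Bool; true; false; T; if_then_else_)
open import Data.Fin.Base as Fin using (Fin; zero; suc; toℕ; inject₁; punchIn)
import Data.Fin.Properties as Fin
open import Data.Fin.Subset using (Subset; ∣_∣; _∩_)
open import Data.Integer.Base as ℤ using (+_; -[1+_]; +[1+_])
import Data.Integer.Properties as ℤ
open import Data.Nat.Base as ℕ using (ℕ; zero; suc)
import Data.Nat.Properties as ℕ
open import Data.Nat.Tactic.RingSolver using (solve-∀)
open import Data.Product.Base using (∃-syntax; _×_; _,_)
open import Data.Rational.Base as ℚ using (ℚ; mkℚ; 0ℚ; 1ℚ; ½)
import Data.Rational.Properties as ℚ
open import Data.Rational.Solver using (module +-*-Solver)
open import Data.Rational.Unnormalised.Base as ℚᵘ using (mkℚᵘ)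
import Data.Rational.Unnormalised.Properties as ℚᵘ
open import Data.Sum.Base using (inj₁; inj₂)
import Data.Vec.Base as Vec
open import Data.Vec.Functional using (Vector; foldr)
open import Function.Definitions using (Injective)
open import Level using (0ℓ)
open import Relation.Binary.Construct.Closure.ReflexiveTransitive using (Star)
open import Relation.Binary.PropositionalEquality
open import Relation.Nullary using (¬_; does; yes; no)

Cauchy : (ℕ → ℚ) → Set
Cauchy x = ∀ ε → 0ℚ ℚ.< ε →
  ∃[ N ] ∀ i j → N ℕ.≤ i → N ℕ.≤ j → ℚ.∣ x i ℚ.- x j ∣ ℚ.≤ ε

record ℝ : Set where
  constructor mkℝ
  field
    seq    : ℕ → ℚ
    cauchy : Cauchy seq

open ℝ public

infix 4 _≈_ _≤_

_≈_ : ℝ → ℝ → Set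
x ≈ y = ∀ ε → 0ℚ ℚ.< ε →
  ∃[ N ] ∀ i → N ℕ.≤ i → ℚ.∣ seq x i ℚ.- seq y i ∣ ℚ.≤ ε

_≤_ : ℝ → ℝ → Set
x ≤ y = ∀ ε → 0ℚ ℚ.< ε →
  ∃[ N ] ∀ i → N ℕ.≤ i → seq x i ℚ.≤ seq y i ℚ.+ ε

module Cauchy-Lemmas where
  open +-*-Solver using (solve; _:+_; _:-_; :-_; _:=_)

  0<½ε : ∀ {ε} → 0ℚ ℚ.< ε → 0ℚ ℚ.< ½ ℚ.* ε
  0<½ε {ε} 0<ε = subst (ℚ._< ½ ℚ.* ε) (ℚ.*-zeroʳ ½) (ℚ.*-monoʳ-<-pos ½ 0<ε)

  ½+½ : ∀ ε → ½ ℚ.* ε ℚ.+ ½ ℚ.* ε ≡ ε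
  ½+½ ε = trans (sym (ℚ.*-distribʳ-+ ε ½ ½)) (ℚ.*-identityˡ ε)

  ≤-max₂ : ∀ {M N i} → M ℕ.⊔ N ℕ.≤ i → N ℕ.≤ i
  ≤-max₂ {M} {N} = ℕ.≤-trans (ℕ.m≤n⊔m M N)

  ≤-max₁ : ∀ {M N i} → M ℕ.⊔ N ℕ.≤ i → M ℕ.≤ i
  ≤-max₁ {M} {N} = ℕ.≤-trans (ℕ.m≤m⊔n M N)

  p-q≤r : ∀ {p q r} → p ℚ.≤ q ℚ.+ r → p ℚ.- q ℚ.≤ r
  p-q≤r {p} {q} {r} h = subst (p ℚ.- q ℚ.≤_)
    (solve 2 (λ q r → (q :+ r) :- q := r) refl q r)
    (ℚ.+-monoˡ-≤ (ℚ.- q) h)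

  ∣p-q∣≤r : ∀ {p q r} → p ℚ.≤ q ℚ.+ r → q ℚ.≤ p ℚ.+ r → ℚ.∣ p ℚ.- q ∣ ℚ.≤ r
  ∣p-q∣≤r {p} {q} {r} h₁ h₂ with ℚ.∣p∣≡p∨∣p∣≡-p (p ℚ.- q)
  ... | inj₁ e = subst (ℚ._≤ r) (sym e) (p-q≤r h₁)
  ... | inj₂ e = subst (ℚ._≤ r)
    (trans (solve 2 (λ p q → q :- p := :- (p :- q)) refl p q) (sym e))
    (p-q≤r h₂)

  ∣p∣≤∣q∣+∣p-q∣ : ∀ p q → ℚ.∣ p ∣ ℚ.≤ ℚ.∣ q ∣ ℚ.+ ℚ.∣ p ℚ.- q ∣
  ∣p∣≤∣q∣+∣p-q∣ p q = subst (λ s → ℚ.∣ s ∣ ℚ.≤ ℚ.∣ q ∣ ℚ.+ ℚ.∣ p ℚ.- q ∣)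
    (solve 2 (λ p q → q :+ (p :- q) := p) refl p q)
    (ℚ.∣p+q∣≤∣p∣+∣q∣ q (p ℚ.- q))

  ∣p-q∣-comm : ∀ p q → ℚ.∣ p ℚ.- q ∣ ≡ ℚ.∣ q ℚ.- p ∣
  ∣p-q∣-comm p q = trans (sym (ℚ.∣-p∣≡∣p∣ (p ℚ.- q)))
    (cong ℚ.∣_∣ (solve 2 (λ p q → :- (p :- q) := q :- p) refl p q))

  +-cauchy : ∀ {x y} → Cauchy x → Cauchy y → Cauchy (λ i → x i ℚ.+ y i)
  +-cauchy {x} {y} cx cy ε 0<ε with cx (½ ℚ.* ε) (0<½ε 0<ε) | cy (½ ℚ.* ε) (0<½ε 0<ε)
  ... | M , hx | N , hy = M ℕ.⊔ N , λ i j Mi Mj → begin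
    ℚ.∣ (x i ℚ.+ y i) ℚ.- (x j ℚ.+ y j) ∣
      ≡⟨ cong ℚ.∣_∣ (solve 4 (λ a b c d → (a :+ b) :- (c :+ d) := (a :- c) :+ (b :- d))
           refl (x i) (y i) (x j) (y j)) ⟩
    ℚ.∣ (x i ℚ.- x j) ℚ.+ (y i ℚ.- y j) ∣
      ≤⟨ ℚ.∣p+q∣≤∣p∣+∣q∣ (x i ℚ.- x j) (y i ℚ.- y j) ⟩
    ℚ.∣ x i ℚ.- x j ∣ ℚ.+ ℚ.∣ y i ℚ.- y j ∣
      ≤⟨ ℚ.+-mono-≤ (hx i j (≤-max₁ Mi) (≤-max₁ Mj))
                    (hy i j (≤-max₂ {M} Mi) (≤-max₂ {M} Mj)) ⟩
    ½ ℚ.* ε ℚ.+ ½ ℚ.* ε ≡⟨ ½+½ ε ⟩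
    ε ∎
    where open ℚ.≤-Reasoning

  neg-cauchy : ∀ {x} → Cauchy x → Cauchy (λ i → ℚ.- x i)
  neg-cauchy {x} cx ε 0<ε with cx ε 0<ε
  ... | N , h = N , λ i j Ni Nj → subst (ℚ._≤ ε)
    (trans (∣p-q∣-comm (x i) (x j))
      (cong ℚ.∣_∣ (solve 2 (λ a b → b :- a := (:- a) :- (:- b)) refl (x i) (x j))))
    (h i j Ni Nj)

  abs-cauchy : ∀ {x} → Cauchy x → Cauchy (λ i → ℚ.∣ x i ∣)
  abs-cauchy {x} cx ε 0<ε with cx ε 0<ε
  ... | N , h = N , λ i j Ni Nj → ℚ.≤-trans
    (∣p-q∣≤r (∣p∣≤∣q∣+∣p-q∣ (x i) (x j))
             (subst (λ d → ℚ.∣ x j ∣ ℚ.≤ ℚ.∣ x i ∣ ℚ.+ d) (∣p-q∣-comm (x j) (x i))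
               (∣p∣≤∣q∣+∣p-q∣ (x j) (x i))))
    (h i j Ni Nj)

  bounded : ∀ {x} → Cauchy x →
    ∃[ B ] (0ℚ ℚ.< B × ∃[ N ] ∀ i → N ℕ.≤ i → ℚ.∣ x i ∣ ℚ.≤ B)
  bounded {x} cx with cx 1ℚ (ℚ.positive⁻¹ 1ℚ)
  ... | N , h = ℚ.∣ x N ∣ ℚ.+ 1ℚ
              , ℚ.+-mono-≤-< (ℚ.0≤∣p∣ (x N)) (ℚ.positive⁻¹ 1ℚ)
              , N , λ i Ni → ℚ.≤-trans (∣p∣≤∣q∣+∣p-q∣ (x i) (x N))
                               (ℚ.+-monoʳ-≤ ℚ.∣ x N ∣ (h i N Ni ℕ.≤-refl))

  scale : ∀ B → 0ℚ ℚ.< B → ∀ ε → 0ℚ ℚ.< ε → ∃[ δ ] (0ℚ ℚ.< δ × B ℚ.* δ ≡ ε)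
  scale B 0<B ε 0<ε = 1/B ℚ.* ε
    , subst (ℚ._< 1/B ℚ.* ε) (ℚ.*-zeroʳ 1/B) (ℚ.*-monoʳ-<-pos 1/B {{ℚ.1/pos⇒pos B}} 0<ε)
    , trans (sym (ℚ.*-assoc B 1/B ε))
        (trans (cong (ℚ._* ε) (ℚ.*-inverseʳ B)) (ℚ.*-identityˡ ε))
    where
    instance
      B-pos = ℚ.positive 0<B
      B-nonZero = ℚ.pos⇒nonZero B
    1/B = ℚ.1/ B

  *-mono-∣∣ : ∀ p q B δ → 0ℚ ℚ.< B → ℚ.∣ p ∣ ℚ.≤ B → ℚ.∣ q ∣ ℚ.≤ δ →
    ℚ.∣ p ℚ.* q ∣ ℚ.≤ B ℚ.* δ
  *-mono-∣∣ p q B δ 0<B hp hq = begin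
    ℚ.∣ p ℚ.* q ∣         ≡⟨ ℚ.∣p*q∣≡∣p∣*∣q∣ p q ⟩
    ℚ.∣ p ∣ ℚ.* ℚ.∣ q ∣   ≤⟨ ℚ.*-monoʳ-≤-nonNeg ℚ.∣ q ∣ {{ℚ.∣-∣-nonNeg q}} hp ⟩
    B ℚ.* ℚ.∣ q ∣         ≤⟨ ℚ.*-monoˡ-≤-nonNeg B {{ℚ.nonNegative (ℚ.<⇒≤ 0<B)}} hq ⟩
    B ℚ.* δ ∎
    where open ℚ.≤-Reasoning

  *-distribˡ-- : ∀ p q r → p ℚ.* (q ℚ.- r) ≡ p ℚ.* q ℚ.- p ℚ.* r
  *-distribˡ-- p q r = trans (ℚ.*-distribˡ-+ p q (ℚ.- r))
    (cong (p ℚ.* q ℚ.+_) (sym (ℚ.neg-distribʳ-* p r)))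

  *-diff : ∀ a b c d → a ℚ.* b ℚ.- c ℚ.* d ≡ a ℚ.* (b ℚ.- d) ℚ.+ d ℚ.* (a ℚ.- c)
  *-diff a b c d = sym (begin
    a ℚ.* (b ℚ.- d) ℚ.+ d ℚ.* (a ℚ.- c)
      ≡⟨ cong₂ ℚ._+_ (*-distribˡ-- a b d) (*-distribˡ-- d a c) ⟩
    (a ℚ.* b ℚ.- a ℚ.* d) ℚ.+ (d ℚ.* a ℚ.- d ℚ.* c)
      ≡⟨ cong₂ (λ s t → (a ℚ.* b ℚ.- a ℚ.* d) ℚ.+ (s ℚ.- t)) (ℚ.*-comm d a) (ℚ.*-comm d c) ⟩
    (a ℚ.* b ℚ.- a ℚ.* d) ℚ.+ (a ℚ.* d ℚ.- c ℚ.* d)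
      ≡⟨ solve 3 (λ p q r → (p :- q) :+ (q :- r) := p :- r)
           refl (a ℚ.* b) (a ℚ.* d) (c ℚ.* d) ⟩
    a ℚ.* b ℚ.- c ℚ.* d ∎)
    where open ≡-Reasoning

  *-close : ∀ a b c d A B α β → 0ℚ ℚ.< A → 0ℚ ℚ.< B →
    ℚ.∣ a ∣ ℚ.≤ A → ℚ.∣ d ∣ ℚ.≤ B → ℚ.∣ b ℚ.- d ∣ ℚ.≤ α → ℚ.∣ a ℚ.- c ∣ ℚ.≤ β →
    ℚ.∣ a ℚ.* b ℚ.- c ℚ.* d ∣ ℚ.≤ A ℚ.* α ℚ.+ B ℚ.* β
  *-close a b c d A B α β 0<A 0<B ha hd hbd hac = begin
    ℚ.∣ a ℚ.* b ℚ.- c ℚ.* d ∣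
      ≡⟨ cong ℚ.∣_∣ (*-diff a b c d) ⟩
    ℚ.∣ a ℚ.* (b ℚ.- d) ℚ.+ d ℚ.* (a ℚ.- c) ∣
      ≤⟨ ℚ.∣p+q∣≤∣p∣+∣q∣ (a ℚ.* (b ℚ.- d)) (d ℚ.* (a ℚ.- c)) ⟩
    ℚ.∣ a ℚ.* (b ℚ.- d) ∣ ℚ.+ ℚ.∣ d ℚ.* (a ℚ.- c) ∣
      ≤⟨ ℚ.+-mono-≤ (*-mono-∣∣ a (b ℚ.- d) A α 0<A ha hbd)
                    (*-mono-∣∣ d (a ℚ.- c) B β 0<B hd hac) ⟩
    A ℚ.* α ℚ.+ B ℚ.* β ∎
    where open ℚ.≤-Reasoning

  *-cauchy : ∀ {x y} → Cauchy x → Cauchy y → Cauchy (λ i → x i ℚ.* y i)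
  *-cauchy {x} {y} cx cy ε 0<ε =
    let A , 0<A , K , hA = bounded {x} cx
        B , 0<B , L , hB = bounded {y} cy
        α , 0<α , Aα = scale A 0<A (½ ℚ.* ε) (0<½ε {ε} 0<ε)
        β , 0<β , Bβ = scale B 0<B (½ ℚ.* ε) (0<½ε {ε} 0<ε)
        M , hx = cx β 0<β
        N , hy = cy α 0<α
        to-K = λ {i} h → ≤-max₁ {K} {L} {i} (≤-max₁ {K ℕ.⊔ L} {M ℕ.⊔ N} {i} h)
        to-L = λ {i} h → ≤-max₂ {K} {L} {i} (≤-max₁ {K ℕ.⊔ L} {M ℕ.⊔ N} {i} h)
        to-M = λ {i} h → ≤-max₁ {M} {N} {i} (≤-max₂ {K ℕ.⊔ L} {M ℕ.⊔ N} {i} h)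
        to-N = λ {i} h → ≤-max₂ {M} {N} {i} (≤-max₂ {K ℕ.⊔ L} {M ℕ.⊔ N} {i} h)
    in (K ℕ.⊔ L) ℕ.⊔ (M ℕ.⊔ N) , λ i j hi hj →
      subst (ℚ.∣ x i ℚ.* y i ℚ.- x j ℚ.* y j ∣ ℚ.≤_)
        (trans (cong₂ ℚ._+_ Aα Bβ) (½+½ ε))
        (*-close (x i) (y i) (x j) (y j) A B α β 0<A 0<B
          (hA i (to-K hi)) (hB j (to-L hj))
          (hy i j (to-N hi) (to-N hj)) (hx i j (to-M hi) (to-M hj)))

  const-cauchy : ∀ q → Cauchy (λ _ → q)
  const-cauchy q ε 0<ε = 0 , λ _ _ _ _ →
    subst (λ d → ℚ.∣ d ∣ ℚ.≤ ε) (sym (ℚ.+-inverseʳ q)) (ℚ.<⇒≤ 0<ε)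

open Cauchy-Lemmas

infixl 6 _+_ _-_
infixl 7 _*_
infix  8 -_

fromℚ : ℚ → ℝ
fromℚ q = mkℝ (λ _ → q) (const-cauchy q)

fromℕ : ℕ → ℝ
fromℕ n = fromℚ (+ n ℚ./ 1)

0ℝ 1ℝ : ℝ
0ℝ = fromℚ 0ℚ
1ℝ = fromℚ 1ℚ

_+_ : ℝ → ℝ → ℝ
x + y = mkℝ (λ i → seq x i ℚ.+ seq y i) (+-cauchy {seq x} {seq y} (cauchy x) (cauchy y))

_*_ : ℝ → ℝ → ℝ
x * y = mkℝ (λ i → seq x i ℚ.* seq y i) (*-cauchy {seq x} {seq y} (cauchy x) (cauchy y))

-_ : ℝ → ℝ
- x = mkℝ (λ i → ℚ.- seq x i) (neg-cauchy {seq x} (cauchy x))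

_-_ : ℝ → ℝ → ℝ
x - y = x + (- y)

abs : ℝ → ℝ
abs x = mkℝ (λ i → ℚ.∣ seq x i ∣) (abs-cauchy {seq x} (cauchy x))

ℝ-rawRing : RawRing 0ℓ 0ℓ
ℝ-rawRing = record
  { Carrier = ℝ ; _≈_ = _≈_ ; _+_ = _+_ ; _*_ = _*_ ; -_ = -_ ; 0# = 0ℝ ; 1# = 1ℝ }

open RawMonoidDefs (RawRing.+-rawMonoid ℝ-rawRing) public using (sum)
open RawMonoidDefs (RawRing.*-rawMonoid ℝ-rawRing) public using () renaming (sum to product)
open RawSemiringDefs (RawRing.rawSemiring ℝ-rawRing) public using (_^_)

step√ : ℕ → ℕ → ℕ
step√ m r with suc r ℕ.* suc r ℕ.≤? m
... | yes _ = suc r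
... | no  _ = r

⌊√_⌋ : ℕ → ℕ
⌊√ zero ⌋  = zero
⌊√ suc m ⌋ = step√ (suc m) ⌊√ m ⌋

⌊√⌋-lower : ∀ m → ⌊√ m ⌋ ℕ.* ⌊√ m ⌋ ℕ.≤ m
⌊√⌋-lower zero = ℕ.z≤n
⌊√⌋-lower (suc m) with suc ⌊√ m ⌋ ℕ.* suc ⌊√ m ⌋ ℕ.≤? suc m
... | yes p = p
... | no  _ = ℕ.m≤n⇒m≤1+n (⌊√⌋-lower m)

⌊√⌋-upper : ∀ m → m ℕ.< suc ⌊√ m ⌋ ℕ.* suc ⌊√ m ⌋
⌊√⌋-upper zero = ℕ.s≤s ℕ.z≤n
⌊√⌋-upper (suc m) with suc ⌊√ m ⌋ ℕ.* suc ⌊√ m ⌋ ℕ.≤? suc m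
... | yes _ = ℕ.≤-<-trans (⌊√⌋-upper m)
  (ℕ.*-mono-< {r} {suc r} {r} {suc r} ℕ.≤-refl ℕ.≤-refl)
  where r = suc ⌊√ m ⌋
... | no  p = ℕ.≰⇒> p

√-approx : ℕ → ℕ → ℚ
√-approx m i = + ⌊√ m ℕ.* (suc i ℕ.* suc i) ⌋ ℚ./ suc i

module √-Lemmas where
  /-mono-≤ : ∀ {a b} k l → a ℕ.* suc l ℕ.≤ b ℕ.* suc k → + a ℚ./ suc k ℚ.≤ + b ℚ./ suc l
  /-mono-≤ {a} {b} k l h = ℚ.toℚᵘ-cancel-≤
    (ℚᵘ.≤-respˡ-≃ (ℚᵘ.≃-sym (ℚ.toℚᵘ-fromℚᵘ (mkℚᵘ (+ a) k)))
    (ℚᵘ.≤-respʳ-≃ (ℚᵘ.≃-sym (ℚ.toℚᵘ-fromℚᵘ (mkℚᵘ (+ b) l)))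
    (ℚᵘ.*≤* (subst₂ ℤ._≤_ (ℤ.pos-* a (suc l)) (ℤ.pos-* b (suc k)) (ℤ.+≤+ h)))))

  /-distrib-+ : ∀ b c l → + (b ℕ.+ c) ℚ./ suc l ≡ + b ℚ./ suc l ℚ.+ + c ℚ./ suc l
  /-distrib-+ b c l = ℚ.toℚᵘ-injective (ℚᵘ.≃-trans (ℚ.toℚᵘ-fromℚᵘ (mkℚᵘ (+ (b ℕ.+ c)) l))
    (ℚᵘ.≃-trans (ℚᵘ.*≡* eq)
    (ℚᵘ.≃-sym (ℚᵘ.≃-trans (ℚ.toℚᵘ-homo-+ (+ b ℚ./ suc l) (+ c ℚ./ suc l))
      (ℚᵘ.+-cong (ℚ.toℚᵘ-fromℚᵘ (mkℚᵘ (+ b) l)) (ℚ.toℚᵘ-fromℚᵘ (mkℚᵘ (+ c) l)))))))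
    where
    L = suc l
    nat : ∀ b c L → (b ℕ.+ c) ℕ.* (L ℕ.* L) ≡ (b ℕ.* L ℕ.+ c ℕ.* L) ℕ.* L
    nat = solve-∀
    eq : + (b ℕ.+ c) ℤ.* + (L ℕ.* L) ≡ (+ b ℤ.* + L ℤ.+ + c ℤ.* + L) ℤ.* + L
    eq = trans (sym (ℤ.pos-* (b ℕ.+ c) (L ℕ.* L))) (trans (cong +_ (nat b c L))
      (trans (ℤ.pos-* (b ℕ.* L ℕ.+ c ℕ.* L) L)
        (cong (ℤ._* + L) (cong₂ ℤ._+_ (ℤ.pos-* b L) (ℤ.pos-* c L)))))

  /-* : ∀ a b k l → + a ℚ./ suc k ℚ.* (+ b ℚ./ suc l) ≡ + (a ℕ.* b) ℚ./ (suc k ℕ.* suc l)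
  /-* a b k l = ℚ.toℚᵘ-injective
    (ℚᵘ.≃-trans (ℚ.toℚᵘ-homo-* (+ a ℚ./ suc k) (+ b ℚ./ suc l))
    (ℚᵘ.≃-trans (ℚᵘ.*-cong (ℚ.toℚᵘ-fromℚᵘ (mkℚᵘ (+ a) k)) (ℚ.toℚᵘ-fromℚᵘ (mkℚᵘ (+ b) l)))
    (ℚᵘ.≃-trans
      (ℚᵘ.*≡* (cong (ℤ._* + (suc k ℕ.* suc l)) (sym (ℤ.pos-* a b))))
      (ℚᵘ.≃-sym (ℚ.toℚᵘ-fromℚᵘ (mkℚᵘ (+ (a ℕ.* b)) (l ℕ.+ k ℕ.* suc l)))))))

  archimedean : ∀ c ε → 0ℚ ℚ.< ε → ∃[ N ] ∀ i → N ℕ.≤ i → + c ℚ./ suc i ℚ.≤ ε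
  archimedean c (mkℚ +[1+ p ] d cop) _ = c ℕ.* suc d , λ i N≤i →
    subst (+ c ℚ./ suc i ℚ.≤_) (ℚ.↥p/↧p≡p (mkℚ +[1+ p ] d cop))
      (/-mono-≤ {c} {suc p} i d
        (ℕ.≤-trans (ℕ.m≤n⇒m≤1+n N≤i) (ℕ.m≤m+n (suc i) (p ℕ.* suc i))))
  archimedean c (mkℚ (+ 0) d cop) (ℚ.*<* (ℤ.+<+ ()))
  archimedean c (mkℚ -[1+ p ] d cop) (ℚ.*<* ())

  √-approx-mono : ∀ m i j → √-approx m i ℚ.≤ √-approx m j ℚ.+ + 1 ℚ./ suc j
  √-approx-mono m i j = subst (√-approx m i ℚ.≤_)
    (trans (cong (λ t → + t ℚ./ suc j) (ℕ.+-comm 1 b)) (/-distrib-+ b 1 j))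
    (/-mono-≤ {a} {suc b} i j (ℕ.<⇒≤ (ℕ.≰⇒> λ h → ℕ.<⇒≱ sq< (ℕ.*-mono-≤ h h))))
    where
    k = suc i
    l = suc j
    a = ⌊√ m ℕ.* (k ℕ.* k) ⌋
    b = ⌊√ m ℕ.* (l ℕ.* l) ⌋
    e₁ : ∀ a l → (a ℕ.* l) ℕ.* (a ℕ.* l) ≡ (a ℕ.* a) ℕ.* (l ℕ.* l)
    e₁ = solve-∀
    e₂ : ∀ m k l → (m ℕ.* (k ℕ.* k)) ℕ.* (l ℕ.* l) ≡ (m ℕ.* (l ℕ.* l)) ℕ.* (k ℕ.* k)
    e₂ = solve-∀
    sq< : (a ℕ.* l) ℕ.* (a ℕ.* l) ℕ.< (suc b ℕ.* k) ℕ.* (suc b ℕ.* k)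
    sq< = begin-strict
      (a ℕ.* l) ℕ.* (a ℕ.* l)            ≡⟨ e₁ a l ⟩
      (a ℕ.* a) ℕ.* (l ℕ.* l)            ≤⟨ ℕ.*-monoˡ-≤ (l ℕ.* l) (⌊√⌋-lower (m ℕ.* (k ℕ.* k))) ⟩
      (m ℕ.* (k ℕ.* k)) ℕ.* (l ℕ.* l)    ≡⟨ e₂ m k l ⟩
      (m ℕ.* (l ℕ.* l)) ℕ.* (k ℕ.* k)    <⟨ ℕ.*-monoˡ-< (k ℕ.* k) (⌊√⌋-upper (m ℕ.* (l ℕ.* l))) ⟩
      (suc b ℕ.* suc b) ℕ.* (k ℕ.* k)    ≡⟨ sym (e₁ (suc b) k) ⟩
      (suc b ℕ.* k) ℕ.* (suc b ℕ.* k)    ∎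
      where open ℕ.≤-Reasoning

  √-cauchy : ∀ m → Cauchy (√-approx m)
  √-cauchy m ε 0<ε with archimedean 1 ε 0<ε
  ... | N , h = N , λ i j Ni Nj → ∣p-q∣≤r
    (ℚ.≤-trans (√-approx-mono m i j) (ℚ.+-monoʳ-≤ (√-approx m j) (h j Nj)))
    (ℚ.≤-trans (√-approx-mono m j i) (ℚ.+-monoʳ-≤ (√-approx m i) (h i Ni)))

open √-Lemmas

√ : ℕ → ℝ
√ m = mkℝ (√-approx m) (√-cauchy m)

0≤√ : ∀ m → 0ℝ ≤ √ m
0≤√ m ε 0<ε = 0 , λ i _ → ℚ.≤-trans
  (/-mono-≤ {0} {⌊√ m ℕ.* (suc i ℕ.* suc i) ⌋} 0 i ℕ.z≤n)
  (subst (ℚ._≤ √-approx m i ℚ.+ ε) (ℚ.+-identityʳ (√-approx m i))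
    (ℚ.+-monoʳ-≤ (√-approx m i) (ℚ.<⇒≤ 0<ε)))

√-square : ∀ m → √ m * √ m ≈ fromℕ m
√-square m ε 0<ε with archimedean (2 ℕ.* m ℕ.+ 1) ε 0<ε
... | N , h = N , λ i N≤i → ∣p-q∣≤r
  (ℚ.≤-trans (lower i) (subst (ℚ._≤ + m ℚ./ 1 ℚ.+ ε) (ℚ.+-identityʳ (+ m ℚ./ 1))
    (ℚ.+-monoʳ-≤ (+ m ℚ./ 1) (ℚ.<⇒≤ 0<ε))))
  (ℚ.≤-trans (upper i) (ℚ.+-monoʳ-≤ (√-approx m i ℚ.* √-approx m i) (h i N≤i)))
  where
  module _ (i : ℕ) where
    k = suc i
    j = i ℕ.+ i ℕ.* k
    a = ⌊√ m ℕ.* (k ℕ.* k) ⌋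

    lower : √-approx m i ℚ.* √-approx m i ℚ.≤ + m ℚ./ 1
    lower = subst (ℚ._≤ + m ℚ./ 1) (sym (/-* a a i i))
      (/-mono-≤ {a ℕ.* a} {m} j 0
        (subst (ℕ._≤ m ℕ.* (k ℕ.* k)) (sym (ℕ.*-identityʳ (a ℕ.* a)))
          (⌊√⌋-lower (m ℕ.* (k ℕ.* k)))))

    m≤m² : ∀ m → m ℕ.≤ m ℕ.* m
    m≤m² zero = ℕ.z≤n
    m≤m² (suc m) = ℕ.m≤m+n (suc m) (m ℕ.* suc m)

    mk² : ∀ m k → (m ℕ.* m) ℕ.* (k ℕ.* k) ≡ (m ℕ.* k) ℕ.* (m ℕ.* k)
    mk² = solve-∀

    a≤mk : a ℕ.≤ m ℕ.* k
    a≤mk = ℕ.≮⇒≥ λ mk<a → ℕ.<⇒≱ (ℕ.*-mono-< mk<a mk<a)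
      (ℕ.≤-trans (⌊√⌋-lower (m ℕ.* (k ℕ.* k)))
        (ℕ.≤-trans (ℕ.*-monoˡ-≤ (k ℕ.* k) (m≤m² m)) (ℕ.≤-reflexive (mk² m k))))

    excess : 2 ℕ.* a ℕ.+ 1 ℕ.≤ (2 ℕ.* m ℕ.+ 1) ℕ.* k
    excess = ℕ.≤-trans
      (ℕ.+-mono-≤ (ℕ.*-monoʳ-≤ 2 a≤mk) (ℕ.s≤s (ℕ.z≤n {i})))
      (ℕ.≤-reflexive (eq m k))
      where
      eq : ∀ m k → 2 ℕ.* (m ℕ.* k) ℕ.+ k ≡ (2 ℕ.* m ℕ.+ 1) ℕ.* k
      eq = solve-∀

    m≤ : + m ℚ./ 1 ℚ.≤ + (a ℕ.* a ℕ.+ (2 ℕ.* a ℕ.+ 1)) ℚ./ suc j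
    m≤ = /-mono-≤ {m} {a ℕ.* a ℕ.+ (2 ℕ.* a ℕ.+ 1)} 0 j
      (subst (m ℕ.* (k ℕ.* k) ℕ.≤_) (eq a) (ℕ.<⇒≤ (⌊√⌋-upper (m ℕ.* (k ℕ.* k)))))
      where
      eq : ∀ a → (1 ℕ.+ a) ℕ.* (1 ℕ.+ a) ≡ (a ℕ.* a ℕ.+ (2 ℕ.* a ℕ.+ 1)) ℕ.* 1
      eq = solve-∀

    error≤ : + (2 ℕ.* a ℕ.+ 1) ℚ./ suc j ℚ.≤ + (2 ℕ.* m ℕ.+ 1) ℚ./ k
    error≤ = /-mono-≤ {2 ℕ.* a ℕ.+ 1} {2 ℕ.* m ℕ.+ 1} j i
      (ℕ.≤-trans (ℕ.*-monoˡ-≤ k excess) (ℕ.≤-reflexive (ℕ.*-assoc (2 ℕ.* m ℕ.+ 1) k k)))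

    upper : + m ℚ./ 1 ℚ.≤ √-approx m i ℚ.* √-approx m i ℚ.+ + (2 ℕ.* m ℕ.+ 1) ℚ./ k
    upper = ℚ.≤-trans m≤ (subst₂ ℚ._≤_
      (sym (/-distrib-+ (a ℕ.* a) (2 ℕ.* a ℕ.+ 1) j))
      (cong (ℚ._+ + (2 ℕ.* m ℕ.+ 1) ℚ./ k) (sym (/-* a a i i)))
      (ℚ.+-monoʳ-≤ (+ (a ℕ.* a) ℚ./ suc j) error≤))

Matrix : ℕ → Set
Matrix n = Fin n → Fin n → ℝ

det : ∀ {n} → Matrix n → ℝ
det {zero}  A = 1ℝ
det {suc n} A = sum λ j →
  (- 1ℝ) ^ toℕ j * A zero j * det (λ i k → A (suc i) (punchIn j k))

1ᴹ : ∀ {n} → Matrix n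
1ᴹ i j = if does (i Fin.≟ j) then 1ℝ else 0ℝ

charpoly : ∀ {n} → Matrix n → ℝ → ℝ
charpoly A x = det (λ i j → x * 1ᴹ i j - A i j)

-- μ lists the eigenvalues of A with multiplicity: charpoly A = ∏ᵢ (x - μᵢ), as
-- functions on the infinite field ℝ, hence as polynomials.
IsSpectrum : ∀ {n} → Matrix n → Vector ℝ n → Set
IsSpectrum A μ = ∀ x → charpoly A x ≈ product (λ i → x - μ i)

-- The energy is a relation rather than a function because no eigenvalues are
-- constructed here.  For symmetric A the spectral theorem gives such a μ, which
-- is unique up to order, so e is determined by A up to _≈_.
IsEnergy : ∀ {n} → Matrix n → ℝ → Set
IsEnergy {n} A e = ∃[ μ ] IsSpectrum {n} A μ × e ≈ sum (λ i → abs (μ i))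

record Graph (n : ℕ) : Set where
  field
    adj        : Fin n → Fin n → Bool
    adj-sym    : ∀ u v → adj u v ≡ adj v u
    adj-irrefl : ∀ v → adj v v ≡ false

  Adj : Fin n → Fin n → Set
  Adj u v = T (adj u v)

  neighbours : Fin n → Subset n
  neighbours v = Vec.tabulate (adj v)

  degree : Fin n → ℕ
  degree v = ∣ neighbours v ∣

  leaves : Subset n
  leaves = Vec.tabulate λ v → does (degree v ℕ.≟ 1)

  -- Maximum over w of the number of leaves adjacent to w (0 on the empty graph).
  D : ℕ
  D = foldr ℕ._⊔_ 0 λ w → ∣ neighbours w ∩ leaves ∣

  -- Fin n: a connected graph has at least one vertex.
  Connected : Set
  Connected = Fin n × (∀ u v → Star Adj u v)

  -- A cycle c₀, …, c_{k+2} of length k + 3.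
  record Cycle (k : ℕ) : Set where
    field
      vertex    : Fin (3 ℕ.+ k) → Fin n
      injective : Injective _≡_ _≡_ vertex
      edge      : ∀ (i : Fin (2 ℕ.+ k)) → Adj (vertex (inject₁ i)) (vertex (suc i))
      closing   : Adj (vertex (Fin.fromℕ (2 ℕ.+ k))) (vertex zero)

  record IsTree : Set where
    field
      connected : Connected
      acyclic   : ∀ k → ¬ Cycle k

  seidel : Matrix n
  seidel i j = if does (i Fin.≟ j) then 0ℝ else if adj i j then - 1ℝ else 1ℝ

-- Root the tree at the neighbour of a leaf and partition it into stars, each
-- consisting of a center c and a nonempty set L_c of d_c children of c.  The
-- vectors v_c = √d_c e_c - 1_{L_c} and h = ∑ (√d_c e_c + 1_{L_c}) are orthogonal,
-- of square norms 2 d_c and 2 α, where α = ∑ d_c.  As tr S = 0, Ky Fan's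
-- inequality bounds the energy below by 2 ∑ ⟨w, S w⟩ / ⟨w, w⟩ over these vectors,
-- which depends on the tree only through the d_c and the edges between stars.
-- The contribution of these edges is bounded by a 2-colouring of the stars if a
-- star other than the largest has two or more children, and directly otherwise.
-- D is at least d_c for the largest star minus the number of stars attached to
-- its children.
--
-- Ky Fan's inequality needs no diagonalisation of S.  The spectrum gives
-- tr Sᵖ = ∑ μᵢᵖ, and the positive functionals xᵖ ↦ ∑ ⟨w, Sᵖ w⟩ and
-- xᵖ ↦ tr Sᵖ - ∑ ⟨w, Sᵖ w⟩ are evaluated at Bernstein polynomials of |x|.

module Submission where

open import Defs using (Graph; module Graph)
open import Algebra.Bundles using (CommutativeRing)
open import Data.Nat.Base as ℕ using (ℕ; zero; suc; _∸_)
open import Data.Product.Base using (∃-syntax; _×_; _,_; proj₁; proj₂)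
open import Level using (0ℓ)

-- As `S = J - I - 2A`, the choice of vectors comes from the adjacency matrix of one star:
-- `√d_c e_c - 1_L` and `√d_c e_c + 1_L` are its eigenvectors for `-√d_c` and `√d_c`. The `v_c`
-- profit from `-2A`, their companions are added up in `h` to profit from `J`. Let `s = ∑ √d_c`, `M`
-- the largest `√d_c` and `Se` the contribution of the edges between stars. With `4 Se ≤ s²` and
-- `∑ d_c √d_c ≤ M α` the bound exceeds `2n - 6` by at least `1 + ∑ (4 √d_c - 3)`, summed over all
-- stars but the largest. Its square beats `2 (n - D)` if one of these stars has two children. If
-- all are single edges, this is too weak for few stars: the terms given away are kept, and two or
-- three stars get rational lower bounds of the excess. The path on four vertices needs
-- `E² ≥ 2 tr S²`. The spectrum is known through the characteristic polynomial only, without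
-- eigenvectors, so all facts about it come from power sums. The order of the Cauchy reals is
-- undecidable: cases are distinguished on finite data, and inequalities rest on nonnegative
-- differences and comparison of squares.

-- Integer coefficients in commutative rings.

module Integers (R : CommutativeRing 0ℓ 0ℓ) where
  open CommutativeRing R
  open import Algebra.Properties.Ring ring
    using (-‿distribˡ-*; -‿distribʳ-*; -‿involutive; -0#≈0#)
  open import Algebra.Properties.AbelianGroup +-abelianGroup using (⁻¹-∙-comm)
  import Algebra.Properties.Semiring.Mult.TCOptimised semiring as Mult
  open import Algebra.Solver.Ring.AlmostCommutativeRing
    using (fromCommutativeRing; _-Raw-AlmostCommutative⟶_)
  open import Data.Integer.Base as ℤ using (ℤ; +_; -[1+_]; _⊖_)
  import Data.Integer.Properties as ℤ
  open import Data.Maybe.Base using (Maybe; just; nothing)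
  import Data.Nat.Properties as ℕ
  open import Relation.Binary.PropositionalEquality as ≡ using (_≡_)
  open import Relation.Nullary using (yes; no)
  open import Relation.Binary.Reasoning.Setoid setoid

  -- With this form of multiple `ι 1` reduces to `1#`, so the numerals `:ι 0` and `:ι 1` of the
  -- solver meet the literal `0#` and `1#` of the goals.
  ι : ℕ → Carrier
  ι n = n Mult.× 1#

  ι-+ : ∀ m n → ι (m ℕ.+ n) ≈ ι m + ι n
  ι-+ m n = Mult.×-homo-+ 1# m n

  ι-* : ∀ m n → ι (m ℕ.* n) ≈ ι m * ι n
  ι-* = Mult.×1-homo-*

  ι-suc : ∀ n → ι (suc n) ≈ 1# + ι n
  ι-suc n = Mult.1+× n 1#

  fromℤ : ℤ → Carrier
  fromℤ (+ n)    = ι n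
  fromℤ -[1+ n ] = - ι (suc n)

  cancel-1 : ∀ a b → (1# + a) - (1# + b) ≈ a - b
  cancel-1 a b = begin
    (1# + a) - (1# + b)      ≈⟨ +-congˡ (sym (⁻¹-∙-comm 1# b)) ⟩
    (1# + a) + (- 1# - b)    ≈⟨ +-congʳ (+-comm 1# a) ⟩
    (a + 1#) + (- 1# - b)    ≈⟨ +-assoc a 1# _ ⟩
    a + (1# + (- 1# - b))    ≈⟨ +-congˡ (sym (+-assoc 1# (- 1#) (- b))) ⟩
    a + ((1# - 1#) - b)      ≈⟨ +-congˡ (+-congʳ (-‿inverseʳ 1#)) ⟩
    a + (0# - b)             ≈⟨ +-congˡ (+-identityˡ (- b)) ⟩
    a - b ∎

  fromℤ-⊖ : ∀ m n → fromℤ (m ⊖ n) ≈ ι m - ι n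
  fromℤ-⊖ zero    zero    = sym (-‿inverseʳ 0#)
  fromℤ-⊖ zero    (suc n) = sym (+-identityˡ _)
  fromℤ-⊖ (suc m) zero    = sym (trans (+-congˡ -0#≈0#) (+-identityʳ _))
  fromℤ-⊖ (suc m) (suc n) = begin
    fromℤ (suc m ⊖ suc n) ≡⟨ ≡.cong fromℤ (ℤ.[1+m]⊖[1+n]≡m⊖n m n) ⟩
    fromℤ (m ⊖ n)         ≈⟨ fromℤ-⊖ m n ⟩
    ι m - ι n             ≈⟨ sym (cancel-1 (ι m) (ι n)) ⟩
    (1# + ι m) - (1# + ι n) ≈⟨ +-cong (sym (ι-suc m)) (-‿cong (sym (ι-suc n))) ⟩
    ι (suc m) - ι (suc n) ∎

  fromℤ-+ : ∀ i j → fromℤ (i ℤ.+ j) ≈ fromℤ i + fromℤ j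
  fromℤ-+ (+ m)    (+ n)    = ι-+ m n
  fromℤ-+ (+ m)    -[1+ n ] = fromℤ-⊖ m (suc n)
  fromℤ-+ -[1+ m ] (+ n)    = trans (fromℤ-⊖ n (suc m)) (+-comm _ _)
  fromℤ-+ -[1+ m ] -[1+ n ] = begin
    - ι (suc (suc (m ℕ.+ n)))     ≡⟨ ≡.cong (λ k → - ι k) (≡.sym (ℕ.+-suc (suc m) n)) ⟩
    - ι (suc m ℕ.+ suc n)         ≈⟨ -‿cong (ι-+ (suc m) (suc n)) ⟩
    - (ι (suc m) + ι (suc n))     ≈⟨ sym (⁻¹-∙-comm _ _) ⟩
    - ι (suc m) - ι (suc n) ∎

  fromℤ-neg : ∀ i → fromℤ (ℤ.- i) ≈ - fromℤ i
  fromℤ-neg (+ zero)  = sym -0#≈0#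
  fromℤ-neg (+ suc n) = refl
  fromℤ-neg -[1+ n ]  = sym (-‿involutive _)

  fromℤ-pos* : ∀ m j → fromℤ (+ m ℤ.* j) ≈ ι m * fromℤ j
  fromℤ-pos* m (+ n)    = trans (reflexive (≡.cong fromℤ (≡.sym (ℤ.pos-* m n)))) (ι-* m n)
  fromℤ-pos* m -[1+ n ] = begin
    fromℤ (+ m ℤ.* (ℤ.- + suc n))   ≡⟨ ≡.cong fromℤ (≡.sym (ℤ.neg-distribʳ-* (+ m) (+ suc n))) ⟩
    fromℤ (ℤ.- (+ m ℤ.* + suc n))   ≈⟨ fromℤ-neg (+ m ℤ.* + suc n) ⟩
    - fromℤ (+ m ℤ.* + suc n)       ≈⟨ -‿cong (fromℤ-pos* m (+ suc n)) ⟩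
    - (ι m * ι (suc n))             ≈⟨ -‿distribʳ-* _ _ ⟩
    ι m * - ι (suc n) ∎

  fromℤ-* : ∀ i j → fromℤ (i ℤ.* j) ≈ fromℤ i * fromℤ j
  fromℤ-* (+ m)    j = fromℤ-pos* m j
  fromℤ-* -[1+ m ] j = begin
    fromℤ ((ℤ.- + suc m) ℤ.* j)     ≡⟨ ≡.cong fromℤ (≡.sym (ℤ.neg-distribˡ-* (+ suc m) j)) ⟩
    fromℤ (ℤ.- (+ suc m ℤ.* j))     ≈⟨ fromℤ-neg (+ suc m ℤ.* j) ⟩
    - fromℤ (+ suc m ℤ.* j)         ≈⟨ -‿cong (fromℤ-pos* (suc m) j) ⟩
    - (ι (suc m) * fromℤ j)         ≈⟨ -‿distribˡ-* _ _ ⟩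
    - ι (suc m) * fromℤ j ∎

  ℤ⟶R : ℤ.+-*-rawRing -Raw-AlmostCommutative⟶ fromCommutativeRing R
  ℤ⟶R = record
    { ⟦_⟧ = fromℤ ; +-homo = fromℤ-+ ; *-homo = fromℤ-* ; -‿homo = fromℤ-neg
    ; 0-homo = refl ; 1-homo = refl }

  -- The map from the integers into a ring may fail to be injective, so different integers are left
  -- undecided; recognising equal ones is enough to normalise.
  fromℤ-≟ : ∀ i j → Maybe (fromℤ i ≈ fromℤ j)
  fromℤ-≟ i j with i ℤ.≟ j
  ... | yes i≡j = just (reflexive (≡.cong fromℤ i≡j))
  ... | no  _   = nothing

  open import Algebra.Solver.Ring ℤ.+-*-rawRing (fromCommutativeRing R) ℤ⟶R fromℤ-≟ public
    using (solve; prove; con; var; _:+_; _:*_; _:-_; :-_; _:^_; _:=_; Polynomial)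

  :ι : ∀ {n} → ℕ → Polynomial n
  :ι k = con (+ k)

-- Finite sums and the Kronecker delta.

-- The sum is opaque so that unification treats ∑ as injective.
module Summation (R : CommutativeRing 0ℓ 0ℓ) where
  open CommutativeRing R hiding (zero)
  open Integers R
  open import Algebra.Properties.Semiring.Sum semiring as Sum using (sum)
  open import Data.Bool.Base using (if_then_else_)
  open import Data.Empty using (⊥-elim)
  open import Data.Fin.Base using (Fin; zero; suc)
  import Data.Fin.Properties as Fin
  open import Function.Base using (_∘_)
  open import Relation.Binary.PropositionalEquality as ≡ using (_≡_; _≢_)
  open import Relation.Nullary using (does; yes; no)
  open import Relation.Binary.Reasoning.Setoid setoid

  opaque
    ∑ : ∀ {n} → (Fin n → Carrier) → Carrier
    ∑ = sum

    ∑-zero : (f : Fin 0 → Carrier) → ∑ f ≈ 0#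
    ∑-zero f = refl

    ∑-suc : ∀ {n} (f : Fin (suc n) → Carrier) → ∑ f ≈ f zero + ∑ (f ∘ suc)
    ∑-suc f = refl

    ∑-cong : ∀ {n} {f g : Fin n → Carrier} → (∀ i → f i ≈ g i) → ∑ f ≈ ∑ g
    ∑-cong = Sum.sum-cong-≋

    ∑-+ : ∀ {n} (f g : Fin n → Carrier) → ∑ (λ i → f i + g i) ≈ ∑ f + ∑ g
    ∑-+ = Sum.∑-distrib-+

    ∑-comm : ∀ {m n} (f : Fin m → Fin n → Carrier) → ∑ (λ i → ∑ (f i)) ≈ ∑ (λ j → ∑ λ i → f i j)
    ∑-comm = Sum.∑-comm

    *-∑ : ∀ {n} x (f : Fin n → Carrier) → x * ∑ f ≈ ∑ (λ i → x * f i)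
    *-∑ = Sum.*-distribˡ-sum

    ∑-* : ∀ {n} x (f : Fin n → Carrier) → ∑ f * x ≈ ∑ (λ i → f i * x)
    ∑-* = Sum.*-distribʳ-sum

    ∑-0 : ∀ {n} {f : Fin n → Carrier} → (∀ i → f i ≈ 0#) → ∑ f ≈ 0#
    ∑-0 {n} f≈0 = trans (Sum.sum-cong-≋ f≈0) (Sum.sum-replicate-zero n)

  ∑-neg : ∀ {n} (f : Fin n → Carrier) → ∑ (λ i → - f i) ≈ - ∑ f
  ∑-neg f = begin
    ∑ (λ i → - f i)        ≈⟨ ∑-cong (λ i → solve 1 (λ x → :- x := (:- :ι 1) :* x) refl (f i)) ⟩
    ∑ (λ i → - 1# * f i)   ≈⟨ sym (*-∑ (- 1#) f) ⟩
    - 1# * ∑ f             ≈⟨ solve 1 (λ x → (:- :ι 1) :* x := :- x) refl (∑ f) ⟩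
    - ∑ f ∎

  ∑-sub : ∀ {n} (f g : Fin n → Carrier) → ∑ (λ i → f i - g i) ≈ ∑ f - ∑ g
  ∑-sub f g = trans (∑-+ f (λ i → - g i)) (+-congˡ (∑-neg g))

  ∑-const : ∀ n x → ∑ {n} (λ _ → x) ≈ ι n * x
  ∑-const zero    x = trans (∑-zero _) (sym (zeroˡ x))
  ∑-const (suc n) x = begin
    ∑ {suc n} (λ _ → x)  ≈⟨ ∑-suc _ ⟩
    x + ∑ {n} (λ _ → x)  ≈⟨ +-congˡ (∑-const n x) ⟩
    x + ι n * x          ≈⟨ solve 2 (λ x m → x :+ m :* x := (:ι 1 :+ m) :* x) refl x (ι n) ⟩
    (1# + ι n) * x       ≈⟨ *-congʳ (sym (ι-suc n)) ⟩
    ι (suc n) * x ∎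

  δ : ∀ {n} → Fin n → Fin n → Carrier
  δ i j = if does (i Fin.≟ j) then 1# else 0#

  δ-diag : ∀ {n} (i : Fin n) → δ i i ≡ 1#
  δ-diag i with i Fin.≟ i
  ... | yes _   = ≡.refl
  ... | no  i≢i = ⊥-elim (i≢i ≡.refl)

  δ-off : ∀ {n} {i j : Fin n} → i ≢ j → δ i j ≡ 0#
  δ-off {i = i} {j} i≢j with i Fin.≟ j
  ... | yes i≡j = ⊥-elim (i≢j i≡j)
  ... | no  _   = ≡.refl

  δ-suc : ∀ {n} (i j : Fin n) → δ (suc i) (suc j) ≡ δ i j
  δ-suc i j with i Fin.≟ j
  ... | yes _ = ≡.refl
  ... | no  _ = ≡.refl

  δ-sym : ∀ {n} (i j : Fin n) → δ i j ≡ δ j i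
  δ-sym i j with i Fin.≟ j | j Fin.≟ i
  ... | yes _   | yes _   = ≡.refl
  ... | no _    | no _    = ≡.refl
  ... | yes i≡j | no j≢i  = ⊥-elim (j≢i (≡.sym i≡j))
  ... | no i≢j  | yes j≡i = ⊥-elim (i≢j (≡.sym j≡i))

  δ-replace : ∀ {n} (i j : Fin n) (f : Fin n → Carrier) → δ i j * f j ≈ δ i j * f i
  δ-replace i j f with i Fin.≟ j
  ... | yes ≡.refl = refl
  ... | no  _      = trans (zeroˡ _) (sym (zeroˡ _))

  ∑-δˡ : ∀ {n} (i : Fin n) (f : Fin n → Carrier) → ∑ (λ j → δ i j * f j) ≈ f i
  ∑-δˡ {suc n} zero f = begin
    ∑ (λ j → δ zero j * f j)           ≈⟨ ∑-suc _ ⟩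
    1# * f zero + ∑ (λ j → 0# * f (suc j))
      ≈⟨ +-cong (*-identityˡ _) (∑-0 λ j → zeroˡ (f (suc j))) ⟩
    f zero + 0# ≈⟨ +-identityʳ _ ⟩
    f zero ∎
  ∑-δˡ {suc n} (suc i) f = begin
    ∑ (λ j → δ (suc i) j * f j)        ≈⟨ ∑-suc _ ⟩
    0# * f zero + ∑ (λ j → δ (suc i) (suc j) * f (suc j))
      ≈⟨ +-cong (zeroˡ _) (∑-cong λ j → *-congʳ (reflexive (δ-suc i j))) ⟩
    0# + ∑ (λ j → δ i j * f (suc j))
      ≈⟨ trans (+-identityˡ _) (∑-δˡ i (f ∘ suc)) ⟩
    f (suc i) ∎

  ∑-δʳ : ∀ {n} (i : Fin n) (f : Fin n → Carrier) → ∑ (λ j → f j * δ i j) ≈ f i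
  ∑-δʳ i f = trans (∑-cong λ j → *-comm (f j) (δ i j)) (∑-δˡ i f)

  -- The exchange of sums behind the linearity of `det` in a row: `j` runs over the columns of the
  -- Laplace expansion, `l` over a linear combination of rows.
  ∑-swap-scale : ∀ {m n} (x : Fin n → Carrier) (c : Fin m → Carrier) (F : Fin n → Fin m → Carrier) →
    ∑ (λ j → x j * ∑ (λ l → c l * F j l)) ≈ ∑ (λ l → c l * ∑ (λ j → x j * F j l))
  ∑-swap-scale x c F = begin
    ∑ (λ j → x j * ∑ (λ l → c l * F j l))
      ≈⟨ (∑-cong λ j → *-∑ (x j) (λ l → c l * F j l)) ⟩
    ∑ (λ j → ∑ (λ l → x j * (c l * F j l)))
      ≈⟨ ∑-comm (λ j l → x j * (c l * F j l)) ⟩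
    ∑ (λ l → ∑ (λ j → x j * (c l * F j l)))
      ≈⟨ (∑-cong λ l → ∑-cong λ j →
           solve 3 (λ x c f → x :* (c :* f) := c :* (x :* f)) refl (x j) (c l) (F j l)) ⟩
    ∑ (λ l → ∑ (λ j → c l * (x j * F j l)))
      ≈⟨ (∑-cong λ l → sym (*-∑ (c l) (λ j → x j * F j l))) ⟩
    ∑ (λ l → c l * ∑ (λ j → x j * F j l)) ∎

-- Determinants by Laplace expansion: alternation and the adjugate.

module Det (R : CommutativeRing 0ℓ 0ℓ) where
  open CommutativeRing R hiding (zero)
  open Integers R
  open Summation R
  open import Algebra.Definitions.RawMonoid (CommutativeRing.*-rawMonoid R) using () renaming (sum to product)
  open import Algebra.Properties.Semiring.Exp semiring using (_^_)
  open import Data.Empty using (⊥-elim)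
  open import Data.Fin.Base as Fin using (Fin; zero; suc; toℕ; punchIn)
  import Data.Fin.Properties as Fin
  open import Data.Vec.Functional using (Vector; updateAt)
  open import Function.Base using (const; _∘_)
  open import Relation.Binary.PropositionalEquality as ≡ using (_≡_; _≢_)
  open import Relation.Nullary using (Dec; yes; no)
  open import Relation.Binary.Reasoning.Setoid setoid

  Matrix : ℕ → Set
  Matrix n = Fin n → Fin n → Carrier

  minor : ∀ {m n} → (Fin (suc m) → Fin (suc n) → Carrier) → Fin (suc n) → Fin m → Fin n → Carrier
  minor A j i k = A (suc i) (punchIn j k)

  det : ∀ {n} → Matrix n → Carrier
  det {zero}  A = 1#
  det {suc n} A = ∑ λ j → (- 1#) ^ toℕ j * A zero j * det (λ i k → A (suc i) (punchIn j k))

  det-cong : ∀ {n} {A B : Matrix n} → (∀ i j → A i j ≈ B i j) → det A ≈ det B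
  det-cong {zero}  A≈B = refl
  det-cong {suc n} A≈B = ∑-cong λ j →
    *-cong (*-congˡ (A≈B zero j)) (det-cong λ i k → A≈B (suc i) (punchIn j k))

  infixl 10 _[_≔_]
  _[_≔_] : ∀ {m n} → (Fin m → Vector Carrier n) → Fin m → Vector Carrier n → Fin m → Vector Carrier n
  A [ i ≔ v ] = updateAt A i (const v)

  ≔-here : ∀ {m n} (A : Fin m → Vector Carrier n) i v → (A [ i ≔ v ]) i ≡ v
  ≔-here A zero    v = ≡.refl
  ≔-here A (suc i) v = ≔-here (A ∘ suc) i v

  ≔-there : ∀ {m n} (A : Fin m → Vector Carrier n) {i k} v → k ≢ i → (A [ i ≔ v ]) k ≡ A k
  ≔-there A {zero}  {zero}  v k≢i = ⊥-elim (k≢i ≡.refl)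
  ≔-there A {zero}  {suc k} v k≢i = ≡.refl
  ≔-there A {suc i} {zero}  v k≢i = ≡.refl
  ≔-there A {suc i} {suc k} v k≢i = ≔-there (A ∘ suc) v (k≢i ∘ ≡.cong suc)

  ≔-self : ∀ {m n} (A : Fin m → Vector Carrier n) i k → (A [ i ≔ A i ]) k ≡ A k
  ≔-self A i k with k Fin.≟ i
  ... | yes ≡.refl = ≔-here A i (A i)
  ... | no  k≢i    = ≔-there A (A i) k≢i

  ≔-cong : ∀ {m n} (A : Fin m → Vector Carrier n) i {u v : Vector Carrier n} → (∀ j → u j ≈ v j) →
    ∀ k j → (A [ i ≔ u ]) k j ≈ (A [ i ≔ v ]) k j
  ≔-cong A zero    u≈v zero    j = u≈v j
  ≔-cong A zero    u≈v (suc k) j = refl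
  ≔-cong A (suc i) u≈v zero    j = refl
  ≔-cong A (suc i) u≈v (suc k) j = ≔-cong (A ∘ suc) i u≈v k j

  ≔-restrict : ∀ {m n p} (A : Fin m → Vector Carrier n) i v (g : Fin p → Fin n) k j →
    (A [ i ≔ v ]) k (g j) ≡ ((λ k → A k ∘ g) [ i ≔ v ∘ g ]) k j
  ≔-restrict A zero    v g zero    j = ≡.refl
  ≔-restrict A zero    v g (suc k) j = ≡.refl
  ≔-restrict A (suc i) v g zero    j = ≡.refl
  ≔-restrict A (suc i) v g (suc k) j = ≔-restrict (A ∘ suc) i v g k j

  det-≔-suc : ∀ {n} (A : Matrix (suc n)) i v →
    det (A [ suc i ≔ v ]) ≈
    ∑ λ j → (- 1#) ^ toℕ j * A zero j * det (minor A j [ i ≔ v ∘ punchIn j ])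
  det-≔-suc A i v = ∑-cong λ j → *-congˡ {x = (- 1#) ^ toℕ j * A zero j}
    (det-cong λ k l → reflexive (≔-restrict (A ∘ suc) i v (punchIn j) k l))

  -- For row 0 this is the linearity of the Laplace sum; a later row persists in every minor, so
  -- induction applies.
  det-row-linear : ∀ {m n} (A : Matrix n) i (c : Vector Carrier m) (u : Fin m → Vector Carrier n) →
    det (A [ i ≔ (λ k → ∑ λ l → c l * u l k) ]) ≈ ∑ λ l → c l * det (A [ i ≔ u l ])
  det-row-linear {m} {suc n} A zero c u = begin
    ∑ (λ j → (- 1#) ^ toℕ j * ∑ (λ l → c l * u l j) * det (minor A j))
      ≈⟨ (∑-cong λ j → trans
            (solve 3 (λ s y d → s :* y :* d := s :* d :* y) refl ((- 1#) ^ toℕ j) (∑ λ l → c l * u l j) (det (minor A j)))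
            refl) ⟩
    ∑ (λ j → (- 1#) ^ toℕ j * det (minor A j) * ∑ (λ l → c l * u l j))
      ≈⟨ ∑-swap-scale (λ j → (- 1#) ^ toℕ j * det (minor A j)) c (λ j l → u l j) ⟩
    ∑ (λ l → c l * ∑ (λ j → (- 1#) ^ toℕ j * det (minor A j) * u l j))
      ≈⟨ (∑-cong λ l → *-congˡ {x = c l} (∑-cong λ j →
            solve 3 (λ s d y → s :* d :* y := s :* y :* d) refl ((- 1#) ^ toℕ j) (det (minor A j)) (u l j))) ⟩
    ∑ (λ l → c l * ∑ (λ j → (- 1#) ^ toℕ j * u l j * det (minor A j))) ∎
  det-row-linear {m} {suc n} A (suc i) c u = begin
    det (A [ suc i ≔ (λ k → ∑ λ l → c l * u l k) ])
      ≈⟨ det-≔-suc A i _ ⟩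
    ∑ (λ j → x j * det (minor A j [ i ≔ (λ k → ∑ λ l → c l * u l (punchIn j k)) ]))
      ≈⟨ (∑-cong λ j → *-congˡ {x = x j} (det-row-linear (minor A j) i c (λ l → u l ∘ punchIn j))) ⟩
    ∑ (λ j → x j * ∑ (λ l → c l * det (minor A j [ i ≔ u l ∘ punchIn j ])))
      ≈⟨ ∑-swap-scale x c (λ j l → det (minor A j [ i ≔ u l ∘ punchIn j ])) ⟩
    ∑ (λ l → c l * ∑ (λ j → x j * det (minor A j [ i ≔ u l ∘ punchIn j ])))
      ≈⟨ (∑-cong λ l → *-congˡ {x = c l} (sym (det-≔-suc A i (u l)))) ⟩
    ∑ (λ l → c l * det (A [ suc i ≔ u l ])) ∎
    where
    x : Vector Carrier (suc n)
    x j = (- 1#) ^ toℕ j * A zero j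

  -- Removing the columns j and then k (of the rest) is the same as removing
  -- punchIn j k and then back j k.
  back : ∀ {n} → Fin (suc n) → Fin n → Fin n
  back zero    zero    = zero
  back zero    (suc k) = zero
  back (suc j) zero    = j
  back (suc j) (suc k) = suc (back j k)

  punchIn-back : ∀ {n} (j : Fin (suc n)) (k : Fin n) → punchIn (punchIn j k) (back j k) ≡ j
  punchIn-back zero    zero    = ≡.refl
  punchIn-back zero    (suc k) = ≡.refl
  punchIn-back (suc j) zero    = ≡.refl
  punchIn-back (suc j) (suc k) = ≡.cong suc (punchIn-back j k)

  punchIn-punchIn : ∀ {n} (j : Fin (suc (suc n))) (k : Fin (suc n)) (m : Fin n) →
    punchIn (punchIn j k) (punchIn (back j k) m) ≡ punchIn j (punchIn k m)
  punchIn-punchIn zero    zero    m       = ≡.refl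
  punchIn-punchIn zero    (suc k) m       = ≡.refl
  punchIn-punchIn (suc j) zero    m       = ≡.refl
  punchIn-punchIn (suc j) (suc k) zero    = ≡.refl
  punchIn-punchIn (suc j) (suc k) (suc m) = ≡.cong suc (punchIn-punchIn j k m)

  sign : ∀ {n} → Fin n → Carrier
  sign j = (- 1#) ^ toℕ j

  -- Deleting the same two columns in the other order costs a sign: the source of all antisymmetry
  -- of `det`.
  sign-back : ∀ {n} (j : Fin (suc n)) (k : Fin n) →
    sign (punchIn j k) * sign (back j k) ≈ - (sign j * sign k)
  sign-back zero zero =
    solve 1 (λ x → (:- :ι 1 :* x) :* x := :- (x :* x)) refl 1#
  sign-back zero (suc k) =
    solve 1 (λ s → (:- :ι 1 :* (:- :ι 1 :* s)) :* :ι 1 := :- (:ι 1 :* (:- :ι 1 :* s))) refl (sign k)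
  sign-back (suc j) zero =
    solve 1 (λ s → :ι 1 :* s := :- ((:- :ι 1 :* s) :* :ι 1)) refl (sign j)
  sign-back (suc j) (suc k) = begin
    - 1# * sign (punchIn j k) * (- 1# * sign (back j k))
      ≈⟨ solve 2 (λ s t → :- :ι 1 :* s :* (:- :ι 1 :* t) := s :* t) refl (sign (punchIn j k)) (sign (back j k)) ⟩
    sign (punchIn j k) * sign (back j k)
      ≈⟨ sign-back j k ⟩
    - (sign j * sign k)
      ≈⟨ solve 2 (λ s t → :- (s :* t) := :- (:- :ι 1 :* s :* (:- :ι 1 :* t))) refl (sign j) (sign k) ⟩
    - (- 1# * sign j * (- 1# * sign k)) ∎

  -- The map from `(j , k)` to `(punchIn j k , back j k)` is an involution without fixed points, so
  -- the terms cancel in pairs. Pairing `F zero k` with `F (suc k) zero` instead of dividing by 2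
  -- keeps this valid in every commutative ring.
  ∑∑-antisym : ∀ {n} (F : Fin (suc n) → Fin n → Carrier) →
    (∀ j k → F (punchIn j k) (back j k) ≈ - F j k) → ∑ (λ j → ∑ (F j)) ≈ 0#
  ∑∑-antisym {zero}  F anti = ∑-0 λ j → ∑-zero (F j)
  ∑∑-antisym {suc n} F anti = begin
    ∑ (λ j → ∑ (F j))
      ≈⟨ ∑-suc (λ j → ∑ (F j)) ⟩
    ∑ (F zero) + ∑ (λ j → ∑ (F (suc j)))
      ≈⟨ +-congˡ (∑-cong λ j → ∑-suc (F (suc j))) ⟩
    ∑ (F zero) + ∑ (λ j → F (suc j) zero + ∑ (λ k → F (suc j) (suc k)))
      ≈⟨ +-congˡ (∑-+ (λ j → F (suc j) zero) _) ⟩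
    ∑ (F zero) + (∑ (λ j → F (suc j) zero) + ∑ (λ j → ∑ (λ k → F (suc j) (suc k))))
      ≈⟨ sym (+-assoc _ _ _) ⟩
    ∑ (F zero) + ∑ (λ j → F (suc j) zero) + ∑ (λ j → ∑ (λ k → F (suc j) (suc k)))
      ≈⟨ +-cong (trans (sym (∑-+ (F zero) (λ j → F (suc j) zero))) (∑-0 pair))
                (∑∑-antisym (λ j k → F (suc j) (suc k)) (λ j k → anti (suc j) (suc k))) ⟩
    0# + 0# ≈⟨ +-identityˡ 0# ⟩
    0# ∎
    where
    pair : ∀ k → F zero k + F (suc k) zero ≈ 0#
    pair k = trans (+-congˡ (eq k)) (-‿inverseʳ (F zero k))
      where
      eq : ∀ k → F (suc k) zero ≈ - F zero k
      eq zero    = anti zero zero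
      eq (suc k) = anti zero (suc k)

  -- In the expansion along rows 0 and 1, the two orders of choosing a pair of columns leave the
  -- same minor and carry opposite signs.
  det-alt₀₁ : ∀ {n} (A : Matrix (suc (suc n))) → (∀ j → A zero j ≈ A (suc zero) j) → det A ≈ 0#
  det-alt₀₁ {n} A A₀≈A₁ = begin
    det A
      ≈⟨ (∑-cong λ j → *-∑ (sign j * a j) (λ k → sign k * A (suc zero) (punchIn j k) * M j k)) ⟩
    ∑ (λ j → ∑ (λ k → sign j * a j * (sign k * A (suc zero) (punchIn j k) * M j k)))
      ≈⟨ (∑-cong λ j → ∑-cong λ k → *-congˡ (*-congʳ (*-congˡ (sym (A₀≈A₁ (punchIn j k)))))) ⟩
    ∑ (λ j → ∑ (λ k → F j k))
      ≈⟨ ∑∑-antisym F anti ⟩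
    0# ∎
    where
    a = A zero
    M : Fin (suc (suc n)) → Fin (suc n) → Carrier
    M j k = det (λ i m → A (suc (suc i)) (punchIn j (punchIn k m)))
    F : Fin (suc (suc n)) → Fin (suc n) → Carrier
    F j k = sign j * a j * (sign k * a (punchIn j k) * M j k)
    anti : ∀ j k → F (punchIn j k) (back j k) ≈ - F j k
    anti j k = begin
      sign j′ * a j′ * (sign k′ * a (punchIn j′ k′) * M j′ k′)
        ≈⟨ *-congˡ (*-cong (*-congˡ (reflexive (≡.cong a (punchIn-back j k))))
             (det-cong λ i m → reflexive (≡.cong (A (suc (suc i))) (punchIn-punchIn j k m)))) ⟩
      sign j′ * a j′ * (sign k′ * a j * M j k)
        ≈⟨ solve 5 (λ s a t b m → s :* a :* (t :* b :* m) := s :* t :* (b :* a :* m)) refl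
             (sign j′) (a j′) (sign k′) (a j) (M j k) ⟩
      sign j′ * sign k′ * (a j * a j′ * M j k)
        ≈⟨ *-congʳ (sign-back j k) ⟩
      - (sign j * sign k) * (a j * a j′ * M j k)
        ≈⟨ solve 5 (λ s t b a m → :- (s :* t) :* (b :* a :* m) := :- (s :* b :* (t :* a :* m))) refl
             (sign j) (sign k) (a j) (a j′) (M j k) ⟩
      - F j k ∎
      where
      j′ = punchIn j k
      k′ = back j k

  Alternating : ℕ → Set
  Alternating n = ∀ (A : Matrix n) i k → i ≢ k → (∀ j → A i j ≈ A k j) → det A ≈ 0#

  -- Rows 0 and k are reduced to rows 0 and 1: by the induction hypothesis the
  -- determinant is alternating, hence antisymmetric, in the rows 1 and k.
  det-alt₀ : ∀ {n} → Alternating n → (A : Matrix (suc n)) → ∀ k → (∀ j → A zero j ≈ A (suc k) j) → det A ≈ 0#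
  det-alt₀ {suc n} _ A zero A₀≈A₁ = det-alt₀₁ A A₀≈A₁
  det-alt₀ {suc n} alt A (suc k) A₀≈Aₖ = begin
    det A          ≈⟨ det-cong A≈Fba ⟩
    F b a          ≈⟨ sym (+-identityˡ _) ⟩
    0# + F b a     ≈⟨ +-congʳ (sym (det-alt₀₁ (G a b) λ j → refl)) ⟩
    F a b + F b a  ≈⟨ Fab+Fba ⟩
    0#             ∎
    where
    a = A zero
    b = A (suc zero)
    G : Vector Carrier (suc (suc n)) → Vector Carrier (suc (suc n)) → Matrix (suc (suc n))
    G x y = A [ suc zero ≔ x ] [ suc (suc k) ≔ y ]
    F : Vector Carrier (suc (suc n)) → Vector Carrier (suc (suc n)) → Carrier
    F x y = det (G x y)
    A≈Fba : ∀ i j → A i j ≈ G b a i j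
    A≈Fba zero j = refl
    A≈Fba (suc zero) j = refl
    A≈Fba (suc (suc i)) j with i Fin.≟ k
    ... | yes ≡.refl = trans (sym (A₀≈Aₖ j)) (reflexive (≡.cong (λ v → v j)
                         (≡.sym (≔-here (λ i → A (suc (suc i))) i a))))
    ... | no i≢k = reflexive (≡.cong (λ v → v j) (≡.sym (≔-there (λ i → A (suc (suc i))) a i≢k)))
    two : ∀ (c : Fin 2 → Carrier) → ∑ c ≈ c zero + c (suc zero)
    two c = trans (∑-suc c) (+-congˡ (trans (∑-suc _) (trans (+-congˡ (∑-zero _)) (+-identityʳ _))))
    pr : Vector Carrier (suc (suc n)) → Vector Carrier (suc (suc n)) → Fin 2 → Vector Carrier (suc (suc n))
    pr x y zero    = x
    pr x y (suc _) = y
    add : ∀ (B : Matrix (suc (suc n))) i x y →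
      det (B [ i ≔ (λ j → x j + y j) ]) ≈ det (B [ i ≔ x ]) + det (B [ i ≔ y ])
    add B i x y = begin
      det (B [ i ≔ (λ j → x j + y j) ])
        ≈⟨ det-cong (≔-cong B i λ j → sym (trans (two _) (+-cong (*-identityˡ _) (*-identityˡ _)))) ⟩
      det (B [ i ≔ (λ j → ∑ λ l → 1# * pr x y l j) ])
        ≈⟨ det-row-linear B i (λ _ → 1#) (pr x y) ⟩
      ∑ (λ l → 1# * det (B [ i ≔ pr x y l ]))
        ≈⟨ trans (two _) (+-cong (*-identityˡ _) (*-identityˡ _)) ⟩
      det (B [ i ≔ x ]) + det (B [ i ≔ y ]) ∎
    -- Both replaced rows persist in every minor of row 0, so the induction hypothesis applies to
    -- these minors.
    Fxx : ∀ x → F x x ≈ 0#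
    Fxx x = ∑-0 λ j → trans (*-congˡ
      (alt (minor (G x x) j) zero (suc k) (λ ()) λ l →
        reflexive (≡.cong (λ v → v (punchIn j l)) (≡.sym (≔-here (λ i → A (suc (suc i))) k x)))))
      (zeroʳ _)
    swap₁ : ∀ x y i j → (A [ suc zero ≔ x ] [ suc (suc k) ≔ y ]) i j ≡ (A [ suc (suc k) ≔ y ] [ suc zero ≔ x ]) i j
    swap₁ x y zero j = ≡.refl
    swap₁ x y (suc zero) j = ≡.refl
    swap₁ x y (suc (suc i)) j = ≡.refl
    add₁ : ∀ x y z → F (λ j → x j + y j) z ≈ F x z + F y z
    add₁ x y z = begin
      F (λ j → x j + y j) z ≈⟨ det-cong (λ i j → reflexive (swap₁ (λ j → x j + y j) z i j)) ⟩
      det (A [ suc (suc k) ≔ z ] [ suc zero ≔ (λ j → x j + y j) ]) ≈⟨ add (A [ suc (suc k) ≔ z ]) (suc zero) x y ⟩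
      det (A [ suc (suc k) ≔ z ] [ suc zero ≔ x ]) + det (A [ suc (suc k) ≔ z ] [ suc zero ≔ y ])
        ≈⟨ +-cong (det-cong (λ i j → reflexive (≡.sym (swap₁ x z i j))))
                  (det-cong (λ i j → reflexive (≡.sym (swap₁ y z i j)))) ⟩
      F x z + F y z ∎
    add₂ : ∀ x y z → F z (λ j → x j + y j) ≈ F z x + F z y
    add₂ x y z = add (A [ suc zero ≔ z ]) (suc (suc k)) x y
    Fab+Fba : F a b + F b a ≈ 0#
    Fab+Fba = begin
      F a b + F b a
        ≈⟨ sym (trans (+-cong (+-congʳ (Fxx a)) (+-congˡ (Fxx b)))
             (+-cong (+-identityˡ _) (+-identityʳ _))) ⟩
      (F a a + F a b) + (F b a + F b b)
        ≈⟨ sym (+-cong (add₂ a b a) (add₂ a b b)) ⟩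
      F a (λ j → a j + b j) + F b (λ j → a j + b j)
        ≈⟨ sym (add₁ a b (λ j → a j + b j)) ⟩
      F (λ j → a j + b j) (λ j → a j + b j)
        ≈⟨ Fxx (λ j → a j + b j) ⟩
      0# ∎

  det-alt : ∀ n → Alternating n
  det-alt (suc n) A zero    zero    i≢k _     = ⊥-elim (i≢k ≡.refl)
  det-alt (suc n) A zero    (suc k) _   A₀≈Aₖ = det-alt₀ (det-alt n) A k A₀≈Aₖ
  det-alt (suc n) A (suc i) zero    _   Aᵢ≈A₀ = det-alt₀ (det-alt n) A i (λ j → sym (Aᵢ≈A₀ j))
  det-alt (suc n) A (suc i) (suc k) i≢k Aᵢ≈Aₖ = ∑-0 λ j → trans
    (*-congˡ (det-alt n (minor A j) i k (i≢k ∘ ≡.cong suc) (Aᵢ≈Aₖ ∘ punchIn j))) (zeroʳ _)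

  det-set-row : ∀ {n} (A : Matrix n) i v → det (A [ i ≔ v ]) ≈ ∑ λ j → v j * det (A [ i ≔ δ j ])
  det-set-row A i v = begin
    det (A [ i ≔ v ])
      ≈⟨ det-cong (≔-cong A i λ k → sym (trans (∑-cong λ l → *-congˡ (reflexive (δ-sym l k))) (∑-δʳ k v))) ⟩
    det (A [ i ≔ (λ k → ∑ λ l → v l * δ l k) ])
      ≈⟨ det-row-linear A i v δ ⟩
    ∑ (λ j → v j * det (A [ i ≔ δ j ])) ∎

  -- The cofactor of the entry `(i , j)`, encoded with a unit vector as row `i`: there are no signs
  -- or minors to handle, and `det-set-row` becomes the expansion along an arbitrary row.
  adjugate : ∀ {n} → Matrix n → Matrix n
  adjugate A j i = det (A [ i ≔ δ j ])

  -- Writing row `k` in place of row `i` gives `A` itself if `k = i`, and a matrix with two equal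
  -- rows otherwise.
  *-adjugate : ∀ {n} (A : Matrix n) k i → ∑ (λ j → A k j * adjugate A j i) ≈ δ k i * det A
  *-adjugate {n} A k i = trans (sym (det-set-row A i (A k))) (value (k Fin.≟ i))
    where
    value : Dec (k ≡ i) → det (A [ i ≔ A k ]) ≈ δ k i * det A
    value (yes ≡.refl) = begin
      det (A [ i ≔ A i ]) ≈⟨ det-cong (λ l j → reflexive (≡.cong (λ v → v j) (≔-self A i l))) ⟩
      det A               ≈⟨ sym (*-identityˡ _) ⟩
      1# * det A          ≈⟨ *-congʳ (reflexive (≡.sym (δ-diag i))) ⟩
      δ i i * det A ∎
    value (no k≢i) = begin
      det (A [ i ≔ A k ])
        ≈⟨ det-alt n (A [ i ≔ A k ]) k i k≢i (λ j → reflexive (≡.cong (λ v → v j)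
             (≡.trans (≔-there A (A k) k≢i) (≡.sym (≔-here A i (A k)))))) ⟩
      0#            ≈⟨ sym (zeroˡ _) ⟩
      0# * det A    ≈⟨ *-congʳ (reflexive (≡.sym (δ-off k≢i))) ⟩
      δ k i * det A ∎

  det-diagonal : ∀ {n} (A : Matrix n) → (∀ i j → i ≢ j → A i j ≈ 0#) → det A ≈ product (λ i → A i i)
  det-diagonal {zero}  A _   = refl
  det-diagonal {suc n} A off = begin
    det A ≈⟨ ∑-suc _ ⟩
    1# * A zero zero * det (minor A zero) + ∑ (λ j → sign (suc j) * A zero (suc j) * det (minor A (suc j)))
      ≈⟨ +-cong (*-cong (*-identityˡ _) (det-diagonal (minor A zero) λ i j i≢j → off (suc i) (suc j) (i≢j ∘ Fin.suc-injective)))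
                (∑-0 λ j → trans (*-congʳ (trans (*-congˡ (off zero (suc j) λ ())) (zeroʳ _))) (zeroˡ _)) ⟩
    A zero zero * product (λ i → A (suc i) (suc i)) + 0# ≈⟨ +-identityʳ _ ⟩
    A zero zero * product (λ i → A (suc i) (suc i)) ∎

-- Axioms of the real numbers.

-- The argument runs over an abstract structure because conversion checking
-- between concrete Cauchy sequences is infeasible.
record RealRing : Set₁ where
  infix 4 _≤_
  field
    commutativeRing : CommutativeRing 0ℓ 0ℓ
  open CommutativeRing commutativeRing
  open Integers commutativeRing using (ι)
  field
    _≤_             : Carrier → Carrier → Set
    ≤-reflexive     : ∀ {x y} → x ≈ y → x ≤ y
    ≤-trans         : ∀ {x y z} → x ≤ y → y ≤ z → x ≤ z
    ≤-antisym       : ∀ {x y} → x ≤ y → y ≤ x → x ≈ y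
    +-mono-≤        : ∀ {x y u v} → x ≤ y → u ≤ v → x + u ≤ y + v
    *-nonNeg        : ∀ {x y} → 0# ≤ x → 0# ≤ y → 0# ≤ x * y
    square-nonNeg   : ∀ x → 0# ≤ x * x
    -- A substitute for deciding signs: the rules for the absolute value and all comparisons with
    -- square roots go through squares.
    square-cancel-≤ : ∀ {x y} → 0# ≤ y → x * x ≤ y * y → x ≤ y
    ∣_∣             : Carrier → Carrier
    ∣∣-nonNeg       : ∀ x → 0# ≤ ∣ x ∣
    ∣∣-square       : ∀ x → ∣ x ∣ * ∣ x ∣ ≈ x * x
    1/suc           : ℕ → Carrier
    1/suc-inverse   : ∀ k → ι (suc k) * 1/suc k ≈ 1#
    archimedean     : ∀ {x y} → (∀ k → x ≤ y + 1/suc k) → x ≤ y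
    bounded         : ∀ x → ∃[ N ] x ≤ ι N
    √               : ℕ → Carrier
    √-nonNeg        : ∀ n → 0# ≤ √ n
    √-square        : ∀ n → √ n * √ n ≈ ι n

-- Ordered ring arithmetic, absolute values and bounds of sums.

module Order (𝓡 : RealRing) where
  open RealRing 𝓡 public
  open CommutativeRing commutativeRing hiding (zero) public
  open Integers commutativeRing public
  open Summation commutativeRing public
  open import Algebra.Properties.Ring ring public using (-‿involutive; -0#≈0#)
  open import Data.Fin.Base using (Fin; zero; suc)
  open import Function.Base using (_∘_)
  open import Relation.Binary.Structures using (IsPreorder)

  ≤-refl : ∀ {x} → x ≤ x
  ≤-refl = ≤-reflexive refl

  ≤-isPreorder : IsPreorder _≈_ _≤_
  ≤-isPreorder = record { isEquivalence = isEquivalence ; reflexive = ≤-reflexive ; trans = ≤-trans }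

  open import Relation.Binary.Reasoning.Base.Double ≤-isPreorder public

  ≤-respˡ : ∀ {x y z} → x ≈ y → x ≤ z → y ≤ z
  ≤-respˡ x≈y x≤z = ≤-trans (≤-reflexive (sym x≈y)) x≤z

  ≤-respʳ : ∀ {x y z} → y ≈ z → x ≤ y → x ≤ z
  ≤-respʳ y≈z x≤y = ≤-trans x≤y (≤-reflexive y≈z)

  +-nonNeg : ∀ {x y} → 0# ≤ x → 0# ≤ y → 0# ≤ x + y
  +-nonNeg 0≤x 0≤y = ≤-respˡ (+-identityˡ 0#) (+-mono-≤ 0≤x 0≤y)

  -- The usual form of the estimates below: the difference is displayed as a nonnegative expression,
  -- and the solver checks the identity.
  ≤-by : ∀ {x y} z → 0# ≤ z → y ≈ x + z → x ≤ y
  ≤-by {x} z 0≤z y≈x+z = ≤-respˡ (+-identityʳ x) (≤-respʳ (sym y≈x+z) (+-mono-≤ ≤-refl 0≤z))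

  x≤y⇒0≤y-x : ∀ {x y} → x ≤ y → 0# ≤ y - x
  x≤y⇒0≤y-x {x} x≤y = ≤-respˡ (-‿inverseʳ x) (+-mono-≤ x≤y ≤-refl)

  0≤y-x⇒x≤y : ∀ {x y} → 0# ≤ y - x → x ≤ y
  0≤y-x⇒x≤y {x} {y} h = ≤-by (y - x) h (solve 2 (λ x y → y := x :+ (y :- x)) refl x y)

  neg-mono-≤ : ∀ {x y} → x ≤ y → - y ≤ - x
  neg-mono-≤ {x} {y} x≤y = ≤-by (y - x) (x≤y⇒0≤y-x x≤y) (solve 2 (λ x y → :- x := :- y :+ (y :- x)) refl x y)

  +-monoˡ-≤ : ∀ {x y} z → x ≤ y → x + z ≤ y + z
  +-monoˡ-≤ z x≤y = +-mono-≤ x≤y ≤-refl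

  +-monoʳ-≤ : ∀ {x y} z → x ≤ y → z + x ≤ z + y
  +-monoʳ-≤ z x≤y = +-mono-≤ ≤-refl x≤y

  *-monoˡ-≤ : ∀ {x y c} → 0# ≤ c → x ≤ y → c * x ≤ c * y
  *-monoˡ-≤ {x} {y} {c} 0≤c x≤y = ≤-by (c * (y - x)) (*-nonNeg 0≤c (x≤y⇒0≤y-x x≤y))
    (solve 3 (λ c x y → c :* y := c :* x :+ c :* (y :- x)) refl c x y)

  *-mono-≤ : ∀ {x y u v} → 0# ≤ y → 0# ≤ u → x ≤ y → u ≤ v → x * u ≤ y * v
  *-mono-≤ {x} {y} {u} {v} 0≤y 0≤u x≤y u≤v = ≤-trans
    (≤-respˡ (*-comm u x) (≤-respʳ (*-comm u y) (*-monoˡ-≤ 0≤u x≤y))) (*-monoˡ-≤ 0≤y u≤v)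

  0≤1 : 0# ≤ 1#
  0≤1 = ≤-respʳ (*-identityˡ 1#) (square-nonNeg 1#)

  ι-nonNeg : ∀ n → 0# ≤ ι n
  ι-nonNeg zero    = ≤-refl
  ι-nonNeg (suc n) = ≤-respʳ (sym (ι-suc n)) (+-nonNeg 0≤1 (ι-nonNeg n))

  ι-mono : ∀ {m n} → m ℕ.≤ n → ι m ≤ ι n
  ι-mono {n = n} ℕ.z≤n = ι-nonNeg n
  ι-mono {suc m} {suc n} (ℕ.s≤s m≤n) = ≤-respˡ (sym (ι-suc m)) (≤-respʳ (sym (ι-suc n)) (+-monoʳ-≤ 1# (ι-mono m≤n)))

  1/suc-nonNeg : ∀ k → 0# ≤ 1/suc k
  1/suc-nonNeg k = ≤-respʳ
    (trans (sym (*-assoc _ _ _)) (trans (*-congʳ (1/suc-inverse k)) (*-identityˡ _)))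
    (*-nonNeg (ι-nonNeg (suc k)) (square-nonNeg (1/suc k)))

  1/suc-cancel : ∀ k x → 1/suc k * (ι (suc k) * x) ≈ x
  1/suc-cancel k x = trans (sym (*-assoc _ _ _)) (trans (*-congʳ (trans (*-comm _ _) (1/suc-inverse k))) (*-identityˡ x))

  ι-cancel-≤ : ∀ k {x y} → ι (suc k) * x ≤ ι (suc k) * y → x ≤ y
  ι-cancel-≤ k {x} {y} h = ≤-respˡ (1/suc-cancel k x) (≤-respʳ (1/suc-cancel k y) (*-monoˡ-≤ (1/suc-nonNeg k) h))

  archimedean-scaled : ∀ {x y} c → (∀ k → x ≤ y + c * 1/suc k) → x ≤ y
  archimedean-scaled {x} {y} c h with bounded c
  ... | N , c≤N = archimedean step
    where
    step : ∀ k → x ≤ y + 1/suc k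
    step k = ≤-trans (h k′) (+-monoʳ-≤ y (begin
      c * 1/suc k′                  ≲⟨ *-mono-≤ (ι-nonNeg (suc N)) (1/suc-nonNeg k′) (≤-trans c≤N (ι-mono {N} {suc N} (ℕ.n≤1+n N))) ≤-refl ⟩
      ι (suc N) * 1/suc k′          ≈⟨ *-congˡ (sym (1/suc-cancel k (1/suc k′))) ⟩
      ι (suc N) * (1/suc k * (ι (suc k) * 1/suc k′))
        ≈⟨ solve 4 (λ a b c d → a :* (b :* (c :* d)) := c :* a :* d :* b) refl (ι (suc N)) (1/suc k) (ι (suc k)) (1/suc k′) ⟩
      ι (suc k) * ι (suc N) * 1/suc k′ * 1/suc k
        ≈⟨ *-congʳ (trans (*-congʳ (sym (ι-* (suc k) (suc N)))) (1/suc-inverse k′)) ⟩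
      1# * 1/suc k                  ≈⟨ *-identityˡ _ ⟩
      1/suc k ∎))
      where
      import Data.Nat.Properties as ℕ
      -- Chosen so that `suc k′` computes to `suc k * suc N`.
      k′ = N ℕ.+ k ℕ.* suc N

  x≤∣x∣ : ∀ x → x ≤ ∣ x ∣
  x≤∣x∣ x = square-cancel-≤ (∣∣-nonNeg x) (≤-reflexive (sym (∣∣-square x)))

  -x≤∣x∣ : ∀ x → - x ≤ ∣ x ∣
  -x≤∣x∣ x = square-cancel-≤ (∣∣-nonNeg x) (≤-reflexive
    (trans (solve 1 (λ x → :- x :* :- x := x :* x) refl x) (sym (∣∣-square x))))

  ∣∣-≤ : ∀ {x y} → 0# ≤ y → x ≤ y → - x ≤ y → ∣ x ∣ ≤ y
  ∣∣-≤ {x} {y} 0≤y x≤y -x≤y = square-cancel-≤ 0≤y (≤-by ((y - x) * (y - - x))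
    (*-nonNeg (x≤y⇒0≤y-x x≤y) (x≤y⇒0≤y-x -x≤y))
    (trans (solve 2 (λ x y → y :* y := x :* x :+ (y :- x) :* (y :- :- x)) refl x y) (+-congʳ (sym (∣∣-square x)))))

  ∣∣-square-≤ : ∀ {x y} → 0# ≤ y → x * x ≤ y * y → ∣ x ∣ ≤ y
  ∣∣-square-≤ {x} 0≤y h = square-cancel-≤ 0≤y (≤-respˡ (sym (∣∣-square x)) h)

  ∣∣-cong : ∀ {x y} → x ≈ y → ∣ x ∣ ≈ ∣ y ∣
  ∣∣-cong {x} {y} x≈y = ≤-antisym (half x≈y) (half (sym x≈y))
    where
    half : ∀ {x y} → x ≈ y → ∣ x ∣ ≤ ∣ y ∣
    half {x} {y} x≈y = ∣∣-square-≤ (∣∣-nonNeg y) (≤-reflexive (trans (*-cong x≈y x≈y) (sym (∣∣-square y))))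

  ∣∣-+ : ∀ x y → ∣ x + y ∣ ≤ ∣ x ∣ + ∣ y ∣
  ∣∣-+ x y = ∣∣-≤ (+-nonNeg (∣∣-nonNeg x) (∣∣-nonNeg y)) (+-mono-≤ (x≤∣x∣ x) (x≤∣x∣ y))
    (≤-respˡ (solve 2 (λ x y → :- x :+ :- y := :- (x :+ y)) refl x y) (+-mono-≤ (-x≤∣x∣ x) (-x≤∣x∣ y)))

  ∣∣-* : ∀ x y → ∣ x * y ∣ ≈ ∣ x ∣ * ∣ y ∣
  ∣∣-* x y = ≤-antisym (∣∣-square-≤ 0≤z (≤-reflexive eq))
    (square-cancel-≤ (∣∣-nonNeg (x * y)) (≤-reflexive (trans (sym eq) (sym (∣∣-square (x * y))))))
    where
    0≤z = *-nonNeg (∣∣-nonNeg x) (∣∣-nonNeg y)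
    eq : (x * y) * (x * y) ≈ (∣ x ∣ * ∣ y ∣) * (∣ x ∣ * ∣ y ∣)
    eq = trans (solve 2 (λ x y → (x :* y) :* (x :* y) := (x :* x) :* (y :* y)) refl x y)
      (trans (*-cong (sym (∣∣-square x)) (sym (∣∣-square y)))
        (solve 2 (λ x y → (x :* x) :* (y :* y) := (x :* y) :* (x :* y)) refl ∣ x ∣ ∣ y ∣))

  ∣∣-neg : ∀ x → ∣ - x ∣ ≈ ∣ x ∣
  ∣∣-neg x = ≤-antisym
    (∣∣-square-≤ (∣∣-nonNeg x) (≤-reflexive (trans (solve 1 (λ x → :- x :* :- x := x :* x) refl x) (sym (∣∣-square x)))))
    (∣∣-square-≤ (∣∣-nonNeg (- x)) (≤-reflexive (trans (solve 1 (λ x → x :* x := :- x :* :- x) refl x) (sym (∣∣-square (- x))))))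

  ∣∣-of-nonNeg : ∀ {x} → 0# ≤ x → ∣ x ∣ ≈ x
  ∣∣-of-nonNeg {x} 0≤x = ≤-antisym (∣∣-square-≤ 0≤x ≤-refl) (x≤∣x∣ x)

  ∣x∣≤0⇒x≈0 : ∀ {x} → ∣ x ∣ ≤ 0# → x ≈ 0#
  ∣x∣≤0⇒x≈0 {x} h = ≤-antisym (≤-trans (x≤∣x∣ x) h)
    (≤-respʳ (-‿involutive x) (≤-respˡ -0#≈0# (neg-mono-≤ (≤-trans (-x≤∣x∣ x) h))))

  ∑-mono : ∀ {n} {f g : Fin n → Carrier} → (∀ i → f i ≤ g i) → ∑ f ≤ ∑ g
  ∑-mono {zero}  f≤g = ≤-reflexive (trans (∑-zero _) (sym (∑-zero _)))
  ∑-mono {suc n} f≤g = ≤-respˡ (sym (∑-suc _)) (≤-respʳ (sym (∑-suc _)) (+-mono-≤ (f≤g zero) (∑-mono (f≤g ∘ suc))))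

  ∑-nonNeg : ∀ {n} {f : Fin n → Carrier} → (∀ i → 0# ≤ f i) → 0# ≤ ∑ f
  ∑-nonNeg {n} {f} 0≤f = ≤-respˡ (∑-0 {n} {λ _ → 0#} λ _ → refl) (∑-mono 0≤f)

  ∑-bound : ∀ {n} {f : Fin n → Carrier} c → (∀ i → f i ≤ c) → ∑ f ≤ ι n * c
  ∑-bound {n} c f≤c = ≤-respʳ (∑-const n c) (∑-mono f≤c)

  ∣∣-∑ : ∀ {n} (f : Fin n → Carrier) → ∣ ∑ f ∣ ≤ ∑ (λ i → ∣ f i ∣)
  ∣∣-∑ {zero}  f = ≤-reflexive (trans (∣∣-cong (∑-zero f)) (trans (∣∣-of-nonNeg ≤-refl) (sym (∑-zero _))))
  ∣∣-∑ {suc n} f = begin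
    ∣ ∑ f ∣                               ≈⟨ ∣∣-cong (∑-suc f) ⟩
    ∣ f zero + ∑ (f ∘ suc) ∣              ≲⟨ ∣∣-+ _ _ ⟩
    ∣ f zero ∣ + ∣ ∑ (f ∘ suc) ∣          ≲⟨ +-monoʳ-≤ _ (∣∣-∑ (f ∘ suc)) ⟩
    ∣ f zero ∣ + ∑ (λ i → ∣ f (suc i) ∣)  ≈⟨ sym (∑-suc _) ⟩
    ∑ (λ i → ∣ f i ∣) ∎

  term≤∑ : ∀ {n} {f : Fin n → Carrier} → (∀ i → 0# ≤ f i) → ∀ i → f i ≤ ∑ f
  term≤∑ {suc n} {f} 0≤f zero = ≤-by (∑ (f ∘ suc)) (∑-nonNeg (0≤f ∘ suc)) (∑-suc f)
  term≤∑ {suc n} {f} 0≤f (suc i) = ≤-trans (term≤∑ (0≤f ∘ suc) i)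
    (≤-by (f zero) (0≤f zero) (trans (∑-suc f) (+-comm _ _)))

  bound-all : ∀ {n} (f : Fin n → Carrier) → ∃[ N ] ∀ i → f i ≤ ι N
  bound-all {zero}  f = 0 , λ ()
  bound-all {suc n} f with bounded (f zero) | bound-all (f ∘ suc)
  ... | M , h₀ | N , h = M ℕ.+ N , λ
    { zero    → ≤-trans h₀ (ι-mono {M} (ℕ.m≤m+n M N))
    ; (suc i) → ≤-trans (h i) (ι-mono {N} (ℕ.m≤n+m N M)) }
    where import Data.Nat.Properties as ℕ

-- Traces of powers from the characteristic polynomial.

module PowerTraces (𝓡 : RealRing) where
  open Order 𝓡
  open Det commutativeRing
  open import Algebra.Definitions.RawMonoid *-rawMonoid using () renaming (sum to product)
  open import Algebra.Properties.Semiring.Exp semiring using (_^_)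
  open import Data.Fin.Base as Fin using (Fin; zero; suc; punchIn)
  import Data.Fin.Properties as Fin
  open import Data.Nat.Base as ℕ using (ℕ; zero; suc; _!)
  import Data.Nat.Properties as ℕ
  open import Data.Vec.Functional using (Vector; updateAt)
  open import Function.Base using (const; _∘_)
  open import Relation.Binary.PropositionalEquality as ≡ using (_≡_)
  open import Relation.Nullary using (yes; no)

  ∣sign∣ : ∀ {n} (j : Fin n) → ∣ sign j ∣ ≈ 1#
  ∣sign∣ zero    = ∣∣-of-nonNeg 0≤1
  ∣sign∣ (suc j) = trans (∣∣-* (- 1#) (sign j))
    (trans (*-cong (trans (∣∣-neg 1#) (∣∣-of-nonNeg 0≤1)) (∣sign∣ j)) (*-identityˡ 1#))

  product-nonNeg : ∀ {n} (ρ : Vector Carrier n) → (∀ i → 0# ≤ ρ i) → 0# ≤ product ρ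
  product-nonNeg {zero}  ρ 0≤ρ = 0≤1
  product-nonNeg {suc n} ρ 0≤ρ = *-nonNeg (0≤ρ zero) (product-nonNeg (ρ ∘ suc) (0≤ρ ∘ suc))

  product-mono : ∀ {n} (ρ σ : Vector Carrier n) → (∀ i → 0# ≤ ρ i) → (∀ i → ρ i ≤ σ i) → product ρ ≤ product σ
  product-mono {zero}  ρ σ 0≤ρ ρ≤σ = ≤-refl
  product-mono {suc n} ρ σ 0≤ρ ρ≤σ = *-mono-≤ (≤-trans (0≤ρ zero) (ρ≤σ zero))
    (product-nonNeg (ρ ∘ suc) (0≤ρ ∘ suc)) (ρ≤σ zero) (product-mono (ρ ∘ suc) (σ ∘ suc) (0≤ρ ∘ suc) (ρ≤σ ∘ suc))

  product-const : ∀ n x → product {n} (λ _ → x) ≈ x ^ n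
  product-const zero    x = refl
  product-const (suc n) x = *-congˡ (product-const n x)

  product-cong : ∀ {n} {ρ σ : Vector Carrier n} → (∀ i → ρ i ≈ σ i) → product ρ ≈ product σ
  product-cong {zero}  ρ≈σ = refl
  product-cong {suc n} ρ≈σ = *-cong (ρ≈σ zero) (product-cong (ρ≈σ ∘ suc))

  product-updateAt : ∀ {n} (i : Fin (suc n)) x → product (updateAt (λ _ → x) i (const 1#)) ≈ x ^ n
  product-updateAt {n}     zero    x = trans (*-identityˡ _) (product-const n x)
  product-updateAt {suc n} (suc i) x = *-congˡ (product-updateAt i x)

  ^-nonNeg : ∀ {x} n → 0# ≤ x → 0# ≤ x ^ n
  ^-nonNeg zero    0≤x = 0≤1
  ^-nonNeg (suc n) 0≤x = *-nonNeg 0≤x (^-nonNeg n 0≤x)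

  ^-distrib-* : ∀ x y n → (x * y) ^ n ≈ x ^ n * y ^ n
  ^-distrib-* x y zero    = sym (*-identityˡ 1#)
  ^-distrib-* x y (suc n) = trans (*-congˡ (^-distrib-* x y n))
    (solve 4 (λ x y p q → (x :* y) :* (p :* q) := (x :* p) :* (y :* q)) refl x y (x ^ n) (y ^ n))

  ^-cancel-≤ : ∀ k n {x y} → ι (suc k) ^ n * x ≤ ι (suc k) ^ n * y → x ≤ y
  ^-cancel-≤ k zero    h = ≤-respˡ (*-identityˡ _) (≤-respʳ (*-identityˡ _) h)
  ^-cancel-≤ k (suc n) h = ^-cancel-≤ k n (ι-cancel-≤ k (≤-respˡ (*-assoc _ _ _) (≤-respʳ (*-assoc _ _ _) h)))

  -- The crude bound by `n !` products with one factor from each row. A separate bound for each row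
  -- lets a unit row count as 1.
  det-bound : ∀ {n} (A : Matrix n) (ρ : Vector Carrier n) → (∀ i → 0# ≤ ρ i) →
    (∀ i j → ∣ A i j ∣ ≤ ρ i) → ∣ det A ∣ ≤ ι (n !) * product ρ
  det-bound {zero}  A ρ 0≤ρ h = ≤-reflexive (trans (∣∣-of-nonNeg 0≤1) (sym (*-identityˡ 1#)))
  det-bound {suc n} A ρ 0≤ρ h = begin
    ∣ det A ∣
      ≲⟨ ∣∣-∑ (λ j → sign j * A zero j * det (minor A j)) ⟩
    ∑ (λ j → ∣ sign j * A zero j * det (minor A j) ∣)
      ≲⟨ ∑-bound (ρ zero * (ι (n !) * P)) term ⟩
    ι (suc n) * (ρ zero * (ι (n !) * P))
      ≈⟨ solve 4 (λ a r b p → a :* (r :* (b :* p)) := (a :* b) :* (r :* p)) refl (ι (suc n)) (ρ zero) (ι (n !)) P ⟩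
    ι (suc n) * ι (n !) * (ρ zero * P)
      ≈⟨ *-congʳ (sym (ι-* (suc n) (n !))) ⟩
    ι (suc n !) * product ρ ∎
    where
    P = product (ρ ∘ suc)
    term : ∀ j → ∣ sign j * A zero j * det (minor A j) ∣ ≤ ρ zero * (ι (n !) * P)
    term j = begin
      ∣ sign j * A zero j * det (minor A j) ∣
        ≈⟨ trans (∣∣-* _ _) (*-congʳ (trans (∣∣-* _ _) (trans (*-congʳ (∣sign∣ j)) (*-identityˡ _)))) ⟩
      ∣ A zero j ∣ * ∣ det (minor A j) ∣
        ≲⟨ *-mono-≤ (0≤ρ zero) (∣∣-nonNeg _) (h zero j)
             (det-bound (minor A j) (ρ ∘ suc) (0≤ρ ∘ suc) λ i k → h (suc i) (punchIn j k)) ⟩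
      ρ zero * (ι (n !) * P) ∎

  -- One row is a unit vector, hence the exponent `n` at order `n + 1`. This missing power makes the
  -- adjugate negligible against the characteristic polynomial.
  adjugate-bound : ∀ {n} (A : Matrix (suc n)) ρ → 0# ≤ ρ → (∀ i j → ∣ A i j ∣ ≤ ρ) →
    ∀ j i → ∣ adjugate A j i ∣ ≤ ι (suc n !) * ρ ^ n
  adjugate-bound {n} A ρ 0≤ρ h j i = ≤-trans (det-bound (A [ i ≔ δ j ]) ρs nonNeg rows)
    (≤-reflexive (*-congˡ (product-updateAt i ρ)))
    where
    open import Data.Vec.Functional.Properties using (updateAt-updates; updateAt-minimal)
    ρs = updateAt (λ _ → ρ) i (const 1#)
    0≤δ : ∀ (k l : Fin (suc n)) → 0# ≤ δ k l
    0≤δ k l with k Fin.≟ l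
    ... | yes _ = 0≤1
    ... | no  _ = ≤-refl
    δ≤1 : ∀ (k l : Fin (suc n)) → δ k l ≤ 1#
    δ≤1 k l with k Fin.≟ l
    ... | yes _ = ≤-refl
    ... | no  _ = 0≤1
    nonNeg : ∀ k → 0# ≤ ρs k
    nonNeg k with k Fin.≟ i
    ... | yes ≡.refl = ≤-respʳ (reflexive (≡.sym (updateAt-updates i (λ _ → ρ)))) 0≤1
    ... | no  k≢i    = ≤-respʳ (reflexive (≡.sym (updateAt-minimal k i (λ _ → ρ) k≢i))) 0≤ρ
    rows : ∀ k l → ∣ (A [ i ≔ δ j ]) k l ∣ ≤ ρs k
    rows k l with k Fin.≟ i
    ... | yes ≡.refl = ≤-respʳ (reflexive (≡.sym (updateAt-updates i (λ _ → ρ))))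
      (≤-respˡ (∣∣-cong (reflexive (≡.cong (λ v → v l) (≡.sym (≔-here A i (δ j))))))
        (≤-respˡ (sym (∣∣-of-nonNeg (0≤δ j l))) (δ≤1 j l)))
    ... | no  k≢i    = ≤-respʳ (reflexive (≡.sym (updateAt-minimal k i (λ _ → ρ) k≢i)))
      (≤-respˡ (∣∣-cong (reflexive (≡.cong (λ v → v l) (≡.sym (≔-there A (δ j) k≢i))))) (h k l))

  -- The derivative of `det` at `A` in direction `E`: the product rule applied to the Laplace
  -- expansion.
  ∂det : ∀ {n} → Matrix n → Matrix n → Carrier
  ∂det {zero}  A E = 0#
  ∂det {suc n} A E = ∑ λ j → sign j * (E zero j * det (minor A j) + A zero j * ∂det (minor A j) (minor E j))

  ∂det-rows : ∀ {n} (A E : Matrix n) → ∂det A E ≈ ∑ λ i → det (A [ i ≔ E i ])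
  ∂det-rows {zero}  A E = sym (∑-zero _)
  ∂det-rows {suc n} A E = begin-equality
    ∑ (λ j → sign j * (E zero j * det (minor A j) + A zero j * ∂det (minor A j) (minor E j)))
      ≈⟨ (∑-cong λ j → solve 5 (λ s e d a q → s :* (e :* d :+ a :* q) := s :* e :* d :+ s :* a :* q) refl
            (sign j) (E zero j) (det (minor A j)) (A zero j) (∂det (minor A j) (minor E j))) ⟩
    ∑ (λ j → sign j * E zero j * det (minor A j) + sign j * A zero j * ∂det (minor A j) (minor E j))
      ≈⟨ ∑-+ _ _ ⟩
    det (A [ zero ≔ E zero ]) + ∑ (λ j → sign j * A zero j * ∂det (minor A j) (minor E j))
      ≈⟨ +-congˡ (∑-cong λ j → trans (*-congˡ (∂det-rows (minor A j) (minor E j))) (*-∑ _ _)) ⟩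
    det (A [ zero ≔ E zero ]) + ∑ (λ j → ∑ λ i → sign j * A zero j * det (minor A j [ i ≔ minor E j i ]))
      ≈⟨ +-congˡ (∑-comm _) ⟩
    det (A [ zero ≔ E zero ]) + ∑ (λ i → ∑ λ j → sign j * A zero j * det (minor A j [ i ≔ minor E j i ]))
      ≈⟨ +-congˡ (∑-cong λ i → sym (det-≔-suc A i (E (suc i)))) ⟩
    det (A [ zero ≔ E zero ]) + ∑ (λ i → det (A [ suc i ≔ E (suc i) ]))
      ≈⟨ sym (∑-suc _) ⟩
    ∑ (λ i → det (A [ i ≔ E i ])) ∎

  -- A first-order Taylor expansion. The remainder `r` depends on `h` but its bound `C` does not,
  -- which is enough to identify derivatives while treating polynomials as mere functions.
  det-expansion : ∀ {n} (A E : Matrix n) → ∃[ C ] ∀ h → ∣ h ∣ ≤ 1# → ∃[ r ]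
    (∣ r ∣ ≤ C × det (λ i j → A i j + h * E i j) ≈ det A + h * ∂det A E + h * h * r)
  det-expansion {zero} A E = 0# , λ h _ → 0# , ≤-reflexive (∣∣-of-nonNeg ≤-refl) ,
    solve 2 (λ o h → o := o :+ h :* :ι 0 :+ h :* h :* :ι 0) refl 1# h
  det-expansion {suc n} A E = ∑ (λ j → c j) , λ h ∣h∣≤1 →
    let r = λ j → proj₁ (proj₂ (IH j) h ∣h∣≤1)
        ∣r∣≤ = λ j → proj₁ (proj₂ (proj₂ (IH j) h ∣h∣≤1))
        eq = λ j → proj₂ (proj₂ (proj₂ (IH j) h ∣h∣≤1))
        R = λ j → sign j * (E zero j * q j + A zero j * r j + h * E zero j * r j)
    in ∑ R
    , ≤-trans (∣∣-∑ R) (∑-mono λ j → begin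
        ∣ R j ∣
          ≈⟨ trans (∣∣-* _ _) (trans (*-congʳ (∣sign∣ j)) (*-identityˡ _)) ⟩
        ∣ E zero j * q j + A zero j * r j + h * E zero j * r j ∣
          ≲⟨ ≤-trans (∣∣-+ _ _) (+-monoˡ-≤ _ (∣∣-+ _ _)) ⟩
        ∣ E zero j * q j ∣ + ∣ A zero j * r j ∣ + ∣ h * E zero j * r j ∣
          ≈⟨ +-cong (+-cong (∣∣-* _ _) (∣∣-* _ _)) (trans (∣∣-* _ _) (*-congʳ (∣∣-* _ _))) ⟩
        ∣ E zero j ∣ * ∣ q j ∣ + ∣ A zero j ∣ * ∣ r j ∣ + ∣ h ∣ * ∣ E zero j ∣ * ∣ r j ∣
          ≲⟨ +-mono-≤ (+-monoʳ-≤ _ (*-monoˡ-≤ (∣∣-nonNeg _) (∣r∣≤ j)))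
              (*-mono-≤ (*-nonNeg 0≤1 (∣∣-nonNeg _)) (∣∣-nonNeg _)
                (*-mono-≤ 0≤1 (∣∣-nonNeg _) ∣h∣≤1 ≤-refl) (∣r∣≤ j)) ⟩
        c j ∎)
    , (begin-equality
        ∑ (λ j → sign j * (A zero j + h * E zero j) * det (λ i k → minor A j i k + h * minor E j i k))
          ≈⟨ (∑-cong λ j → trans (*-congˡ (eq j))
               (solve 7 (λ s a e h d q r →
                  s :* (a :+ h :* e) :* (d :+ h :* q :+ h :* h :* r) :=
                  s :* a :* d :+ h :* (s :* (e :* d :+ a :* q)) :+ h :* h :* (s :* (e :* q :+ a :* r :+ h :* e :* r))) refl
                  (sign j) (A zero j) (E zero j) h (det (minor A j)) (q j) (r j))) ⟩
        ∑ (λ j → sign j * A zero j * det (minor A j) + h * D j + h * h * R j)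
          ≈⟨ trans (∑-+ _ _) (+-cong (trans (∑-+ _ _) (+-congˡ (sym (*-∑ h D)))) (sym (*-∑ (h * h) R))) ⟩
        det A + h * ∂det A E + h * h * ∑ R ∎)
    where
    IH : ∀ j → _
    IH j = det-expansion (minor A j) (minor E j)
    q : Vector Carrier (suc n)
    q j = ∂det (minor A j) (minor E j)
    D : Vector Carrier (suc n)
    D j = sign j * (E zero j * det (minor A j) + A zero j * q j)
    c : Vector Carrier (suc n)
    c j = ∣ E zero j ∣ * ∣ q j ∣ + ∣ A zero j ∣ * proj₁ (IH j) + 1# * ∣ E zero j ∣ * proj₁ (IH j)

  infix 30 _⟨_⟩
  _⟨_⟩ : ∀ {n} → Matrix n → Carrier → Matrix n
  (M ⟨ x ⟩) i j = x * δ i j - M i j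

  charpoly : ∀ {n} → Matrix n → Carrier → Carrier
  charpoly M x = det (M ⟨ x ⟩)

  pow : ∀ {n} → Matrix n → ℕ → Matrix n
  pow M zero    = δ
  pow M (suc p) = λ i j → ∑ λ l → pow M p i l * M l j

  trace : ∀ {n} → Matrix n → Carrier
  trace M = ∑ λ i → M i i

  -- The trace of `Mᵖ adj (x - M)`: up to the factor `charpoly M x` the trace of `Mᵖ` times the
  -- resolvent, written without division.
  τ : ∀ {n} → Matrix n → ℕ → Carrier → Carrier
  τ M p x = ∑ λ i → ∑ λ k → pow M p i k * adjugate (M ⟨ x ⟩) k i

  -- Since (x - M) adj (x - M) = charpoly M x.
  τ-step : ∀ {n} (M : Matrix n) p x → τ M (suc p) x ≈ x * τ M p x - charpoly M x * trace (pow M p)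
  τ-step M p x = begin-equality
    ∑ (λ i → ∑ λ j → ∑ (λ k → P i k * M k j) * B j i)
      ≈⟨ (∑-cong λ i → row i) ⟩
    ∑ (λ i → x * ∑ (λ k → P i k * B k i) - φ * P i i)
      ≈⟨ ∑-sub _ _ ⟩
    ∑ (λ i → x * ∑ (λ k → P i k * B k i)) - ∑ (λ i → φ * P i i)
      ≈⟨ sym (+-cong (*-∑ x _) (-‿cong (*-∑ φ _))) ⟩
    x * τ M p x - φ * trace P ∎
    where
    P = pow M p
    φ = charpoly M x
    B = adjugate (M ⟨ x ⟩)
    adj : ∀ k i → ∑ (λ j → M k j * B j i) ≈ x * B k i - δ k i * φ
    adj k i = begin-equality
      ∑ (λ j → M k j * B j i)
        ≈⟨ (∑-cong λ j → solve 4 (λ x d m b → m :* b := x :* (d :* b) :- (x :* d :- m) :* b) refl x (δ k j) (M k j) (B j i)) ⟩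
      ∑ (λ j → x * (δ k j * B j i) - (M ⟨ x ⟩) k j * B j i)
        ≈⟨ ∑-sub _ _ ⟩
      ∑ (λ j → x * (δ k j * B j i)) - ∑ (λ j → (M ⟨ x ⟩) k j * B j i)
        ≈⟨ +-cong (trans (sym (*-∑ x _)) (*-congˡ (∑-δˡ k λ j → B j i))) (-‿cong (*-adjugate (M ⟨ x ⟩) k i)) ⟩
      x * B k i - δ k i * φ ∎
    row : ∀ i → ∑ (λ j → ∑ (λ k → P i k * M k j) * B j i) ≈ x * ∑ (λ k → P i k * B k i) - φ * P i i
    row i = begin-equality
      ∑ (λ j → ∑ (λ k → P i k * M k j) * B j i)
        ≈⟨ (∑-cong λ j → trans (∑-* (B j i) _) (∑-cong λ k → *-assoc _ _ _)) ⟩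
      ∑ (λ j → ∑ (λ k → P i k * (M k j * B j i)))
        ≈⟨ ∑-comm _ ⟩
      ∑ (λ k → ∑ (λ j → P i k * (M k j * B j i)))
        ≈⟨ (∑-cong λ k → trans (sym (*-∑ (P i k) _)) (*-congˡ (adj k i))) ⟩
      ∑ (λ k → P i k * (x * B k i - δ k i * φ))
        ≈⟨ (∑-cong λ k → solve 5 (λ p x b d f → p :* (x :* b :- d :* f) := x :* (p :* b) :- f :* (p :* d)) refl
              (P i k) x (B k i) (δ k i) φ) ⟩
      ∑ (λ k → x * (P i k * B k i) - φ * (P i k * δ k i))
        ≈⟨ ∑-sub _ _ ⟩
      ∑ (λ k → x * (P i k * B k i)) - ∑ (λ k → φ * (P i k * δ k i))
        ≈⟨ +-cong (sym (*-∑ x _)) (-‿cong (trans (sym (*-∑ φ _)) (*-congˡ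
             (trans (∑-cong λ k → *-congˡ (reflexive (δ-sym k i))) (∑-δʳ i (P i)))))) ⟩
      x * ∑ (λ k → P i k * B k i) - φ * P i i ∎

  τ-zero : ∀ {n} (M : Matrix n) x → τ M 0 x ≈ ∂det (M ⟨ x ⟩) δ
  τ-zero M x = trans (∑-cong λ i → ∑-δˡ i (λ k → adjugate (M ⟨ x ⟩) k i)) (sym (∂det-rows (M ⟨ x ⟩) δ))

  -- τ M 0 is the derivative of the characteristic polynomial, hence determined by it.
  τ-zero-unique : ∀ {n} (M N : Matrix n) → (∀ x → charpoly M x ≈ charpoly N x) → ∀ x → τ M 0 x ≈ τ N 0 x
  τ-zero-unique M N φ≈ x = trans (τ-zero M x) (trans equal (sym (τ-zero N x)))
    where
    dM = ∂det (M ⟨ x ⟩) δ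
    dN = ∂det (N ⟨ x ⟩) δ
    CM = proj₁ (det-expansion (M ⟨ x ⟩) δ)
    CN = proj₁ (det-expansion (N ⟨ x ⟩) δ)
    shift : ∀ (M : Matrix _) h → charpoly M (x + h) ≈ det (λ i j → (M ⟨ x ⟩) i j + h * δ i j)
    shift M h = det-cong λ i j → solve 4 (λ x h d m → (x :+ h) :* d :- m := x :* d :- m :+ h :* d) refl x h (δ i j) (M i j)
    1/suc≤1 : ∀ k → 1/suc k ≤ 1#
    1/suc≤1 k = ι-cancel-≤ k (≤-respˡ (sym (1/suc-inverse k))
      (≤-respʳ (sym (*-identityʳ _)) (ι-mono {1} {suc k} (ℕ.s≤s ℕ.z≤n))))
    -- The expansions of both matrices at `h = 1/suc k` share their value and constant term. Their
    -- difference, divided by `h`, compares the derivatives up to remainders of order `h`.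
    close : ∀ k → ∣ dM - dN ∣ ≤ 0# + (CM + CN) * 1/suc k
    close k with proj₂ (det-expansion (M ⟨ x ⟩) δ) (1/suc k) (≤-respˡ (sym (∣∣-of-nonNeg (1/suc-nonNeg k))) (1/suc≤1 k))
               | proj₂ (det-expansion (N ⟨ x ⟩) δ) (1/suc k) (≤-respˡ (sym (∣∣-of-nonNeg (1/suc-nonNeg k))) (1/suc≤1 k))
    ... | r , ∣r∣≤ , eqM | s , ∣s∣≤ , eqN = begin
      ∣ dM - dN ∣      ≈⟨ ∣∣-cong diff ⟩
      ∣ h * (s - r) ∣  ≈⟨ trans (∣∣-* _ _) (*-congʳ (∣∣-of-nonNeg (1/suc-nonNeg k))) ⟩
      h * ∣ s - r ∣    ≲⟨ *-monoˡ-≤ (1/suc-nonNeg k) (≤-trans (∣∣-+ s (- r))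
                            (+-mono-≤ ∣s∣≤ (≤-respˡ (sym (∣∣-neg r)) ∣r∣≤))) ⟩
      h * (CN + CM)    ≈⟨ solve 3 (λ h a b → h :* (b :+ a) := :ι 0 :+ (a :+ b) :* h) refl h CM CN ⟩
      0# + (CM + CN) * h ∎
      where
      h = 1/suc k
      eq : charpoly M x + h * dM + h * h * r ≈ charpoly N x + h * dN + h * h * s
      eq = trans (sym eqM) (trans (sym (shift M h)) (trans (φ≈ (x + h)) (trans (shift N h) eqN)))
      eq′ : h * (dM - dN) ≈ h * (h * (s - r))
      eq′ = begin-equality
        h * (dM - dN)
          ≈⟨ solve 5 (λ h p q r f → h :* (p :- q) := (f :+ h :* p :+ h :* h :* r) :- f :- h :* q :- h :* h :* r) refl h dM dN r (charpoly M x) ⟩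
        (charpoly M x + h * dM + h * h * r) - charpoly M x - h * dN - h * h * r
          ≈⟨ +-congʳ (+-congʳ (+-cong eq (-‿cong (φ≈ x)))) ⟩
        (charpoly N x + h * dN + h * h * s) - charpoly N x - h * dN - h * h * r
          ≈⟨ solve 5 (λ h q r s f → (f :+ h :* q :+ h :* h :* s) :- f :- h :* q :- h :* h :* r := h :* (h :* (s :- r))) refl h dN r s (charpoly N x) ⟩
        h * (h * (s - r)) ∎
      unit : ∀ z → ι (suc k) * (h * z) ≈ z
      unit z = trans (sym (*-assoc _ _ _)) (trans (*-congʳ (1/suc-inverse k)) (*-identityˡ z))
      diff : dM - dN ≈ h * (s - r)
      diff = trans (sym (unit _)) (trans (*-congˡ eq′) (unit _))
    equal : dM ≈ dN
    equal = begin-equality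
      dM              ≈⟨ solve 2 (λ a b → a := (a :- b) :+ b) refl dM dN ⟩
      (dM - dN) + dN  ≈⟨ +-congʳ (∣x∣≤0⇒x≈0 (archimedean-scaled (CM + CN) close)) ⟩
      0# + dN         ≈⟨ +-identityˡ dN ⟩
      dN ∎

  -- `τ` is linear in the entries of the adjugate, hence of order `n` where the characteristic
  -- polynomial has order `n + 1`. The offset `a` leaves room to evaluate beyond all eigenvalues.
  τ-bound : ∀ {n} (M : Matrix (suc n)) p a → ∃[ C ] ∀ k → ∣ τ M p (ι (a ℕ.+ suc k)) ∣ ≤ C * ι (suc k) ^ n
  τ-bound {n} M p a = C , λ k → let y = ι (suc k); x = ι (a ℕ.+ suc k); b = λ k i → adjugate (M ⟨ x ⟩) k i in begin
    ∣ τ M p x ∣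
      ≲⟨ ≤-trans (∣∣-∑ _) (∑-mono λ i → ∣∣-∑ _) ⟩
    ∑ (λ i → ∑ λ k → ∣ P i k * b k i ∣)
      ≲⟨ (∑-mono λ i → ∑-mono λ j → ≤-respˡ (sym (∣∣-* _ _)) (*-monoˡ-≤ (∣∣-nonNeg (P i j))
            (≤-trans (adjugate-bound (M ⟨ x ⟩) (ι K * y) (*-nonNeg (ι-nonNeg K) (ι-nonNeg (suc k))) (entry k) j i)
              (≤-reflexive (*-congˡ (^-distrib-* (ι K) y n)))))) ⟩
    ∑ (λ i → ∑ λ j → ∣ P i j ∣ * (ι (suc n !) * (ι K ^ n * y ^ n)))
      ≈⟨ (trans (∑-cong λ i → sym (∑-* _ _)) (sym (∑-* _ _))) ⟩
    ∑ (λ i → ∑ λ j → ∣ P i j ∣) * (ι (suc n !) * (ι K ^ n * y ^ n))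
      ≈⟨ solve 4 (λ s f k y → s :* (f :* (k :* y)) := s :* (f :* k) :* y) refl _ (ι (suc n !)) (ι K ^ n) (y ^ n) ⟩
    C * y ^ n ∎
    where
    P = pow M p
    E = bound-all (λ i → ι (proj₁ (bound-all (λ j → ∣ M i j ∣))))
    N₀ : ℕ
    N₀ = proj₁ E
    ∣M∣≤ : ∀ i j → ∣ M i j ∣ ≤ ι N₀
    ∣M∣≤ i j = ≤-trans (proj₂ (bound-all (λ j → ∣ M i j ∣)) j) (proj₂ E i)
    K = a ℕ.+ 1 ℕ.+ N₀
    C = ∑ (λ i → ∑ λ j → ∣ P i j ∣) * (ι (suc n !) * ι K ^ n)
    entry : ∀ k i j → ∣ (M ⟨ ι (a ℕ.+ suc k) ⟩) i j ∣ ≤ ι K * ι (suc k)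
    entry k i j = begin
      ∣ x * δ i j - M i j ∣        ≲⟨ ∣∣-+ _ _ ⟩
      ∣ x * δ i j ∣ + ∣ - M i j ∣  ≲⟨ +-mono-≤ (xδ≤x i j) (≤-respˡ (sym (∣∣-neg _)) (∣M∣≤ i j)) ⟩
      x + ι N₀                     ≈⟨ sym (ι-+ (a ℕ.+ suc k) N₀) ⟩
      ι (a ℕ.+ suc k ℕ.+ N₀)       ≲⟨ ι-mono {a ℕ.+ suc k ℕ.+ N₀} {K ℕ.* suc k} bound ⟩
      ι (K ℕ.* suc k)              ≈⟨ ι-* K (suc k) ⟩
      ι K * ι (suc k) ∎
      where
      x = ι (a ℕ.+ suc k)
      xδ≤x : ∀ (i j : Fin (suc n)) → ∣ x * δ i j ∣ ≤ x
      xδ≤x i j with i Fin.≟ j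
      ... | yes _ = ≤-reflexive (trans (∣∣-cong (*-identityʳ x)) (∣∣-of-nonNeg (ι-nonNeg (a ℕ.+ suc k))))
      ... | no  _ = ≤-respˡ (sym (trans (∣∣-cong (zeroʳ x)) (∣∣-of-nonNeg ≤-refl))) (ι-nonNeg (a ℕ.+ suc k))
      bound : a ℕ.+ suc k ℕ.+ N₀ ℕ.≤ K ℕ.* suc k
      bound = ℕ.≤-trans (ℕ.+-mono-≤ (ℕ.+-mono-≤ (ℕ.m≤m*n a (suc k)) (ℕ.≤-reflexive (≡.sym (ℕ.*-identityˡ (suc k))))) (ℕ.m≤m*n N₀ (suc k)))
        (ℕ.≤-reflexive (≡.sym (≡.trans (ℕ.*-distribʳ-+ (suc k) (a ℕ.+ 1) N₀) (≡.cong (ℕ._+ N₀ ℕ.* suc k) (ℕ.*-distribʳ-+ (suc k) a 1)))))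

  diagonal : ∀ {n} → Vector Carrier n → Matrix n
  diagonal μ i j = μ i * δ i j

  charpoly-diagonal : ∀ {n} (μ : Vector Carrier n) x → charpoly (diagonal μ) x ≈ product (λ i → x - μ i)
  charpoly-diagonal μ x = trans
    (det-diagonal (diagonal μ ⟨ x ⟩) λ i j i≢j → trans
      (+-cong (trans (*-congˡ (reflexive (δ-off i≢j))) (zeroʳ x)) (-‿cong (trans (*-congˡ (reflexive (δ-off i≢j))) (zeroʳ (μ i)))))
      (-‿inverseʳ 0#))
    (product-cong λ i → +-cong (trans (*-congˡ (reflexive (δ-diag i))) (*-identityʳ x))
                               (-‿cong (trans (*-congˡ (reflexive (δ-diag i))) (*-identityʳ (μ i)))))

  -- If the traces of the lower powers agree, then charpoly · (difference of the
  -- p-th traces) = O(xⁿ), while charpoly grows like xⁿ⁺¹.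
  trace-pow-unique : ∀ {n} (M : Matrix n) (μ : Vector Carrier n) →
    (∀ x → charpoly M x ≈ product (λ i → x - μ i)) →
    ∀ p → trace (pow M p) ≈ trace (pow (diagonal μ) p)
  trace-pow-unique {zero}  M μ _ p = trans (∑-zero _) (sym (∑-zero _))
  trace-pow-unique {suc n} M μ spec = λ p → traces p (τs p)
    where
    N = diagonal μ
    φ≈ : ∀ x → charpoly M x ≈ charpoly N x
    φ≈ x = trans (spec x) (sym (charpoly-diagonal μ x))
    -- An upper bound of all `μ i`: at `a + (k + 1)` each factor of the characteristic polynomial is
    -- at least `k + 1`.
    a : ℕ
    a = proj₁ (bound-all μ)
    φ-growth : ∀ k → ι (suc k) ^ suc n ≤ charpoly M (ι (a ℕ.+ suc k))
    φ-growth k = ≤-respʳ (sym (spec _)) (≤-respˡ (product-const (suc n) (ι (suc k)))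
      (product-mono (λ _ → ι (suc k)) (λ i → ι (a ℕ.+ suc k) - μ i) (λ _ → ι-nonNeg (suc k)) λ i →
        ≤-by (ι a - μ i) (x≤y⇒0≤y-x (proj₂ (bound-all μ) i))
          (trans (+-congʳ (ι-+ a (suc k))) (solve 3 (λ a y m → a :+ y :- m := y :+ (a :- m)) refl (ι a) (ι (suc k)) (μ i)))))
    traces : ∀ p → (∀ x → τ M p x ≈ τ N p x) → trace (pow M p) ≈ trace (pow N p)
    traces p τ≈ = begin-equality
      tM            ≈⟨ solve 2 (λ a b → a := (a :- b) :+ b) refl tM tN ⟩
      (tM - tN) + tN ≈⟨ +-congʳ (∣x∣≤0⇒x≈0 (archimedean-scaled (CM + CN) small)) ⟩
      0# + tN       ≈⟨ +-identityˡ tN ⟩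
      tN ∎
      where
      tM = trace (pow M p)
      tN = trace (pow N p)
      CM = proj₁ (τ-bound M (suc p) a)
      CN = proj₁ (τ-bound N (suc p) a)
      c = ∣ tM - tN ∣
      small : ∀ k → c ≤ 0# + (CM + CN) * 1/suc k
      small k = ι-cancel-≤ k (≤-respʳ (sym (trans
          (solve 3 (λ y C u → y :* (:ι 0 :+ C :* u) := y :* u :* C) refl y (CM + CN) (1/suc k))
          (trans (*-congʳ (1/suc-inverse k)) (*-identityˡ _))))
        (^-cancel-≤ k n (begin
          y ^ n * (y * c)      ≈⟨ solve 3 (λ p y c → p :* (y :* c) := (y :* p) :* c) refl (y ^ n) y c ⟩
          y ^ suc n * c        ≲⟨ *-mono-≤ (∣∣-nonNeg φ) (∣∣-nonNeg _) (≤-trans (φ-growth k) (x≤∣x∣ φ)) ≤-refl ⟩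
          ∣ φ ∣ * c            ≈⟨ sym (∣∣-* φ (tM - tN)) ⟩
          ∣ φ * (tM - tN) ∣    ≈⟨ ∣∣-cong diff ⟩
          ∣ τ N (suc p) x - τ M (suc p) x ∣ ≲⟨ ∣∣-+ _ _ ⟩
          ∣ τ N (suc p) x ∣ + ∣ - τ M (suc p) x ∣
            ≲⟨ +-mono-≤ (proj₂ (τ-bound N (suc p) a) k) (≤-respˡ (sym (∣∣-neg _)) (proj₂ (τ-bound M (suc p) a) k)) ⟩
          CN * y ^ n + CM * y ^ n  ≈⟨ solve 3 (λ a b p → b :* p :+ a :* p := p :* (a :+ b)) refl CM CN (y ^ n) ⟩
          y ^ n * (CM + CN) ∎)))
        where
        y = ι (suc k)
        x = ι (a ℕ.+ suc k)
        φ = charpoly M x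
        diff : φ * (tM - tN) ≈ τ N (suc p) x - τ M (suc p) x
        diff = begin-equality
          φ * (tM - tN)
            ≈⟨ solve 4 (λ f s t z → f :* (s :- t) := (z :- f :* t) :- (z :- f :* s)) refl φ tM tN (x * τ M p x) ⟩
          (x * τ M p x - φ * tN) - (x * τ M p x - φ * tM)
            ≈⟨ +-cong (+-cong (*-congˡ (τ≈ x)) (-‿cong (*-congʳ (φ≈ x)))) refl ⟩
          (x * τ N p x - charpoly N x * tN) - (x * τ M p x - φ * tM)
            ≈⟨ sym (+-cong (τ-step N p x) (-‿cong (τ-step M p x))) ⟩
          τ N (suc p) x - τ M (suc p) x ∎
    -- The induction interleaves two facts: equality of `τ` at `p` forces equal traces of the powers
    -- `p` by comparison of growth, and both together give `τ` at `p + 1` by `τ-step`.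
    τs : ∀ p x → τ M p x ≈ τ N p x
    τs zero    = τ-zero-unique M N φ≈
    τs (suc p) x = begin-equality
      τ M (suc p) x                                ≈⟨ τ-step M p x ⟩
      x * τ M p x - charpoly M x * trace (pow M p) ≈⟨ +-cong (*-congˡ (τs p x)) (-‿cong (*-cong (φ≈ x) (traces p (τs p)))) ⟩
      x * τ N p x - charpoly N x * trace (pow N p) ≈⟨ sym (τ-step N p x) ⟩
      τ N (suc p) x ∎

  pow-diagonal : ∀ {n} (μ : Vector Carrier n) p i j → pow (diagonal μ) p i j ≈ μ i ^ p * δ i j
  pow-diagonal μ zero    i j = sym (*-identityˡ _)
  pow-diagonal μ (suc p) i j = begin-equality
    ∑ (λ l → pow (diagonal μ) p i l * (μ l * δ l j))
      ≈⟨ (∑-cong λ l → trans (*-congʳ (trans (pow-diagonal μ p i l) (*-comm _ _))) (*-assoc _ _ _)) ⟩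
    ∑ (λ l → δ i l * (μ i ^ p * (μ l * δ l j)))
      ≈⟨ ∑-δˡ i _ ⟩
    μ i ^ p * (μ i * δ i j)
      ≈⟨ solve 3 (λ p m d → p :* (m :* d) := m :* p :* d) refl (μ i ^ p) (μ i) (δ i j) ⟩
    μ i ^ suc p * δ i j ∎

  trace-pow : ∀ {n} (M : Matrix n) (μ : Vector Carrier n) →
    (∀ x → charpoly M x ≈ product (λ i → x - μ i)) →
    ∀ p → trace (pow M p) ≈ ∑ (λ i → μ i ^ p)
  trace-pow M μ spec p = trans (trace-pow-unique M μ spec p) (∑-cong λ i →
    trans (pow-diagonal μ p i i) (trans (*-congˡ (reflexive (δ-diag i))) (*-identityʳ _)))

-- Positive functionals and Bernstein approximation of the absolute value.

-- Bernstein polynomials of the absolute value.  A sequence m stands for the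
-- linear functional xᵖ ↦ m p on polynomials, and W t f m for the value of m on
-- ∑ₖ (t choose k) f(2k - t) (r + x)ᵏ (r - x)ᵗ⁻ᵏ.
module Moments (𝓡 : RealRing) (n : ℕ) where
  open Order 𝓡
  open import Algebra.Properties.Semiring.Exp semiring using (_^_)
  open import Data.Fin.Base using (Fin)
  open PowerTraces 𝓡 using (^-nonNeg; ^-cancel-≤)

  Seq : Set
  Seq = ℕ → Carrier

  r ρ : Carrier
  r = ι (suc n)
  ρ = ι (2 ℕ.* suc n)

  0≤r : 0# ≤ r
  0≤r = ι-nonNeg (suc n)

  r+r : r + r ≈ ρ
  r+r = trans (solve 1 (λ r → r :+ r := :ι 2 :* r) refl r) (sym (ι-* 2 (suc n)))

  -- The functional preceded by multiplication with `r + x` and with `r - x`.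
  up down : Seq → Seq
  up   m p = r * m p + m (suc p)
  down m p = r * m p - m (suc p)

  -- The value of the functional on `(r + x)ᵏ (r - x)ˡ`.
  Φ : Seq → ℕ → ℕ → Carrier
  Φ m zero    zero    = m 0
  Φ m zero    (suc l) = Φ (down m) zero l
  Φ m (suc k) l       = Φ (up m) k l

  -- Nonnegative on the Bernstein basis of the interval from `-r` to `r`. This is a condition on the
  -- moments alone, yet it makes `W` monotone in `f`.
  Positive : Seq → Set
  Positive m = ∀ k l → 0# ≤ Φ m k l

  Φ-cong : ∀ {m m′} → (∀ p → m p ≈ m′ p) → ∀ k l → Φ m k l ≈ Φ m′ k l
  Φ-cong e zero    zero    = e 0
  Φ-cong e zero    (suc l) = Φ-cong (λ p → +-cong (*-congˡ (e p)) (-‿cong (e (suc p)))) zero l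
  Φ-cong e (suc k) l       = Φ-cong (λ p → +-cong (*-congˡ (e p)) (e (suc p))) k l

  up-down : ∀ m p → up (down m) p ≈ down (up m) p
  up-down m p = solve 4 (λ r a b c → r :* (r :* a :- b) :+ (r :* b :- c) := r :* (r :* a :+ b) :- (r :* b :+ c)) refl
    r (m p) (m (suc p)) (m (suc (suc p)))

  Φ-down : ∀ m k l → Φ (down m) k l ≈ Φ m k (suc l)
  Φ-down m zero    l = refl
  Φ-down m (suc k) l = trans (Φ-cong (up-down m) k l) (Φ-down (up m) k l)

  up-positive : ∀ {m} → Positive m → Positive (up m)
  up-positive pos k l = pos (suc k) l

  down-positive : ∀ {m} → Positive m → Positive (down m)
  down-positive {m} pos k l = ≤-respʳ (sym (Φ-down m k l)) (pos k (suc l))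

  positive-cong : ∀ {m m′} → (∀ p → m p ≈ m′ p) → Positive m → Positive m′
  positive-cong e pos k l = ≤-respʳ (Φ-cong e k l) (pos k l)

  Φ-+ : ∀ m m′ k l → Φ (λ p → m p + m′ p) k l ≈ Φ m k l + Φ m′ k l
  Φ-+ m m′ zero    zero    = refl
  Φ-+ m m′ zero    (suc l) = trans (Φ-cong (λ p → solve 5 (λ r a b c d → r :* (a :+ b) :- (c :+ d) := r :* a :- c :+ (r :* b :- d)) refl
    r (m p) (m′ p) (m (suc p)) (m′ (suc p))) zero l) (Φ-+ (down m) (down m′) zero l)
  Φ-+ m m′ (suc k) l       = trans (Φ-cong (λ p → solve 5 (λ r a b c d → r :* (a :+ b) :+ (c :+ d) := r :* a :+ c :+ (r :* b :+ d)) refl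
    r (m p) (m′ p) (m (suc p)) (m′ (suc p))) k l) (Φ-+ (up m) (up m′) k l)

  Φ-scale : ∀ c m k l → Φ (λ p → c * m p) k l ≈ c * Φ m k l
  Φ-scale c m zero    zero    = refl
  Φ-scale c m zero    (suc l) = trans (Φ-cong (λ p → solve 4 (λ r c a b → r :* (c :* a) :- c :* b := c :* (r :* a :- b)) refl
    r c (m p) (m (suc p))) zero l) (Φ-scale c (down m) zero l)
  Φ-scale c m (suc k) l       = trans (Φ-cong (λ p → solve 4 (λ r c a b → r :* (c :* a) :+ c :* b := c :* (r :* a :+ b)) refl
    r c (m p) (m (suc p))) k l) (Φ-scale c (up m) k l)

  positive-+ : ∀ {m m′} → Positive m → Positive m′ → Positive (λ p → m p + m′ p)
  positive-+ {m} {m′} pos pos′ k l = ≤-respʳ (sym (Φ-+ m m′ k l)) (+-nonNeg (pos k l) (pos′ k l))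

  positive-scale : ∀ {c m} → 0# ≤ c → Positive m → Positive (λ p → c * m p)
  positive-scale {c} {m} 0≤c pos k l = ≤-respʳ (sym (Φ-scale c m k l)) (*-nonNeg 0≤c (pos k l))

  positive-0 : Positive (λ _ → 0#)
  positive-0 k l = ≤-reflexive (sym (trans (Φ-cong (λ _ → sym (zeroˡ 0#)) k l)
    (trans (Φ-scale 0# (λ _ → 0#) k l) (zeroˡ _))))

  positive-∑ : ∀ {N} {m : Fin N → Seq} → (∀ i → Positive (m i)) → Positive (λ p → ∑ λ i → m i p)
  positive-∑ {zero}  pos = positive-cong (λ p → sym (∑-zero _)) positive-0
  positive-∑ {suc N} pos = positive-cong (λ p → sym (∑-suc _))
    (positive-+ (pos Fin.zero) (positive-∑ (λ i → pos (Fin.suc i))))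

  W : ℕ → (Carrier → Carrier) → Seq → Carrier
  W zero    f m = f 0# * m 0
  W (suc t) f m = W t (λ x → f (x + 1#)) (up m) + W t (λ x → f (x - 1#)) (down m)

  W-mono : ∀ t {f g m} → Positive m → (∀ x → f x ≤ g x) → W t f m ≤ W t g m
  W-mono zero    {f} {g} {m} pos f≤g = ≤-respˡ (*-comm _ _) (≤-respʳ (*-comm _ _) (*-monoˡ-≤ (pos 0 0) (f≤g 0#)))
  W-mono (suc t) {f} {g} {m} pos f≤g = +-mono-≤ (W-mono t {m = up m} (up-positive pos) (λ x → f≤g _))
    (W-mono t {m = down m} (down-positive {m} pos) (λ x → f≤g _))

  W-cong : ∀ t {f g m m′} → (∀ x → f x ≈ g x) → (∀ p → m p ≈ m′ p) → W t f m ≈ W t g m′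
  W-cong zero    f≈g e = *-cong (f≈g 0#) (e 0)
  W-cong (suc t) f≈g e = +-cong (W-cong t (λ x → f≈g _) (λ p → +-cong (*-congˡ (e p)) (e (suc p))))
    (W-cong t (λ x → f≈g _) (λ p → +-cong (*-congˡ (e p)) (-‿cong (e (suc p)))))

  W-congᶠ : ∀ t {f g} m → (∀ x → f x ≈ g x) → W t f m ≈ W t g m
  W-congᶠ t m f≈g = W-cong t f≈g (λ _ → refl)

  W-+ : ∀ t f g m → W t (λ x → f x + g x) m ≈ W t f m + W t g m
  W-+ zero    f g m = distribʳ _ _ _
  W-+ (suc t) f g m = trans (+-cong (W-+ t _ _ (up m)) (W-+ t _ _ (down m)))
    (solve 4 (λ a b c d → a :+ b :+ (c :+ d) := a :+ c :+ (b :+ d)) refl _ _ _ _)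

  W-scale : ∀ t c f m → W t (λ x → c * f x) m ≈ c * W t f m
  W-scale zero    c f m = *-assoc _ _ _
  W-scale (suc t) c f m = trans (+-cong (W-scale t c _ (up m)) (W-scale t c _ (down m))) (sym (distribˡ c _ _))

  W-+ᵐ : ∀ t f m m′ → W t f (λ p → m p + m′ p) ≈ W t f m + W t f m′
  W-+ᵐ zero    f m m′ = distribˡ _ _ _
  W-+ᵐ (suc t) f m m′ = trans (+-cong
      (trans (W-cong t (λ _ → refl) (λ p → solve 5 (λ r a b c d → r :* (a :+ b) :+ (c :+ d) := r :* a :+ c :+ (r :* b :+ d)) refl
        r (m p) (m′ p) (m (suc p)) (m′ (suc p)))) (W-+ᵐ t _ (up m) (up m′)))
      (trans (W-cong t (λ _ → refl) (λ p → solve 5 (λ r a b c d → r :* (a :+ b) :- (c :+ d) := r :* a :- c :+ (r :* b :- d)) refl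
        r (m p) (m′ p) (m (suc p)) (m′ (suc p)))) (W-+ᵐ t _ (down m) (down m′))))
    (solve 4 (λ a b c d → a :+ b :+ (c :+ d) := a :+ c :+ (b :+ d)) refl _ _ _ _)

  W-0ᵐ : ∀ t f → W t f (λ _ → 0#) ≈ 0#
  W-0ᵐ zero    f = zeroʳ _
  W-0ᵐ (suc t) f = trans (+-cong
      (trans (W-cong t (λ _ → refl) (λ p → solve 1 (λ r → r :* :ι 0 :+ :ι 0 := :ι 0) refl r)) (W-0ᵐ t _))
      (trans (W-cong t (λ _ → refl) (λ p → solve 1 (λ r → r :* :ι 0 :- :ι 0 := :ι 0) refl r)) (W-0ᵐ t _)))
    (+-identityˡ 0#)

  W-∑ᵐ : ∀ t f {N} (m : Fin N → Seq) → W t f (λ p → ∑ λ i → m i p) ≈ ∑ λ i → W t f (m i)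
  W-∑ᵐ t f {zero}  m = trans (W-cong t (λ _ → refl) (λ p → ∑-zero _)) (trans (W-0ᵐ t f) (sym (∑-zero _)))
  W-∑ᵐ t f {suc N} m = trans (W-cong t (λ _ → refl) (λ p → ∑-suc _))
    (trans (W-+ᵐ t f (m Fin.zero) _) (trans (+-congˡ (W-∑ᵐ t f (λ i → m (Fin.suc i)))) (sym (∑-suc _))))

  W-const : ∀ t c m → W t (λ _ → c) m ≈ c * (ρ ^ t * m 0)
  W-const zero    c m = *-congˡ (sym (*-identityˡ _))
  W-const (suc t) c m = trans (+-cong (W-const t c (up m)) (W-const t c (down m)))
    (trans (solve 5 (λ c q r a b → c :* (q :* (r :* a :+ b)) :+ c :* (q :* (r :* a :- b)) := c :* ((r :+ r) :* q :* a)) refl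
      c (ρ ^ t) r (m 0) (m 1))
    (*-congˡ (*-congʳ (*-congʳ r+r))))

  -- The mean of a random walk of `t` steps that go up with probability `(r + x) / ρ` and down with
  -- `(r - x) / ρ`: each step has mean `2 x / ρ`, and the total weight is `ρᵗ`.
  W-id : ∀ t m → ρ * W t (λ x → x) m ≈ ι t * ρ ^ t * (m 1 + m 1)
  W-id zero    m = solve 3 (λ r a b → r :* (:ι 0 :* a) := :ι 0 :* :ι 1 :* (b :+ b)) refl ρ (m 0) (m 1)
  W-id (suc t) m = begin-equality
    ρ * (W t (λ x → x + 1#) (up m) + W t (λ x → x - 1#) (down m))
      ≈⟨ *-congˡ (+-cong (shift 1# (up m)) (shift (- 1#) (down m))) ⟩
    ρ * (W t id (up m) + 1# * (Q * up m 0) + (W t id (down m) + - 1# * (Q * down m 0)))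
      ≈⟨ solve 6 (λ R q a b u d → R :* (a :+ :ι 1 :* (q :* u) :+ (b :+ :- :ι 1 :* (q :* d))) := R :* a :+ R :* b :+ R :* (q :* (u :- d)))
           refl ρ Q (W t id (up m)) (W t id (down m)) (up m 0) (down m 0) ⟩
    ρ * W t id (up m) + ρ * W t id (down m) + ρ * (Q * (up m 0 - down m 0))
      ≈⟨ +-congʳ (+-cong (W-id t (up m)) (W-id t (down m))) ⟩
    ι t * Q * (up m 1 + up m 1) + ι t * Q * (down m 1 + down m 1) + ρ * (Q * (up m 0 - down m 0))
      ≈⟨ solve 7 (λ R q T r a b c → T :* q :* (r :* b :+ c :+ (r :* b :+ c)) :+ T :* q :* (r :* b :- c :+ (r :* b :- c)) :+ R :* (q :* (r :* a :+ b :- (r :* a :- b)))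
            := (T :* (r :+ r) :+ R) :* q :* (b :+ b)) refl ρ Q (ι t) r (m 0) (m 1) (m 2) ⟩
    (ι t * (r + r) + ρ) * Q * (m 1 + m 1)
      ≈⟨ *-congʳ (*-congʳ (+-congʳ (*-congˡ r+r))) ⟩
    (ι t * ρ + ρ) * Q * (m 1 + m 1)
      ≈⟨ solve 4 (λ T R q b → (T :* R :+ R) :* q :* b := (:ι 1 :+ T) :* (R :* q) :* b) refl (ι t) ρ Q (m 1 + m 1) ⟩
    (1# + ι t) * (ρ * Q) * (m 1 + m 1)
      ≈⟨ *-congʳ (*-congʳ (sym (ι-suc t))) ⟩
    ι (suc t) * ρ ^ suc t * (m 1 + m 1) ∎
    where
    id : Carrier → Carrier
    id x = x
    Q = ρ ^ t
    shift : ∀ c m → W t (λ x → x + c) m ≈ W t id m + c * (Q * m 0)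
    shift c m = trans (W-+ t id (λ _ → c) m) (+-congˡ (W-const t c m))

  -- The second moment of the same walk: each of the `t` steps has square 1, and the `t² - t`
  -- ordered pairs of different steps are independent with means `2 x / ρ`.
  W-square : ∀ t m → ρ * ρ * W t (λ x → x * x) m ≈
    ι t * (ρ * ρ * ρ ^ t) * m 0 + (ι t * ι t - ι t) * ρ ^ t * (ι 4 * m 2)
  W-square zero m = solve 3 (λ R a c → R :* R :* (:ι 0 :* :ι 0 :* a) := :ι 0 :* (R :* R :* :ι 1) :* a :+ (:ι 0 :* :ι 0 :- :ι 0) :* :ι 1 :* (:ι 4 :* c))
    refl ρ (m 0) (m 2)
  W-square (suc t) m = begin-equality
    ρ * ρ * (W t (λ x → (x + 1#) * (x + 1#)) (up m) + W t (λ x → (x - 1#) * (x - 1#)) (down m))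
      ≈⟨ *-congˡ (+-cong
           (expand (λ x → solve 1 (λ x → (x :+ :ι 1) :* (x :+ :ι 1) := x :* x :+ (:ι 2 :* x :+ :ι 1)) refl x) (up m))
           (expand (λ x → solve 1 (λ x → (x :- :ι 1) :* (x :- :ι 1) := x :* x :+ (:- :ι 2 :* x :+ :ι 1)) refl x) (down m))) ⟩
    ρ * ρ * (W t sq (up m) + (ι 2 * W t id (up m) + 1# * (Q * up m 0)) + (W t sq (down m) + (- ι 2 * W t id (down m) + 1# * (Q * down m 0))))
      ≈⟨ solve 8 (λ R q a b e f u d →
           R :* R :* (a :+ (:ι 2 :* e :+ :ι 1 :* (q :* u)) :+ (b :+ (:- :ι 2 :* f :+ :ι 1 :* (q :* d)))) :=
           (R :* R :* a :+ R :* R :* b) :+ (:ι 2 :* R :* (R :* e :- R :* f) :+ R :* R :* (q :* (u :+ d))))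
           refl ρ Q (W t sq (up m)) (W t sq (down m)) (W t id (up m)) (W t id (down m)) (up m 0) (down m 0) ⟩
    (ρ * ρ * W t sq (up m) + ρ * ρ * W t sq (down m)) +
    (ι 2 * ρ * (ρ * W t id (up m) - ρ * W t id (down m)) + ρ * ρ * (Q * (up m 0 + down m 0)))
      ≈⟨ +-cong (+-cong (W-square t (up m)) (W-square t (down m)))
          (+-congʳ (*-congˡ (+-cong (W-id t (up m)) (-‿cong (W-id t (down m)))))) ⟩
    (T * (ρ * ρ * Q) * up m 0 + (T * T - T) * Q * (ι 4 * up m 2) + (T * (ρ * ρ * Q) * down m 0 + (T * T - T) * Q * (ι 4 * down m 2))) +
    (ι 2 * ρ * (T * Q * (up m 1 + up m 1) - T * Q * (down m 1 + down m 1)) + ρ * ρ * (Q * (up m 0 + down m 0)))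
      ≈⟨ solve 8 (λ R q T r a b c e →
           (T :* (R :* R :* q) :* (r :* a :+ b) :+ (T :* T :- T) :* q :* (:ι 4 :* (r :* c :+ e)) :+
             (T :* (R :* R :* q) :* (r :* a :- b) :+ (T :* T :- T) :* q :* (:ι 4 :* (r :* c :- e)))) :+
           (:ι 2 :* R :* (T :* q :* (r :* b :+ c :+ (r :* b :+ c)) :- T :* q :* (r :* b :- c :+ (r :* b :- c))) :+
             R :* R :* (q :* (r :* a :+ b :+ (r :* a :- b)))) :=
           (:ι 1 :+ T) :* (R :* R :* ((r :+ r) :* q)) :* a :+ ((T :* T :- T) :* (r :+ r) :+ :ι 2 :* T :* R) :* q :* (:ι 4 :* c))
           refl ρ Q T r (m 0) (m 1) (m 2) (m 3) ⟩
    (1# + T) * (ρ * ρ * ((r + r) * Q)) * m 0 + ((T * T - T) * (r + r) + ι 2 * T * ρ) * Q * (ι 4 * m 2)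
      ≈⟨ +-cong (*-congʳ (*-congˡ (*-congˡ (*-congʳ r+r)))) (*-congʳ (*-congʳ (+-congʳ (*-congˡ r+r)))) ⟩
    (1# + T) * (ρ * ρ * (ρ * Q)) * m 0 + ((T * T - T) * ρ + ι 2 * T * ρ) * Q * (ι 4 * m 2)
      ≈⟨ +-congˡ (solve 4 (λ T R q c → ((T :* T :- T) :* R :+ :ι 2 :* T :* R) :* q :* c :=
            ((:ι 1 :+ T) :* (:ι 1 :+ T) :- (:ι 1 :+ T)) :* (R :* q) :* c) refl T ρ Q (ι 4 * m 2)) ⟩
    (1# + T) * (ρ * ρ * (ρ * Q)) * m 0 + ((1# + T) * (1# + T) - (1# + T)) * (ρ * Q) * (ι 4 * m 2)
      ≈⟨ +-cong (*-congʳ (*-congʳ (sym (ι-suc t)))) (*-congʳ (*-congʳ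
           (+-cong (*-cong (sym (ι-suc t)) (sym (ι-suc t))) (-‿cong (sym (ι-suc t)))))) ⟩
    ι (suc t) * (ρ * ρ * ρ ^ suc t) * m 0 + (ι (suc t) * ι (suc t) - ι (suc t)) * ρ ^ suc t * (ι 4 * m 2) ∎
    where
    id sq : Carrier → Carrier
    id x = x
    sq x = x * x
    Q = ρ ^ t
    T = ι t
    expand : ∀ {c f} → (∀ x → f x ≈ x * x + (c * x + 1#)) → ∀ m →
      W t f m ≈ W t sq m + (c * W t id m + 1# * (Q * m 0))
    expand {c} f≈ m = trans (W-congᶠ t m f≈) (trans (W-+ t sq _ m)
      (+-congˡ (trans (W-+ t (λ x → c * x) (λ _ → 1#) m) (+-cong (W-scale t c id m) (W-const t 1# m)))))

  powers : Carrier → Seq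
  powers μ p = μ ^ p

  powers-positive : ∀ {μ} → μ ≤ r → - μ ≤ r → Positive (powers μ)
  powers-positive {μ} μ≤r -μ≤r = pos
    where
    0≤r+μ : 0# ≤ r + μ
    0≤r+μ = ≤-respʳ (solve 2 (λ r m → r :- :- m := r :+ m) refl r μ) (x≤y⇒0≤y-x -μ≤r)
    up-powers : ∀ p → (r + μ) * powers μ p ≈ up (powers μ) p
    up-powers p = distribʳ _ _ _
    down-powers : ∀ p → (r - μ) * powers μ p ≈ down (powers μ) p
    down-powers p = solve 3 (λ r m q → (r :- m) :* q := r :* q :- m :* q) refl r μ (powers μ p)
    pos : Positive (powers μ)
    pos zero    zero    = 0≤1
    pos zero    (suc l) = ≤-respʳ (Φ-cong down-powers zero l)
      (≤-respʳ (sym (Φ-scale _ _ zero l)) (*-nonNeg (x≤y⇒0≤y-x μ≤r) (pos zero l)))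
    pos (suc k) l       = ≤-respʳ (Φ-cong up-powers k l)
      (≤-respʳ (sym (Φ-scale _ _ k l)) (*-nonNeg 0≤r+μ (pos k l)))

  -- Cauchy-Schwarz bounds the first absolute moment of the Bernstein weights by
  -- the second: the polynomial of |x| exceeds |x| by at most r/√t, where t = k².
  W-abs : ∀ {μ} → μ ≤ r → - μ ≤ r → ∀ k → let t = k ℕ.* k in
    ρ * W t ∣_∣ (powers μ) ≤ ρ ^ t * (ι 2 * ι t * ∣ μ ∣ + ι k * ρ)
  W-abs {μ} μ≤r -μ≤r k = square-cancel-≤ 0≤rhs (begin
    (ρ * w) * (ρ * w)
      ≈⟨ solve 2 (λ R w → (R :* w) :* (R :* w) := R :* R :* (w :* w)) refl ρ w ⟩
    ρ * ρ * (w * w)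
      ≲⟨ *-monoˡ-≤ (*-nonNeg 0≤ρ 0≤ρ) cauchy-schwarz ⟩
    ρ * ρ * (M * s)
      ≈⟨ solve 3 (λ R M s → R :* (M :* s) := M :* (R :* s)) refl (ρ * ρ) M s ⟩
    M * (ρ * ρ * s)
      ≈⟨ *-congˡ (W-square t (powers μ)) ⟩
    M * (T * (ρ * ρ * M) * 1# + (T * T - T) * M * (ι 4 * (μ * (μ * 1#))))
      ≲⟨ ≤-by (M * M * (T * (ι 4 * (μ * μ)) + ι 4 * T * ι k * ρ * ∣ μ ∣))
           (*-nonNeg (square-nonNeg M) (+-nonNeg (*-nonNeg 0≤T (*-nonNeg (ι-nonNeg 4) (square-nonNeg μ)))
             (*-nonNeg (*-nonNeg (*-nonNeg (*-nonNeg (ι-nonNeg 4) 0≤T) (ι-nonNeg k)) 0≤ρ) (∣∣-nonNeg μ))))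
           eq ⟩
    (M * (ι 2 * T * ∣ μ ∣ + ι k * ρ)) * (M * (ι 2 * T * ∣ μ ∣ + ι k * ρ)) ∎)
    where
    t = k ℕ.* k
    T = ι t
    M = ρ ^ t
    w = W t ∣_∣ (powers μ)
    s = W t (λ x → x * x) (powers μ)
    0≤ρ = ι-nonNeg (2 ℕ.* suc n)
    0≤T = ι-nonNeg t
    0≤M : 0# ≤ M
    0≤M = ^-nonNeg t 0≤ρ
    0≤rhs = *-nonNeg 0≤M (+-nonNeg (*-nonNeg (*-nonNeg (ι-nonNeg 2) 0≤T) (∣∣-nonNeg μ)) (*-nonNeg (ι-nonNeg k) 0≤ρ))
    eq : (M * (ι 2 * T * ∣ μ ∣ + ι k * ρ)) * (M * (ι 2 * T * ∣ μ ∣ + ι k * ρ)) ≈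
      M * (T * (ρ * ρ * M) * 1# + (T * T - T) * M * (ι 4 * (μ * (μ * 1#)))) + M * M * (T * (ι 4 * (μ * μ)) + ι 4 * T * ι k * ρ * ∣ μ ∣)
    eq = begin-equality
      (M * (ι 2 * T * ∣ μ ∣ + ι k * ρ)) * (M * (ι 2 * T * ∣ μ ∣ + ι k * ρ))
        ≈⟨ solve 5 (λ M T a k R → (M :* (:ι 2 :* T :* a :+ k :* R)) :* (M :* (:ι 2 :* T :* a :+ k :* R)) :=
              M :* M :* (:ι 4 :* T :* T :* (a :* a) :+ :ι 4 :* T :* k :* R :* a :+ (k :* k) :* (R :* R))) refl M T ∣ μ ∣ (ι k) ρ ⟩
      M * M * (ι 4 * T * T * (∣ μ ∣ * ∣ μ ∣) + ι 4 * T * ι k * ρ * ∣ μ ∣ + (ι k * ι k) * (ρ * ρ))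
        ≈⟨ *-congˡ (+-cong (+-congʳ (*-congˡ (∣∣-square μ))) (*-congʳ (sym (ι-* k k)))) ⟩
      M * M * (ι 4 * T * T * (μ * μ) + ι 4 * T * ι k * ρ * ∣ μ ∣ + T * (ρ * ρ))
        ≈⟨ solve 6 (λ M T a k R m → M :* M :* (:ι 4 :* T :* T :* (m :* m) :+ :ι 4 :* T :* k :* R :* a :+ T :* (R :* R)) :=
              M :* (T :* (R :* R :* M) :* :ι 1 :+ (T :* T :- T) :* M :* (:ι 4 :* (m :* (m :* :ι 1)))) :+
              M :* M :* (T :* (:ι 4 :* (m :* m)) :+ :ι 4 :* T :* k :* R :* a)) refl M T ∣ μ ∣ (ι k) ρ μ ⟩
      _ ∎
    -- 0 ≤ W (M|x| - w)² = M (M s - w²).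
    cauchy-schwarz : w * w ≤ M * s
    -- The index is the predecessor of `2 * suc n`; it exhibits `ρ` as a positive numeral, so that
    -- `M = ρ ^ t` cancels.
    cauchy-schwarz = ^-cancel-≤ (n ℕ.+ suc (n ℕ.+ 0)) t (0≤y-x⇒x≤y (≤-respʳ (begin-equality
      W t (λ x → (M * ∣ x ∣ - w) * (M * ∣ x ∣ - w)) (powers μ)
        ≈⟨ W-congᶠ t (powers μ) (λ x → trans
             (solve 3 (λ M a w → (M :* a :- w) :* (M :* a :- w) := M :* M :* (a :* a) :+ (:- (:ι 2 :* M :* w) :* a :+ w :* w)) refl M ∣ x ∣ w)
             (+-congʳ (*-congˡ (∣∣-square x)))) ⟩
      W t (λ x → M * M * (x * x) + (- (ι 2 * M * w) * ∣ x ∣ + w * w)) (powers μ)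
        ≈⟨ trans (W-+ t _ _ (powers μ)) (+-cong (W-scale t (M * M) _ (powers μ))
             (trans (W-+ t _ _ (powers μ)) (+-cong (W-scale t (- (ι 2 * M * w)) ∣_∣ (powers μ)) (W-const t (w * w) (powers μ))))) ⟩
      M * M * s + (- (ι 2 * M * w) * w + w * w * (M * 1#))
        ≈⟨ solve 3 (λ M s w → M :* M :* s :+ (:- (:ι 2 :* M :* w) :* w :+ w :* w :* (M :* :ι 1)) := M :* (M :* s) :- M :* (w :* w)) refl M s w ⟩
      M * (M * s) - M * (w * w) ∎)
      (≤-respˡ (trans (W-const t 0# (powers μ)) (zeroˡ _))
        (W-mono t {λ _ → 0#} (powers-positive μ≤r -μ≤r) (λ x → square-nonNeg _)))))

  -- By positivity, `x ≤ |x|` bounds `mQ` and `- x ≤ |x|` bounds `- mP`. The sum of both functionals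
  -- consists of point evaluations at the `μ i`, where the Bernstein polynomial of `|x|` is known up
  -- to an error that vanishes as the degree grows.
  positive-difference : ∀ {N} (μ : Fin N → Carrier) → (∀ i → μ i ≤ r) → (∀ i → - μ i ≤ r) →
    ∀ mP mQ → Positive mP → Positive mQ → (∀ p → mP p + mQ p ≈ ∑ λ i → μ i ^ p) →
    mQ 1 - mP 1 ≤ ∑ λ i → ∣ μ i ∣
  positive-difference {N} μ μ≤r -μ≤r mP mQ posP posQ total = archimedean-scaled C λ k →
    ι-cancel-≤ k (≤-respʳ (sym (begin-equality
      ι (suc k) * (E + C * 1/suc k)
        ≈⟨ solve 4 (λ k e c u → k :* (e :+ c :* u) := k :* e :+ k :* u :* c) refl (ι (suc k)) E C (1/suc k) ⟩
      ι (suc k) * E + ι (suc k) * 1/suc k * C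
        ≈⟨ +-congˡ (trans (*-congʳ (1/suc-inverse k)) (*-identityˡ _)) ⟩
      ι (suc k) * E + C ∎)) (bound k))
    where
    E = ∑ λ i → ∣ μ i ∣
    X = mQ 1 - mP 1
    C = ι N * ρ
    0≤ρ = ι-nonNeg (2 ℕ.* suc n)
    id : Carrier → Carrier
    id x = x
    bound : ∀ k → ι (suc k) * X ≤ ι (suc k) * E + C
    bound k = ι-cancel-≤ 1 (≤-trans (ι-cancel-≤ k (≤-respˡ T-lhs (≤-respʳ T-rhs (^-cancel-≤ (n ℕ.+ suc (n ℕ.+ 0)) t (begin
      M * (ι 2 * T * X)
        ≈⟨ solve 4 (λ M T q p → M :* (:ι 2 :* T :* (q :- p)) := T :* M :* (q :+ q) :- T :* M :* (p :+ p)) refl M T (mQ 1) (mP 1) ⟩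
      T * M * (mQ 1 + mQ 1) - T * M * (mP 1 + mP 1)
        ≈⟨ +-cong (sym (W-id t mQ)) (-‿cong (sym (W-id t mP))) ⟩
      ρ * W t id mQ - ρ * W t id mP
        ≈⟨ solve 3 (λ r a b → r :* a :- r :* b := r :* (a :+ :- :ι 1 :* b)) refl ρ (W t id mQ) (W t id mP) ⟩
      ρ * (W t id mQ + - 1# * W t id mP)
        ≲⟨ *-monoˡ-≤ 0≤ρ (+-mono-≤ (W-mono t posQ x≤∣x∣)
             (≤-respˡ (W-scale t (- 1#) id mP) (W-mono t posP λ x →
               ≤-respˡ (solve 1 (λ x → :- x := :- :ι 1 :* x) refl x) (-x≤∣x∣ x)))) ⟩
      ρ * (W t ∣_∣ mQ + W t ∣_∣ mP)
        ≈⟨ *-congˡ (trans (+-comm _ _) (trans (sym (W-+ᵐ t ∣_∣ mP mQ))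
             (trans (W-cong t {∣_∣} (λ _ → refl) total) (W-∑ᵐ t ∣_∣ (λ i → powers (μ i)))))) ⟩
      ρ * ∑ (λ i → W t ∣_∣ (powers (μ i)))
        ≈⟨ *-∑ ρ _ ⟩
      ∑ (λ i → ρ * W t ∣_∣ (powers (μ i)))
        ≲⟨ ∑-mono (λ i → W-abs (μ≤r i) (-μ≤r i) K) ⟩
      ∑ (λ i → M * (ι 2 * T * ∣ μ i ∣ + ι K * ρ))
        ≈⟨ sym (*-∑ M _) ⟩
      M * ∑ (λ i → ι 2 * T * ∣ μ i ∣ + ι K * ρ)
        ≈⟨ *-congˡ (trans (∑-+ _ _) (+-cong (sym (*-∑ (ι 2 * T) _)) (∑-const N (ι K * ρ)))) ⟩
      M * (ι 2 * T * E + ι N * (ι K * ρ)) ∎)))))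
      (≤-by C (*-nonNeg (ι-nonNeg N) 0≤ρ)
        (solve 3 (λ k e c → :ι 2 :* (k :* e :+ c) := :ι 2 :* (k :* e) :+ c :+ c) refl (ι K) E C)))
      where
      K = suc k
      -- For a square degree the error of order `√t` is the numeral `K`. Dividing by `K` leaves the
      -- error `C`, independent of `K`, beside terms proportional to `K`.
      t = K ℕ.* K
      T = ι t
      M = ρ ^ t
      T-lhs : ι 2 * T * X ≈ ι K * (ι 2 * (ι K * X))
      T-lhs = trans (*-congʳ (*-congˡ (ι-* K K))) (solve 2 (λ k x → :ι 2 :* (k :* k) :* x := k :* (:ι 2 :* (k :* x))) refl (ι K) X)
      T-rhs : ι 2 * T * E + ι N * (ι K * ρ) ≈ ι K * (ι 2 * (ι K * E) + C)
      T-rhs = trans (+-congʳ (*-congʳ (*-congˡ (ι-* K K))))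
        (solve 4 (λ k e n r → :ι 2 :* (k :* k) :* e :+ n :* (k :* r) := k :* (:ι 2 :* (k :* e) :+ n :* r)) refl (ι K) E (ι N) ρ)

-- Ky Fan's inequality for symmetric matrices with entries of modulus at most 1.

-- Ky Fan's inequality 2 ∑ ⟨w, S w⟩ ≤ ∑ |μ| + tr S for orthonormal w.
module Spectral (𝓡 : RealRing) where
  open Order 𝓡
  open PowerTraces 𝓡
  open Det commutativeRing using (Matrix)
  open import Algebra.Definitions.RawMonoid *-rawMonoid using () renaming (sum to product)
  open import Algebra.Properties.Semiring.Exp semiring using (_^_)
  open import Data.Fin.Base using (Fin)
  import Data.Fin.Properties as Fin
  open import Relation.Nullary using (yes; no)

  ⟨_,_⟩ : ∀ {n} → (Fin n → Carrier) → (Fin n → Carrier) → Carrier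
  ⟨ x , y ⟩ = ∑ λ i → x i * y i

  infixr 8 _·_
  _·_ : ∀ {n} → Matrix n → (Fin n → Carrier) → Fin n → Carrier
  (M · z) i = ∑ λ j → M i j * z j

  ⟨⟩-cong : ∀ {n} {x x′ y y′ : Fin n → Carrier} → (∀ i → x i ≈ x′ i) → (∀ i → y i ≈ y′ i) → ⟨ x , y ⟩ ≈ ⟨ x′ , y′ ⟩
  ⟨⟩-cong ex ey = ∑-cong λ i → *-cong (ex i) (ey i)

  form : ∀ {n} → Matrix n → (Fin n → Carrier) → Carrier
  form M z = ∑ λ i → ∑ λ j → z i * M i j * z j

  form≈ : ∀ {n} (M : Matrix n) z → form M z ≈ ⟨ z , M · z ⟩
  form≈ M z = ∑-cong λ i → trans (∑-cong λ j → *-assoc _ _ _) (sym (*-∑ (z i) _))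

  module _ {n} (S : Matrix n) (S-sym : ∀ i j → S i j ≈ S j i)
           (S≤1 : ∀ i j → 0# ≤ 1# - S i j) (-1≤S : ∀ i j → 0# ≤ 1# + S i j) where
    open Moments 𝓡 n

    selfAdjoint : ∀ x y → ⟨ S · x , y ⟩ ≈ ⟨ x , S · y ⟩
    selfAdjoint x y = begin-equality
      ∑ (λ i → ∑ (λ j → S i j * x j) * y i)
        ≈⟨ (∑-cong λ i → ∑-* (y i) _) ⟩
      ∑ (λ i → ∑ λ j → S i j * x j * y i)
        ≈⟨ ∑-comm _ ⟩
      ∑ (λ j → ∑ λ i → S i j * x j * y i)
        ≈⟨ (∑-cong λ j → trans (∑-cong λ i → trans (*-congʳ (*-congʳ (S-sym i j)))
              (solve 3 (λ s x y → s :* x :* y := x :* (s :* y)) refl (S j i) (x j) (y i))) (sym (*-∑ (x j) _))) ⟩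
      ∑ (λ j → x j * ∑ (λ i → S j i * y i)) ∎

    ·-cong : ∀ (M : Matrix n) {x y} → (∀ i → x i ≈ y i) → ∀ i → (M · x) i ≈ (M · y) i
    ·-cong M e i = ∑-cong λ j → *-congˡ (e j)

    ·-linear : ∀ (M : Matrix n) c x y i → (M · (λ j → c * x j + y j)) i ≈ c * (M · x) i + (M · y) i
    ·-linear M c x y i = trans
      (∑-cong λ j → solve 4 (λ m c x y → m :* (c :* x :+ y) := c :* (m :* x) :+ m :* y) refl (M i j) c (x j) (y j))
      (trans (∑-+ _ _) (+-congʳ (sym (*-∑ c _))))

    pow-suc-· : ∀ p z i → (pow S (suc p) · z) i ≈ (pow S p · (S · z)) i
    pow-suc-· p z i = begin-equality
      ∑ (λ j → ∑ (λ l → pow S p i l * S l j) * z j)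
        ≈⟨ (∑-cong λ j → trans (∑-* (z j) _) (∑-cong λ l → *-assoc _ _ _)) ⟩
      ∑ (λ j → ∑ λ l → pow S p i l * (S l j * z j))
        ≈⟨ ∑-comm _ ⟩
      ∑ (λ l → ∑ λ j → pow S p i l * (S l j * z j))
        ≈⟨ (∑-cong λ l → sym (*-∑ (pow S p i l) _)) ⟩
      (pow S p · (S · z)) i ∎

    pow-zero-· : ∀ z i → (pow S 0 · z) i ≈ z i
    pow-zero-· z i = ∑-δˡ i z

    pow-comm-· : ∀ p z i → (pow S p · (S · z)) i ≈ (S · (pow S p · z)) i
    pow-comm-· zero    z i = trans (pow-zero-· (S · z) i) (sym (·-cong S (pow-zero-· z) i))
    pow-comm-· (suc p) z i = trans (pow-suc-· p (S · z) i)
      (trans (pow-comm-· p (S · z) i) (·-cong S (λ j → sym (pow-suc-· p z j)) i))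

    moment : (Fin n → Carrier) → Seq
    moment z p = ⟨ z , pow S p · z ⟩

    ⟨⟩-linearˡ : ∀ c (x y z : Fin n → Carrier) → ⟨ (λ j → c * x j + y j) , z ⟩ ≈ c * ⟨ x , z ⟩ + ⟨ y , z ⟩
    ⟨⟩-linearˡ c x y z = trans
      (∑-cong λ j → solve 4 (λ c x y z → (c :* x :+ y) :* z := c :* (x :* z) :+ y :* z) refl c (x j) (y j) (z j))
      (trans (∑-+ _ _) (+-congʳ (sym (*-∑ c _))))

    ⟨⟩-linearʳ : ∀ c (x y z : Fin n → Carrier) → ⟨ z , (λ j → c * x j + y j) ⟩ ≈ c * ⟨ z , x ⟩ + ⟨ z , y ⟩
    ⟨⟩-linearʳ c x y z = trans (∑-cong λ j → *-comm _ _) (trans (⟨⟩-linearˡ c x y z)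
      (+-cong (*-congˡ (∑-cong λ j → *-comm _ _)) (∑-cong λ j → *-comm _ _)))

    shifted : Carrier → (Fin n → Carrier) → Fin n → Carrier
    shifted c z i = c * z i + (S · z) i

    moment-S : ∀ z p → ⟨ S · z , pow S p · z ⟩ ≈ moment z (suc p)
    moment-S z p = trans (selfAdjoint z (pow S p · z))
      (⟨⟩-cong (λ _ → refl) (λ i → trans (sym (pow-comm-· p z i)) (sym (pow-suc-· p z i))))

    moment-shifted : ∀ c z p → moment (shifted c z) p ≈ c * (c * moment z p + moment z (suc p)) + (c * moment z (suc p) + moment z (suc (suc p)))
    moment-shifted c z p = begin-equality
      ⟨ shifted c z , pow S p · shifted c z ⟩
        ≈⟨ ⟨⟩-linearˡ c z (S · z) _ ⟩
      c * ⟨ z , pow S p · shifted c z ⟩ + ⟨ S · z , pow S p · shifted c z ⟩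
        ≈⟨ +-cong (*-congˡ (inner z)) (inner (S · z)) ⟩
      c * (c * ⟨ z , pow S p · z ⟩ + ⟨ z , pow S (suc p) · z ⟩) + (c * ⟨ S · z , pow S p · z ⟩ + ⟨ S · z , pow S (suc p) · z ⟩)
        ≈⟨ +-congˡ (+-cong (*-congˡ (moment-S z p)) (moment-S z (suc p))) ⟩
      c * (c * moment z p + moment z (suc p)) + (c * moment z (suc p) + moment z (suc (suc p))) ∎
      where
      inner : ∀ y → ⟨ y , pow S p · shifted c z ⟩ ≈ c * ⟨ y , pow S p · z ⟩ + ⟨ y , pow S (suc p) · z ⟩
      inner y = trans (⟨⟩-cong (λ _ → refl) (·-linear (pow S p) c z (S · z)))
        (trans (⟨⟩-linearʳ c (pow S p · z) (pow S p · (S · z)) y)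
          (+-congˡ (⟨⟩-cong (λ _ → refl) (λ i → sym (pow-suc-· p z i)))))

    -- By self-adjointness a square `(r + S)²` inside the moment of `z` moves into the vector, as
    -- the moment of `(r + S) z`.
    up-up : ∀ z p → moment (shifted r z) p ≈ up (up (moment z)) p
    up-up z p = moment-shifted r z p

    down-down : ∀ z p → moment (shifted (- r) z) p ≈ down (down (moment z)) p
    down-down z p = trans (moment-shifted (- r) z p)
      (solve 4 (λ r a b c → :- r :* (:- r :* a :+ b) :+ (:- r :* b :+ c) := r :* (r :* a :- b) :- (r :* b :- c)) refl
        r (moment z p) (moment z (suc p)) (moment z (suc (suc p))))

    norm² : (Fin n → Carrier) → Carrier
    norm² z = ⟨ z , z ⟩

    norm²-nonNeg : ∀ z → 0# ≤ norm² z
    norm²-nonNeg z = ∑-nonNeg λ i → square-nonNeg (z i)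

    -- |∑ Cⱼₖ zⱼ zₖ| ≤ n ∑ zⱼ² as 2 (zⱼ² + zₖ² ± 2 C zⱼ zₖ) is (1 ± C)(zⱼ + zₖ)² + (1 ∓ C)(zⱼ - zₖ)².
    form-bound : ∀ (C : Matrix n) → (∀ i j → 0# ≤ 1# - C i j) → (∀ i j → 0# ≤ 1# + C i j) →
      ∀ z → 0# ≤ ι n * norm² z + form C z
    form-bound C C≤1 -1≤C z = ι-cancel-≤ 3 (≤-respˡ (sym (zeroʳ _)) (≤-respʳ eq
      (∑-nonNeg λ i → ∑-nonNeg λ j → +-nonNeg
        (*-nonNeg (-1≤C i j) (square-nonNeg (z i + z j)))
        (*-nonNeg (C≤1 i j) (square-nonNeg (z i - z j))))))
      where
      Z = norm² z
      eq : ∑ (λ i → ∑ λ j → (1# + C i j) * ((z i + z j) * (z i + z j)) + (1# - C i j) * ((z i - z j) * (z i - z j))) ≈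
           ι 4 * (ι n * Z + form C z)
      eq = begin-equality
        ∑ (λ i → ∑ λ j → (1# + C i j) * ((z i + z j) * (z i + z j)) + (1# - C i j) * ((z i - z j) * (z i - z j)))
          ≈⟨ (∑-cong λ i → ∑-cong λ j → solve 3 (λ c x y →
               (:ι 1 :+ c) :* ((x :+ y) :* (x :+ y)) :+ (:ι 1 :- c) :* ((x :- y) :* (x :- y)) :=
               :ι 2 :* (x :* x) :+ (:ι 2 :* (y :* y) :+ :ι 4 :* (x :* c :* y))) refl (C i j) (z i) (z j)) ⟩
        ∑ (λ i → ∑ λ j → ι 2 * (z i * z i) + (ι 2 * (z j * z j) + ι 4 * (z i * C i j * z j)))
          ≈⟨ (∑-cong λ i → trans (∑-+ _ _) (+-cong (∑-const n _) (trans (∑-+ _ _) (+-cong (sym (*-∑ (ι 2) _)) (sym (*-∑ (ι 4) _)))))) ⟩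
        ∑ (λ i → ι n * (ι 2 * (z i * z i)) + (ι 2 * Z + ι 4 * ∑ (λ j → z i * C i j * z j)))
          ≈⟨ trans (∑-+ _ _) (+-cong (trans (sym (*-∑ (ι n) _)) (*-congˡ (sym (*-∑ (ι 2) _))))
               (trans (∑-+ _ _) (+-cong (∑-const n _) (sym (*-∑ (ι 4) _))))) ⟩
        ι n * (ι 2 * Z) + (ι n * (ι 2 * Z) + ι 4 * form C z)
          ≈⟨ solve 3 (λ n z f → n :* (:ι 2 :* z) :+ (n :* (:ι 2 :* z) :+ :ι 4 :* f) := :ι 4 :* (n :* z :+ f)) refl (ι n) Z (form C z) ⟩
        ι 4 * (ι n * Z + form C z) ∎

    n≤r : ι n ≤ r
    n≤r = ι-mono {n} {suc n} (ℕ.n≤1+n n)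
      where import Data.Nat.Properties as ℕ

    moment₀ : ∀ z → moment z 0 ≈ norm² z
    moment₀ z = ⟨⟩-cong (λ _ → refl) (pow-zero-· z)

    moment₁ : ∀ z → moment z 1 ≈ form S z
    moment₁ z = trans (⟨⟩-cong (λ _ → refl) λ i → trans (pow-suc-· 0 z i) (pow-zero-· (S · z) i)) (sym (form≈ S z))

    form-neg : ∀ (C : Matrix n) z → form (λ i j → - C i j) z ≈ - form C z
    form-neg C z = trans (∑-cong λ i → trans (∑-cong λ j → solve 3 (λ x c y → x :* :- c :* y := :- (x :* c :* y)) refl (z i) (C i j) (z j))
      (∑-neg _)) (∑-neg _)

    rnorm² : ∀ z → ι n * norm² z ≤ r * moment z 0
    rnorm² z = ≤-respʳ (*-congˡ (sym (moment₀ z))) (*-mono-≤ 0≤r (norm²-nonNeg z) n≤r ≤-refl)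

    base₁₀ : ∀ z → 0# ≤ r * moment z 0 + moment z 1
    base₁₀ z = ≤-trans (form-bound S S≤1 -1≤S z) (+-mono-≤ (rnorm² z) (≤-reflexive (sym (moment₁ z))))

    base₀₁ : ∀ z → 0# ≤ r * moment z 0 - moment z 1
    base₀₁ z = ≤-trans (form-bound (λ i j → - S i j) (λ i j → ≤-respʳ (+-congˡ (sym (-‿involutive _))) (-1≤S i j)) S≤1 z)
      (+-mono-≤ (rnorm² z) (≤-reflexive (trans (form-neg S z) (-‿cong (sym (moment₁ z))))))

    -- The square is the quadratic form of the rank-one matrix `S i j * S i k`, whose entries again
    -- lie between -1 and 1, so `form-bound` applies to it.
    S·z-square : ∀ z i → (S · z) i * (S · z) i ≤ r * norm² z
    S·z-square z i = ≤-trans (0≤y-x⇒x≤y (≤-respʳ (+-congˡ (trans (form-neg C z) (-‿cong form≈²)))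
        (form-bound (λ j k → - C j k) (λ j k → ≤-respʳ (+-congˡ (sym (-‿involutive _))) (-1≤C j k)) C≤1 z)))
      (*-mono-≤ 0≤r (norm²-nonNeg z) n≤r ≤-refl)
      where
      C : Matrix n
      C j k = S i j * S i k
      -1≤C : ∀ j k → 0# ≤ 1# + C j k
      -1≤C j k = ι-cancel-≤ 1 (≤-respˡ (sym (zeroʳ _)) (≤-respʳ
        (solve 2 (λ a b → (:ι 1 :+ a) :* (:ι 1 :+ b) :+ (:ι 1 :- a) :* (:ι 1 :- b) := :ι 2 :* (:ι 1 :+ a :* b)) refl (S i j) (S i k))
        (+-nonNeg (*-nonNeg (-1≤S i j) (-1≤S i k)) (*-nonNeg (S≤1 i j) (S≤1 i k)))))
      C≤1 : ∀ j k → 0# ≤ 1# - C j k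
      C≤1 j k = ι-cancel-≤ 1 (≤-respˡ (sym (zeroʳ _)) (≤-respʳ
        (solve 2 (λ a b → (:ι 1 :+ a) :* (:ι 1 :- b) :+ (:ι 1 :- a) :* (:ι 1 :+ b) := :ι 2 :* (:ι 1 :- a :* b)) refl (S i j) (S i k))
        (+-nonNeg (*-nonNeg (-1≤S i j) (S≤1 i k)) (*-nonNeg (S≤1 i j) (-1≤S i k)))))
      form≈² : form C z ≈ (S · z) i * (S · z) i
      form≈² = trans (∑-cong λ j → trans (∑-cong λ k → solve 4 (λ x a b y → x :* (a :* b) :* y := a :* x :* (b :* y)) refl (z j) (S i j) (S i k) (z k))
        (sym (*-∑ _ _))) (sym (∑-* _ _))

    base₁₁ : ∀ z → 0# ≤ Φ (moment z) 1 1
    base₁₁ z = ≤-respʳ (trans (sym (+-congʳ (*-assoc r r _)))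
        (trans (solve 4 (λ r a b c → r :* r :* a :- c := r :* (r :* a :+ b) :- (r :* b :+ c)) refl r (moment z 0) (moment z 1) (moment z 2)) refl))
      (x≤y⇒0≤y-x (begin
        moment z 2                ≈⟨ sym (moment-S z 1) ⟩
        ⟨ S · z , pow S 1 · z ⟩   ≈⟨ ⟨⟩-cong (λ _ → refl) (λ i → trans (pow-suc-· 0 z i) (pow-zero-· (S · z) i)) ⟩
        norm² (S · z)             ≲⟨ ∑-bound _ (S·z-square z) ⟩
        ι n * (r * norm² z)       ≲⟨ *-mono-≤ 0≤r (*-nonNeg 0≤r (norm²-nonNeg z)) n≤r ≤-refl ⟩
        r * (r * norm² z)         ≈⟨ *-congˡ (*-congˡ (sym (moment₀ z))) ⟩
        r * (r * moment z 0) ∎))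

    -- Pairs of equal factors are absorbed into the vector, as `(r + S) z` or `(S - r) z`. At most
    -- one factor of each kind remains: the base cases are the norm, `r + S`, `r - S` and `r² - S²`,
    -- which are nonnegative because the entries of `S` have modulus at most 1 and `n ≤ r`.
    moment-positive : ∀ z → Positive (moment z)
    moment-positive z zero    zero          = ≤-respʳ (sym (moment₀ z)) (norm²-nonNeg z)
    moment-positive z (suc zero) zero       = base₁₀ z
    moment-positive z zero    (suc zero)    = base₀₁ z
    moment-positive z (suc zero) (suc zero) = base₁₁ z
    moment-positive z (suc (suc k)) l       = ≤-respʳ (Φ-cong (up-up z) k l) (moment-positive (shifted r z) k l)
    moment-positive z zero (suc (suc l))    = ≤-respʳ (Φ-cong (down-down z) zero l) (moment-positive (shifted (- r) z) zero l)
    moment-positive z (suc zero) (suc (suc l)) =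
      ≤-respʳ (trans (Φ-cong (λ p → trans (up-cong (down-down z) p) (trans (up-down (down (moment z)) p) (down-cong (up-down (moment z)) p))) zero l) refl)
        (moment-positive (shifted (- r) z) (suc zero) l)
      where
      up-cong : ∀ {m m′} → (∀ p → m p ≈ m′ p) → ∀ p → up m p ≈ up m′ p
      up-cong e p = +-cong (*-congˡ (e p)) (e (suc p))
      down-cong : ∀ {m m′} → (∀ p → m p ≈ m′ p) → ∀ p → down m p ≈ down m′ p
      down-cong e p = +-cong (*-congˡ (e p)) (-‿cong (e (suc p)))

    module _ (μ : Fin n → Carrier) (spectrum : ∀ x → charpoly S x ≈ product (λ i → x - μ i)) where

      trace-S^ : ∀ p → trace (pow S p) ≈ ∑ λ i → μ i ^ p
      trace-S^ = trace-pow S μ spectrum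

      trace-S² : trace (pow S 2) ≈ ∑ λ i → ∑ λ j → S i j * S i j
      trace-S² = ∑-cong λ i → trans (∑-cong λ l → *-congʳ (trans (∑-δˡ i (λ k → S k l)) refl)) (∑-cong λ l → *-congˡ (S-sym l i))

      S²≤1 : ∀ i j → S i j * S i j ≤ 1#
      S²≤1 i j = ≤-by ((1# - S i j) * (1# + S i j)) (*-nonNeg (S≤1 i j) (-1≤S i j))
        (solve 1 (λ s → :ι 1 := s :* s :+ (:ι 1 :- s) :* (:ι 1 :+ s)) refl (S i j))

      -- `μ i` squared is at most `∑ μ² = tr S²`, a sum of `n²` squares of entries: the power traces
      -- alone confine the spectrum to the Bernstein interval.
      ∣μ∣≤r : ∀ i → ∣ μ i ∣ ≤ r
      ∣μ∣≤r i = ∣∣-square-≤ 0≤r (begin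
        μ i * μ i                        ≈⟨ *-congˡ (sym (*-identityʳ _)) ⟩
        μ i ^ 2                          ≲⟨ term≤∑ (λ j → ≤-respʳ (*-congˡ (sym (*-identityʳ _))) (square-nonNeg (μ j))) i ⟩
        ∑ (λ i → μ i ^ 2)                ≈⟨ sym (trace-S^ 2) ⟩
        trace (pow S 2)                  ≈⟨ trace-S² ⟩
        ∑ (λ i → ∑ λ j → S i j * S i j)  ≲⟨ ∑-bound (ι n * 1#) (λ i → ∑-bound 1# (S²≤1 i)) ⟩
        ι n * (ι n * 1#)                 ≈⟨ *-congˡ (*-identityʳ _) ⟩
        ι n * ι n                        ≲⟨ *-mono-≤ 0≤r (ι-nonNeg n) n≤r n≤r ⟩
        r * r ∎)

      trace-S¹ : trace (pow S 1) ≈ trace S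
      trace-S¹ = ∑-cong λ i → ∑-δˡ i (λ k → S k i)

      energy : Carrier
      energy = ∑ λ i → ∣ μ i ∣

      -- As tr S = 0, the other eigenvalues sum to - μᵢ.
      energy² : trace S ≈ 0# → ι 2 * ∑ (λ i → ∑ λ j → S i j * S i j) ≤ energy * energy
      energy² traceless = begin
        ι 2 * ∑ (λ i → ∑ λ j → S i j * S i j)
          ≈⟨ *-congˡ (trans (sym trace-S²) (trace-S^ 2)) ⟩
        ι 2 * ∑ (λ i → μ i ^ 2)
          ≈⟨ trans (*-∑ _ _) (∑-cong λ i → trans (*-congˡ (trans (*-congˡ (*-identityʳ _)) (sym (∣∣-square (μ i)))))
               (solve 1 (λ x → :ι 2 :* (x :* x) := (x :+ x) :* x) refl ∣ μ i ∣)) ⟩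
        ∑ (λ i → (∣ μ i ∣ + ∣ μ i ∣) * ∣ μ i ∣)
          ≲⟨ (∑-mono λ i → *-mono-≤ 0≤energy (∣∣-nonNeg _) (≤-respʳ (solve 2 (λ e x → e :- x :+ x := e) refl energy ∣ μ i ∣) (+-monoˡ-≤ ∣ μ i ∣ (half i))) ≤-refl) ⟩
        ∑ (λ i → energy * ∣ μ i ∣)
          ≈⟨ sym (*-∑ _ _) ⟩
        energy * energy ∎
        where
        0≤energy : 0# ≤ energy
        0≤energy = ∑-nonNeg λ i → ∣∣-nonNeg (μ i)
        ∑μ≈0 : ∑ μ ≈ 0#
        ∑μ≈0 = trans (∑-cong λ i → sym (*-identityʳ (μ i))) (trans (sym (trace-S^ 1)) (trans trace-S¹ traceless))
        δ-nonNeg : ∀ (i j : Fin n) → 0# ≤ 1# - δ i j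
        δ-nonNeg i j with i Fin.≟ j
        ... | yes _ = ≤-reflexive (sym (-‿inverseʳ 1#))
        ... | no  _ = ≤-respʳ (solve 1 (λ x → :ι 1 := :ι 1 :- :ι 0) refl 0#) 0≤1
        others : ∀ (f : Fin n → Carrier) i → ∑ (λ j → (1# - δ i j) * f j) ≈ ∑ f - f i
        others f i = trans (∑-cong λ j → solve 2 (λ d f → (:ι 1 :- d) :* f := f :- d :* f) refl (δ i j) (f j))
          (trans (∑-sub _ _) (+-congˡ (-‿cong (∑-δˡ i f))))
        half : ∀ i → ∣ μ i ∣ ≤ energy - ∣ μ i ∣
        half i = begin
          ∣ μ i ∣                                   ≈⟨ sym (∣∣-neg (μ i)) ⟩
          ∣ - μ i ∣                                 ≈⟨ ∣∣-cong (trans (sym (+-identityˡ _)) (trans (+-congʳ (sym ∑μ≈0)) (sym (others μ i)))) ⟩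
          ∣ ∑ (λ j → (1# - δ i j) * μ j) ∣          ≲⟨ ∣∣-∑ _ ⟩
          ∑ (λ j → ∣ (1# - δ i j) * μ j ∣)          ≈⟨ (∑-cong λ j → trans (∣∣-* _ _) (*-congʳ (∣∣-of-nonNeg (δ-nonNeg i j)))) ⟩
          ∑ (λ j → (1# - δ i j) * ∣ μ j ∣)          ≈⟨ others (λ j → ∣ μ j ∣) i ⟩
          energy - ∣ μ i ∣ ∎

      module _ {N} (w : Fin N → Fin n → Carrier) (λ′ : Fin N → Carrier) (0≤λ : ∀ j → 0# ≤ λ′ j)
             (orthogonal : ∀ j k → λ′ j * λ′ k * ⟨ w j , w k ⟩ ≈ λ′ j * δ j k) where

        -- `G` is the orthogonal projection onto the span of the weighted vectors, `P` the
        -- complementary one. The nonzero weights are inverse squared norms; a zero weight discards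
        -- its vector.
        G P : Matrix n
        G a b = ∑ λ j → λ′ j * (w j a * w j b)
        P a b = δ a b - G a b

        G-sym : ∀ a b → G a b ≈ G b a
        G-sym a b = ∑-cong λ j → *-congˡ (*-comm _ _)

        G² : ∀ a b → ∑ (λ i → G i a * G i b) ≈ G a b
        G² a b = begin-equality
          ∑ (λ i → ∑ (λ j → λ′ j * (w j i * w j a)) * ∑ (λ k → λ′ k * (w k i * w k b)))
            ≈⟨ (∑-cong λ i → trans (∑-* _ _) (∑-cong λ j → *-∑ _ _)) ⟩
          ∑ (λ i → ∑ λ j → ∑ λ k → λ′ j * (w j i * w j a) * (λ′ k * (w k i * w k b)))
            ≈⟨ trans (∑-comm _) (∑-cong λ j → ∑-comm _) ⟩
          ∑ (λ j → ∑ λ k → ∑ λ i → λ′ j * (w j i * w j a) * (λ′ k * (w k i * w k b)))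
            ≈⟨ (∑-cong λ j → ∑-cong λ k → trans (∑-cong λ i →
                 solve 6 (λ l x a m y b → l :* (x :* a) :* (m :* (y :* b)) := a :* b :* (l :* m) :* (x :* y)) refl
                   (λ′ j) (w j i) (w j a) (λ′ k) (w k i) (w k b))
                 (trans (sym (*-∑ _ _)) (trans (*-assoc _ _ _) (trans (*-congˡ (orthogonal j k))
                   (solve 4 (λ a b l d → a :* b :* (l :* d) := d :* (l :* (a :* b))) refl (w j a) (w k b) (λ′ j) (δ j k)))))) ⟩
          ∑ (λ j → ∑ λ k → δ j k * (λ′ j * (w j a * w k b)))
            ≈⟨ (∑-cong λ j → ∑-δˡ j λ k → λ′ j * (w j a * w k b)) ⟩
          G a b ∎

        P² : ∀ a b → ∑ (λ i → P i a * P i b) ≈ P a b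
        P² a b = begin-equality
          ∑ (λ i → (δ i a - G i a) * (δ i b - G i b))
            ≈⟨ (∑-cong λ i → trans
                 (solve 4 (λ d g e h → (d :- g) :* (e :- h) := (d :* e :- d :* h) :- (e :* g :- g :* h)) refl (δ i a) (G i a) (δ i b) (G i b))
                 (+-cong (+-cong (*-congʳ (reflexive (δ-sym i a))) (-‿cong (*-congʳ (reflexive (δ-sym i a)))))
                   (-‿cong (+-congʳ (*-congʳ (reflexive (δ-sym i b))))))) ⟩
          ∑ (λ i → (δ a i * δ i b - δ a i * G i b) - (δ b i * G i a - G i a * G i b))
            ≈⟨ trans (∑-sub _ _) (+-cong (∑-sub _ _) (-‿cong (∑-sub _ _))) ⟩
          (∑ (λ i → δ a i * δ i b) - ∑ (λ i → δ a i * G i b)) - (∑ (λ i → δ b i * G i a) - ∑ (λ i → G i a * G i b))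
            ≈⟨ +-cong (+-cong (∑-δˡ a _) (-‿cong (∑-δˡ a _))) (-‿cong (+-cong (trans (∑-δˡ b _) (G-sym b a)) (-‿cong (G² a b)))) ⟩
          (δ a b - G a b) - (G a b - G a b)
            ≈⟨ solve 2 (λ d g → d :- g :- (g :- g) := d :- g) refl (δ a b) (G a b) ⟩
          P a b ∎

        -- As `P` is symmetric and idempotent, the trace of `Sᵖ P` is the sum of the moments of the
        -- rows of `P`. In this form the complementary functional is visibly positive.
        mP mQ : Seq
        mP p = ∑ λ i → moment (P i) p
        mQ p = ∑ λ j → λ′ j * moment (w j) p

        trace-G : ∀ (B : Matrix n) → ∑ (λ a → ∑ λ b → G a b * B a b) ≈ ∑ λ j → λ′ j * form B (w j)
        trace-G B = begin-equality
          ∑ (λ a → ∑ λ b → ∑ (λ j → λ′ j * (w j a * w j b)) * B a b)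
            ≈⟨ (∑-cong λ a → trans (∑-cong λ b → ∑-* _ _) (∑-comm _)) ⟩
          ∑ (λ a → ∑ λ j → ∑ λ b → λ′ j * (w j a * w j b) * B a b)
            ≈⟨ ∑-comm _ ⟩
          ∑ (λ j → ∑ λ a → ∑ λ b → λ′ j * (w j a * w j b) * B a b)
            ≈⟨ (∑-cong λ j → trans (∑-cong λ a → trans (∑-cong λ b →
                 solve 4 (λ l x y m → l :* (x :* y) :* m := l :* (x :* m :* y)) refl (λ′ j) (w j a) (w j b) (B a b)) (sym (*-∑ _ _)))
                 (sym (*-∑ _ _))) ⟩
          ∑ (λ j → λ′ j * form B (w j)) ∎

        trace-P : ∀ (B : Matrix n) → ∑ (λ i → form B (P i)) ≈ trace B - ∑ λ j → λ′ j * form B (w j)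
        trace-P B = begin-equality
          ∑ (λ i → ∑ λ a → ∑ λ b → P i a * B a b * P i b)
            ≈⟨ trans (∑-comm _) (∑-cong λ a → ∑-comm _) ⟩
          ∑ (λ a → ∑ λ b → ∑ λ i → P i a * B a b * P i b)
            ≈⟨ (∑-cong λ a → ∑-cong λ b → trans (∑-cong λ i → solve 3 (λ p m q → p :* m :* q := p :* q :* m) refl (P i a) (B a b) (P i b))
                 (trans (sym (∑-* _ _)) (*-congʳ (P² a b)))) ⟩
          ∑ (λ a → ∑ λ b → (δ a b - G a b) * B a b)
            ≈⟨ (∑-cong λ a → trans (∑-cong λ b → solve 3 (λ d g m → (d :- g) :* m := d :* m :- g :* m) refl (δ a b) (G a b) (B a b)) (∑-sub _ _)) ⟩
          ∑ (λ a → ∑ (λ b → δ a b * B a b) - ∑ (λ b → G a b * B a b))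
            ≈⟨ trans (∑-sub _ _) (+-cong (∑-cong λ a → ∑-δˡ a (B a)) (-‿cong (trace-G B))) ⟩
          trace B - ∑ (λ j → λ′ j * form B (w j)) ∎

        total : ∀ p → mP p + mQ p ≈ ∑ λ i → μ i ^ p
        total p = begin-equality
          mP p + mQ p
            ≈⟨ +-cong (trans (∑-cong λ i → sym (form≈ (pow S p) (P i))) (trace-P (pow S p)))
                      (∑-cong λ j → *-congˡ (sym (form≈ (pow S p) (w j)))) ⟩
          (trace (pow S p) - F) + F
            ≈⟨ solve 2 (λ t f → t :- f :+ f := t) refl (trace (pow S p)) F ⟩
          trace (pow S p)
            ≈⟨ trace-S^ p ⟩
          ∑ (λ i → μ i ^ p) ∎
          where F = ∑ λ j → λ′ j * form (pow S p) (w j)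

        ky-fan : ι 2 * ∑ (λ j → λ′ j * form S (w j)) ≤ energy + trace S
        ky-fan = ≤-respˡ eq (+-monoˡ-≤ (trace S) (positive-difference μ
          (λ i → ≤-trans (x≤∣x∣ (μ i)) (∣μ∣≤r i)) (λ i → ≤-trans (-x≤∣x∣ (μ i)) (∣μ∣≤r i)) mP mQ
          (positive-∑ λ i → moment-positive (P i))
          (positive-∑ λ j → positive-scale (0≤λ j) (moment-positive (w j)))
          total))
          where
          F = ∑ λ j → λ′ j * form S (w j)
          mQ₁ : mQ 1 ≈ F
          mQ₁ = ∑-cong λ j → *-congˡ (moment₁ (w j))
          eq : mQ 1 - mP 1 + trace S ≈ ι 2 * F
          eq = begin-equality
            mQ 1 - mP 1 + trace S
              ≈⟨ solve 3 (λ q p t → q :- p :+ t := :ι 2 :* q :+ (t :- (p :+ q))) refl (mQ 1) (mP 1) (trace S) ⟩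
            ι 2 * mQ 1 + (trace S - (mP 1 + mQ 1))
              ≈⟨ +-cong (*-congˡ mQ₁) (+-congˡ (-‿cong (trans (total 1) (trans (sym (trace-S^ 1)) trace-S¹)))) ⟩
            ι 2 * F + (trace S - trace S)
              ≈⟨ solve 2 (λ f t → f :+ (t :- t) := f) refl (ι 2 * F) (trace S) ⟩
            ι 2 * F ∎

-- Rooted trees from connectedness and acyclicity.

module Rooting where
  open import Data.Bool.Base using (T)
  open import Data.Bool.Properties using (T?)
  open import Data.Empty using (⊥-elim)
  open import Data.Fin.Base as Fin using (Fin; zero; suc; toℕ)
  import Data.Fin.Properties as Fin
  import Data.Nat.Properties as ℕ
  open import Data.Sum.Base using (_⊎_; inj₁; inj₂)
  open import Relation.Binary.Construct.Closure.ReflexiveTransitive using (Star; ε; _◅_)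
  open import Relation.Binary.PropositionalEquality
  open import Relation.Nullary using (¬_; Dec; yes; no)
  open import Relation.Nullary.Decidable using (_×-dec_; ¬?)

  least : ∀ {P : ℕ → Set} → (∀ k → Dec (P k)) → ∀ k → P k → ∃[ m ] (P m × ∀ j → P j → m ℕ.≤ j)
  least P? zero    Pk = zero , Pk , λ _ _ → ℕ.z≤n
  least P? (suc k) Pk with P? zero
  ... | yes P0 = zero , P0 , λ _ _ → ℕ.z≤n
  ... | no ¬P0 with least (λ j → P? (suc j)) k Pk
  ...   | m , Pm , min = suc m , Pm , λ
    { zero P0 → ⊥-elim (¬P0 P0) ; (suc j) Pj → ℕ.s≤s (min j Pj) }

  argmax : ∀ {n} → Fin n → (f : Fin n → ℕ) → ∃[ v ] (∀ u → f u ℕ.≤ f v)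
  argmax {suc zero} _ f = zero , λ { zero → ℕ.≤-refl }
  argmax {suc (suc n)} _ f with argmax {suc n} zero (λ i → f (suc i))
  ... | v , max with f zero ℕ.≤? f (suc v)
  ...   | yes f₀≤ = suc v , λ { zero → f₀≤ ; (suc u) → max u }
  ...   | no  f₀≰ = zero , λ { zero → ℕ.≤-refl ; (suc u) → ℕ.≤-trans (max u) (ℕ.<⇒≤ (ℕ.≰⇒> f₀≰)) }

  -- All clauses about `parent` exclude the root, where its value is arbitrary. Acyclicity is
  -- expressed by `adj-only`: there are no edges but those to parents.
  record Rooted {n} (G : Graph n) (r : Fin n) : Set where
    open Graph G
    field
      parent       : Fin n → Fin n
      depth        : Fin n → ℕ
      depth-root   : depth r ≡ 0
      depth-parent : ∀ v → v ≢ r → depth v ≡ suc (depth (parent v))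
      adj-parent   : ∀ v → v ≢ r → Adj v (parent v)
      adj-only     : ∀ u v → Adj u v → (u ≢ r × parent u ≡ v) ⊎ (v ≢ r × parent v ≡ u)

  module _ {n} (G : Graph n) where
    open Graph G

    adj-flip : ∀ {u v} → Adj u v → Adj v u
    adj-flip {u} {v} = subst T (adj-sym u v)

    ¬adj-self : ∀ {u v} → Adj u v → u ≢ v
    ¬adj-self {u} a refl = subst T (adj-irrefl u) a

    module Distances (connected : ∀ u v → Star Adj u v) (r : Fin n) where

      -- A walk of exactly `k` steps to the root. Exact length makes this decidable by recursion, so
      -- the least `k`, the distance, can be found by search.
      Reach : ℕ → Fin n → Set
      Reach zero    v = v ≡ r
      Reach (suc k) v = ∃[ u ] (Adj v u × Reach k u)

      reach? : ∀ k v → Dec (Reach k v)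
      reach? zero    v = v Fin.≟ r
      reach? (suc k) v = Fin.any? λ u → T? (adj v u) ×-dec reach? k u

      reach : ∀ {v} → Star Adj v r → ∃[ k ] Reach k v
      reach ε = zero , refl
      reach (_◅_ {j = u} e es) with reach es
      ... | k , Rk = suc k , u , e , Rk

      dist : ∀ v → ∃[ m ] (Reach m v × ∀ j → Reach j v → m ℕ.≤ j)
      dist v with reach (connected v r)
      ... | k , Rk = least (λ j → reach? j v) k Rk

      depth : Fin n → ℕ
      depth v = proj₁ (dist v)

      depth-root : depth r ≡ 0
      depth-root = ℕ.n≤0⇒n≡0 (proj₂ (proj₂ (dist r)) 0 refl)

      next : ∀ v → v ≢ r → ∃[ u ] (Adj v u × depth v ≡ suc (depth u))
      next v v≢r with dist v in eq
      ... | zero  , v≡r , _ = ⊥-elim (v≢r v≡r)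
      ... | suc k , (u , e , Ru) , min = u , e , cong suc (ℕ.≤-antisym
        (ℕ.s≤s⁻¹ (min (suc (depth u)) (u , e , proj₁ (proj₂ (dist u)))))
        (proj₂ (proj₂ (dist u)) k Ru))

      parent : Fin n → Fin n
      parent v with v Fin.≟ r
      ... | yes _  = r
      ... | no v≢r = proj₁ (next v v≢r)

      parent-spec : ∀ v → v ≢ r → Adj v (parent v) × depth v ≡ suc (depth (parent v))
      parent-spec v v≢r with v Fin.≟ r
      ... | yes v≡r = ⊥-elim (v≢r v≡r)
      ... | no v≢r′ = proj₂ (next v v≢r′)

      up : ℕ → Fin n → Fin n
      up zero    v = v
      up (suc k) v = parent (up k v)

      ≢r : ∀ {v k} → depth v ≡ suc k → v ≢ r
      ≢r d refl with trans (sym depth-root) d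
      ... | ()

      depth0 : ∀ v → depth v ≡ 0 → v ≡ r
      depth0 v d with v Fin.≟ r
      ... | yes v≡r = v≡r
      ... | no v≢r with trans (sym d) (proj₂ (parent-spec v v≢r))
      ...   | ()

      depth-up : ∀ k v → k ℕ.≤ depth v → k ℕ.+ depth (up k v) ≡ depth v
      depth-up zero    v _ = refl
      depth-up (suc k) v k<d with depth (up k v) in eq | depth-up k v (ℕ.<⇒≤ k<d)
      ... | zero  | e = ⊥-elim (ℕ.<⇒≢ k<d (trans (sym (ℕ.+-identityʳ k)) e))
      ... | suc m | e = trans (sym (ℕ.+-suc k _)) (trans
        (cong (k ℕ.+_) (trans (sym (proj₂ (parent-spec (up k v) (≢r eq)))) eq)) e)

      up-≢r : ∀ k v → k ℕ.< depth v → up k v ≢ r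
      up-≢r k v k<d e = ℕ.<⇒≢ k<d (trans (sym (ℕ.+-identityʳ k))
        (trans (cong (k ℕ.+_) (sym (trans (cong depth e) depth-root))) (depth-up k v (ℕ.<⇒≤ k<d))))

      adj-up : ∀ k v → k ℕ.< depth v → Adj (up k v) (up (suc k) v)
      adj-up k v k<d = proj₁ (parent-spec (up k v) (up-≢r k v k<d))

      up-root : ∀ v → up (depth v) v ≡ r
      up-root v = depth0 _ (ℕ.+-cancelˡ-≡ (depth v) _ _ (trans (depth-up (depth v) v ℕ.≤-refl) (sym (ℕ.+-identityʳ _))))

      up-injective : ∀ {j k} v → j ℕ.≤ depth v → k ℕ.≤ depth v → up j v ≡ up k v → j ≡ k
      up-injective {j} {k} v j≤ k≤ e = ℕ.+-cancelʳ-≡ (depth (up k v)) j k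
        (trans (cong (λ x → j ℕ.+ depth x) (sym e)) (trans (depth-up j v j≤) (sym (depth-up k v k≤))))

      -- Take the least `i` for which the `i`-th ancestor of `u` is an ancestor of `v`. It exists as
      -- both meet at the root, and its minimality keeps the earlier ancestors of `u` off the path
      -- of `v`.
      lowest-common-ancestor : ∀ u v → ∃[ i ] ∃[ j ] (i ℕ.≤ depth u × j ℕ.≤ depth v × up i u ≡ up j v ×
        (∀ {a b} → a ℕ.< i → b ℕ.≤ depth v → up a u ≢ up b v))
      lowest-common-ancestor u v
        with least meet? (depth u) (Fin.fromℕ (depth v) ,
          trans (up-root u) (sym (trans (cong (λ k → up k v) (Fin.toℕ-fromℕ (depth v))) (up-root v))))
        where
        meet? : ∀ i → Dec (∃[ j ] up i u ≡ up (toℕ {suc (depth v)} j) v)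
        meet? i = Fin.any? λ j → up i u Fin.≟ up (toℕ j) v
      ... | i , (j , common) , min = i , toℕ j , min (depth u) at-root , ℕ.s≤s⁻¹ (Fin.toℕ<n j) , common , λ a<i b≤ eq →
        ℕ.<⇒≱ a<i (min _ (Fin.fromℕ< (ℕ.s≤s b≤) , trans eq (cong (λ k → up k v) (sym (Fin.toℕ-fromℕ< (ℕ.s≤s b≤))))))
        where
        at-root : ∃[ j ] up (depth u) u ≡ up (toℕ {suc (depth v)} j) v
        at-root = Fin.fromℕ (depth v) ,
          trans (up-root u) (sym (trans (cong (λ k → up k v) (Fin.toℕ-fromℕ (depth v))) (up-root v)))

      -- An edge that does not join a vertex to its parent closes a cycle with
      -- the paths from its ends to their lowest common ancestor.
      module ExtraEdge (u v : Fin n) (e : Adj u v)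
        (u↛v : ¬ (u ≢ r × parent u ≡ v)) (v↛u : ¬ (v ≢ r × parent v ≡ u))
        (i j : ℕ) (i≤ : i ℕ.≤ depth u) (j≤ : j ℕ.≤ depth v) (common : up i u ≡ up j v)
        (apart : ∀ {a b} → a ℕ.< i → b ℕ.≤ depth v → up a u ≢ up b v) where

        m : ℕ
        m = i ℕ.+ j

        -- Up from `u` to the common ancestor in `i` steps, down to `v` in `j` steps; at `t = i`
        -- both descriptions agree.
        path : ℕ → Fin n
        path t with t ℕ.≤? i
        ... | yes _ = up t u
        ... | no  _ = up (m ℕ.∸ t) v

        path-left : ∀ {t} → t ℕ.≤ i → path t ≡ up t u
        path-left {t} t≤i with t ℕ.≤? i
        ... | yes _  = refl
        ... | no t≰i = ⊥-elim (t≰i t≤i)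

        path-right : ∀ {t} → i ℕ.≤ t → path t ≡ up (m ℕ.∸ t) v
        path-right {t} i≤t with t ℕ.≤? i
        ... | no _ = refl
        ... | yes t≤i with ℕ.≤-antisym t≤i i≤t
        ...   | refl = trans common (cong (λ k → up k v) (sym (ℕ.m+n∸m≡n i j)))

        m∸t≤j : ∀ {t} → i ℕ.≤ t → m ℕ.∸ t ℕ.≤ j
        m∸t≤j {t} i≤t = ℕ.≤-trans (ℕ.∸-monoʳ-≤ m i≤t) (ℕ.≤-reflexive (ℕ.m+n∸m≡n i j))

        path-injective : ∀ {s t} → s ℕ.≤ m → t ℕ.≤ m → path s ≡ path t → s ≡ t
        path-injective {s} {t} s≤m t≤m eq with ℕ.<-≤-connex s i | ℕ.<-≤-connex t i
        ... | inj₁ s<i | inj₁ t<i = up-injective u (ℕ.≤-trans (ℕ.<⇒≤ s<i) i≤) (ℕ.≤-trans (ℕ.<⇒≤ t<i) i≤)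
          (trans (sym (path-left (ℕ.<⇒≤ s<i))) (trans eq (path-left (ℕ.<⇒≤ t<i))))
        ... | inj₁ s<i | inj₂ i≤t = ⊥-elim (apart s<i (ℕ.≤-trans (m∸t≤j i≤t) j≤)
          (trans (sym (path-left (ℕ.<⇒≤ s<i))) (trans eq (path-right i≤t))))
        ... | inj₂ i≤s | inj₁ t<i = ⊥-elim (apart t<i (ℕ.≤-trans (m∸t≤j i≤s) j≤)
          (trans (sym (path-left (ℕ.<⇒≤ t<i))) (trans (sym eq) (path-right i≤s))))
        ... | inj₂ i≤s | inj₂ i≤t = ℕ.∸-cancelˡ-≡ s≤m t≤m
          (up-injective v (ℕ.≤-trans (m∸t≤j i≤s) j≤) (ℕ.≤-trans (m∸t≤j i≤t) j≤)
            (trans (sym (path-right i≤s)) (trans eq (path-right i≤t))))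

        path-edge : ∀ {t} → t ℕ.< m → Adj (path t) (path (suc t))
        path-edge {t} t<m with ℕ.<-≤-connex t i
        ... | inj₁ t<i = subst₂ Adj (sym (path-left (ℕ.<⇒≤ t<i))) (sym (path-left t<i))
          (adj-up t u (ℕ.<-≤-trans t<i i≤))
        ... | inj₂ i≤t = subst₂ Adj (trans (cong (λ k → up k v) step) (sym (path-right i≤t)))
            (sym (path-right (ℕ.m≤n⇒m≤1+n i≤t)))
            (adj-flip (adj-up (m ℕ.∸ suc t) v (ℕ.<-≤-trans (subst (m ℕ.∸ suc t ℕ.<_) step ℕ.≤-refl) (ℕ.≤-trans (m∸t≤j i≤t) j≤))))
          where
          step : suc (m ℕ.∸ suc t) ≡ m ℕ.∸ t
          step = sym (ℕ.+-∸-assoc 1 t<m)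

        -- A cycle has at least three vertices, so the path needs two edges. Length 0 would make the
        -- given edge a loop, length 1 would make it an edge to a parent.
        long : ∀ i j → up i u ≡ up j v → i ℕ.≤ depth u → j ℕ.≤ depth v → ∃[ k ] i ℕ.+ j ≡ 2 ℕ.+ k
        long zero           zero           eq _  _  = ⊥-elim (¬adj-self e eq)
        long zero           (suc zero)     eq _  j≤ = ⊥-elim (v↛u (up-≢r 0 v j≤ , sym eq))
        long (suc zero)     zero           eq i≤ _  = ⊥-elim (u↛v (up-≢r 0 u i≤ , eq))
        long zero           (suc (suc j′)) _  _  _  = j′ , refl
        long (suc zero)     (suc j′)       _  _  _  = j′ , refl
        long (suc (suc i′)) j′             _  _  _  = i′ ℕ.+ j′ , refl

        cycle : ∃[ k ] Cycle k
        cycle with long i j common i≤ j≤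
        ... | k , m≡2+k = k , record
          { vertex    = λ x → path (toℕ x)
          ; injective = λ {x} {y} eq → Fin.toℕ-injective (path-injective (≤m x) (≤m y) eq)
          ; edge      = λ x → subst (λ t → Adj (path t) (path (suc (toℕ x)))) (sym (Fin.toℕ-inject₁ x))
                          (path-edge (subst (toℕ x ℕ.<_) (sym m≡2+k) (Fin.toℕ<n x)))
          ; closing   = subst₂ Adj (sym last≡v) refl (adj-flip (subst (λ x → Adj x v) (sym (path-left ℕ.z≤n)) e))
          }
          where
          ≤m : ∀ (x : Fin (3 ℕ.+ k)) → toℕ x ℕ.≤ m
          ≤m x = subst (toℕ x ℕ.≤_) (sym m≡2+k) (ℕ.s≤s⁻¹ (Fin.toℕ<n x))
          last≡v : path (toℕ (Fin.fromℕ (2 ℕ.+ k))) ≡ v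
          last≡v = trans (cong path (trans (Fin.toℕ-fromℕ (2 ℕ.+ k)) (sym m≡2+k)))
            (trans (path-right (ℕ.m≤m+n i j)) (cong (λ k → up k v) (ℕ.n∸n≡0 m)))

    rootAt : IsTree → ∀ r → Rooted G r
    rootAt tree r = record
      { parent       = parent
      ; depth        = depth
      ; depth-root   = depth-root
      ; depth-parent = λ v v≢r → proj₂ (parent-spec v v≢r)
      ; adj-parent   = λ v v≢r → proj₁ (parent-spec v v≢r)
      ; adj-only     = only
      }
      where
      open Distances (proj₂ (IsTree.connected tree)) r
      only : ∀ u v → Adj u v → (u ≢ r × parent u ≡ v) ⊎ (v ≢ r × parent v ≡ u)
      only u v e with (¬? (u Fin.≟ r)) ×-dec (parent u Fin.≟ v) | (¬? (v Fin.≟ r)) ×-dec (parent v Fin.≟ u)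
      ... | yes p | _     = inj₁ p
      ... | no _  | yes q = inj₂ q
      ... | no ¬p | no ¬q with lowest-common-ancestor u v
      ...   | i , j , i≤ , j≤ , common , apart with ExtraEdge.cycle u v e ¬p ¬q i j i≤ j≤ common apart
      ...     | k , c = ⊥-elim (IsTree.acyclic tree k c)

-- Cardinalities of Boolean predicates.

module Counting where
  open import Data.Bool.Base using (Bool; true; false)
  open import Data.Fin.Base using (Fin; zero; suc)
  import Data.Fin.Properties as Fin
  open import Data.Fin.Subset using (∣_∣)
  import Data.Vec.Base as Vec
  open import Function.Base using (_∘_)
  open import Relation.Binary.PropositionalEquality

  card : ∀ {n} → (Fin n → Bool) → ℕ
  card f = ∣ Vec.tabulate f ∣

  card-none : ∀ {n} (f : Fin n → Bool) → (∀ i → f i ≡ false) → card f ≡ 0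
  card-none {zero}  f none = refl
  card-none {suc n} f none with f zero | none zero
  ... | .false | refl = card-none (f ∘ suc) (none ∘ suc)

  card-unique : ∀ {n} (f : Fin n → Bool) w → f w ≡ true → (∀ u → f u ≡ true → u ≡ w) → card f ≡ 1
  card-unique {suc n} f zero fw only with f zero
  ... | true = cong suc (card-none (f ∘ suc) λ i → off i (f (suc i)) refl)
    where
    off : ∀ i b → f (suc i) ≡ b → b ≡ false
    off i false _ = refl
    off i true  e with only (suc i) e
    ... | ()
  card-unique {suc n} f (suc w) fw only with f zero in f₀
  ... | false = card-unique (f ∘ suc) w fw λ u fu → Fin.suc-injective (only (suc u) fu)
  ... | true with only zero f₀
  ...   | ()

-- Leaves and the partition of a tree into stars.

module Labelling where
  open Rooting
  open Counting
  open import Data.Bool.Base using (Bool; true; false)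
  open import Data.Bool.Properties using (T-≡; _≟_)
  open import Data.Empty using (⊥-elim)
  open import Data.Fin.Base as Fin using (Fin; zero; suc)
  import Data.Fin.Properties as Fin
  import Data.Nat.Properties as ℕ
  open import Data.Sum.Base using (inj₁; inj₂)
  open import Function.Bundles using (Equivalence)
  open import Relation.Binary.PropositionalEquality
  open import Relation.Nullary using (Dec; yes; no; does)
  open import Relation.Nullary.Decidable using (_×-dec_; ¬?)

  -- center v holds iff some child of v is not a center; the star of a center
  -- consists of it and of its children that are not centers.
  record StarPartition {n} (G : Graph n) (r : Fin n) : Set where
    field
      rooted : Rooted G r
    open Rooted rooted public
    field
      center       : Fin n → Bool
      center-root  : center r ≡ true
      center-child : ∀ v → center v ≡ true → ∃[ u ] (u ≢ r × parent u ≡ v × center u ≡ false)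
      other-child  : ∀ v → center v ≡ false → ∀ u → u ≢ r → parent u ≡ v → center u ≡ true

    other≢r : ∀ {v} → center v ≡ false → v ≢ r
    other≢r c refl with trans (sym center-root) c
    ... | ()

  module _ {n} (G : Graph n) where
    open Graph G

    degree-one : ∀ v w → Adj v w → (∀ u → Adj v u → u ≡ w) → degree v ≡ 1
    degree-one v w a only = card-unique (adj v) w (Equivalence.to T-≡ a) λ u e → only u (Equivalence.from T-≡ e)

    module _ {r} (R : Rooted G r) where
      open Rooted R

      childless-neighbour : ∀ v → v ≢ r → (∀ u → u ≢ r → parent u ≢ v) → ∀ u → Adj v u → u ≡ parent v
      childless-neighbour v v≢r none u a with adj-only v u a
      ... | inj₁ (_ , pv≡u)   = sym pv≡u
      ... | inj₂ (u≢r , pu≡v) = ⊥-elim (none u u≢r pu≡v)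

      module Labels (H : ℕ) (depth≤H : ∀ v → depth v ℕ.≤ H) where

        Child : (Fin n → Bool) → Fin n → Set
        Child label v = ∃[ u ] (u ≢ r × parent u ≡ v × label u ≡ false)

        child? : ∀ label v → Dec (Child label v)
        child? label v = Fin.any? λ u → ¬? (u Fin.≟ r) ×-dec ((parent u Fin.≟ v) ×-dec (label u ≟ false))

        -- Labels are computed from the deepest level upwards; `k` is the number of levels below
        -- `v`. The default `false` is correct as vertices of depth `H` are childless. Only the
        -- values at `k = H ∸ depth v` are meaningful.
        label : ℕ → Fin n → Bool
        label zero    v = false
        label (suc k) v = does (child? (label k) v)

        center : Fin n → Bool
        center v = label (H ℕ.∸ depth v) v

        level : ∀ {u v k} → u ≢ r → parent u ≡ v → H ℕ.∸ depth v ≡ suc k → H ℕ.∸ depth u ≡ k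
        level {u} {v} {k} u≢r refl eq = trans (cong (H ℕ.∸_) (depth-parent u u≢r))
          (trans (sym (ℕ.pred[m∸n]≡m∸[1+n] H (depth v))) (cong ℕ.pred eq))

        center-child : ∀ v → center v ≡ true → Child center v
        center-child v cv with H ℕ.∸ depth v in eq
        ... | suc k with child? (label k) v
        ...   | yes (u , u≢r , pu≡v , lu) = u , u≢r , pu≡v , trans (cong (λ k → label k u) (level u≢r pu≡v eq)) lu

        other-child : ∀ v → center v ≡ false → ∀ u → u ≢ r → parent u ≡ v → center u ≡ true
        other-child v cv u u≢r pu≡v with H ℕ.∸ depth v in eq
        ... | zero = ⊥-elim (ℕ.<⇒≱ (ℕ.≤-trans (ℕ.≤-reflexive (trans (cong (λ v → suc (depth v)) (sym pu≡v)) (sym (depth-parent u u≢r)))) (depth≤H u))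
                       (ℕ.m∸n≡0⇒m≤n eq))
        ... | suc k with child? (label k) v
        ...   | no none with label k u in lu
        ...     | true  = trans (cong (λ k → label k u) (level u≢r pu≡v eq)) lu
        ...     | false = ⊥-elim (none (u , u≢r , pu≡v , lu))

    -- This is why the root is adjacent to a leaf: the leaf is childless and so no center, hence the
    -- root has a child that is not a center and is itself a center.
    starPartition : ∀ {r} → Rooted G r → ∀ {ℓ} → Adj ℓ r → (∀ u → Adj ℓ u → u ≡ r) → StarPartition G r
    starPartition {r} R {ℓ} a only = record
      { rooted       = R
      ; center       = center
      ; center-root  = root (center r) refl
      ; center-child = center-child
      ; other-child  = other-child
      }
      where
      open Rooted R
      open Labels R (depth (proj₁ (argmax r depth))) (proj₂ (argmax r depth))
      ℓ≢r : ℓ ≢ r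
      ℓ≢r refl = ¬adj-self G a refl
      parent-ℓ : parent ℓ ≡ r
      parent-ℓ = only (parent ℓ) (adj-parent ℓ ℓ≢r)
      ℓ-other : ∀ b → center ℓ ≡ b → b ≡ false
      ℓ-other false _ = refl
      ℓ-other true  e with center-child ℓ e
      ... | u , u≢r , pu≡ℓ , _ = ⊥-elim (u≢r (only u (adj-flip G (subst (Adj u) pu≡ℓ (adj-parent u u≢r)))))
      root : ∀ b → center r ≡ b → b ≡ true
      root true  _ = refl
      root false e with trans (sym (other-child r e ℓ ℓ≢r parent-ℓ)) (ℓ-other (center ℓ) refl)
      ... | ()

    -- A deepest vertex has no children, so its parent is its only neighbour; the second vertex `y`
    -- guarantees that the deepest vertex differs from the root.
    leaf-exists : IsTree → ∀ {x y : Fin n} → x ≢ y → ∃[ ℓ ] ∃[ w ] (Adj ℓ w × ∀ u → Adj ℓ u → u ≡ w)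
    leaf-exists tree {x} {y} x≢y = ℓ , parent ℓ , adj-parent ℓ ℓ≢x ,
      childless-neighbour R ℓ ℓ≢x λ u u≢x pu≡ℓ → ℕ.<⇒≱
        (ℕ.≤-reflexive (trans (cong (λ v → suc (depth v)) (sym pu≡ℓ)) (sym (depth-parent u u≢x)))) (proj₂ deepest u)
      where
      R = rootAt G tree x
      open Rooted R
      deepest = argmax x depth
      ℓ = proj₁ deepest
      ℓ≢x : ℓ ≢ x
      ℓ≢x e = ℕ.<⇒≱ (ℕ.≤-trans (ℕ.s≤s ℕ.z≤n) (ℕ.≤-reflexive (sym (depth-parent y (λ y≡x → x≢y (sym y≡x))))))
        (ℕ.≤-trans (proj₂ deepest y) (ℕ.≤-reflexive (trans (cong depth e) depth-root)))

    leaf-partition : IsTree → ∀ {x y : Fin n} → x ≢ y → ∃[ r ] ∃[ ℓ ] (StarPartition G r × Adj r ℓ × degree ℓ ≡ 1)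
    leaf-partition tree x≢y with leaf-exists tree x≢y
    ... | ℓ , w , a , only = w , ℓ , starPartition (rootAt G tree w) a only , adj-flip G a , degree-one ℓ w a only

-- The test vectors of the stars and their quadratic forms.

module StarVectors (𝓡 : RealRing) where
  open Order 𝓡
  open Counting
  open Labelling
  open PowerTraces 𝓡 using (charpoly)
  open Spectral 𝓡 using (form; ky-fan)
  open Det commutativeRing using (Matrix)
  open import Algebra.Definitions.RawMonoid *-rawMonoid using () renaming (sum to product)
  open import Data.Bool.Base using (Bool; true; false; not; _∧_; T)
  open import Data.Bool.Properties using (T-≡)
  open import Data.Empty using (⊥-elim)
  open import Data.Fin.Base as Fin using (Fin; zero; suc)
  import Data.Fin.Properties as Fin
  import Data.Nat.Properties as ℕ
  open import Data.Sum.Base using (inj₁; inj₂)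
  open import Function.Base using (_∘_)
  open import Function.Bundles using (Equivalence)
  open import Relation.Binary.PropositionalEquality as ≡ using (_≡_; _≢_)
  open import Relation.Nullary using (¬_; Dec; yes; no; does)

  ⟦_⟧ : Bool → Carrier
  ⟦ true  ⟧ = 1#
  ⟦ false ⟧ = 0#

  ⟦⟧-nonNeg : ∀ b → 0# ≤ ⟦ b ⟧
  ⟦⟧-nonNeg true  = 0≤1
  ⟦⟧-nonNeg false = ≤-refl

  ∑-⟦⟧ : ∀ {n} (f : Fin n → Bool) → ∑ (λ i → ⟦ f i ⟧) ≈ ι (card f)
  ∑-⟦⟧ {zero}  f = ∑-zero _
  ∑-⟦⟧ {suc n} f with f zero in eq
  ... | true  = trans (∑-suc _) (trans (+-cong (reflexive (≡.cong ⟦_⟧ eq)) (∑-⟦⟧ (f ∘ suc))) (sym (ι-suc (card (f ∘ suc)))))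
  ... | false = trans (∑-suc _) (trans (+-cong (reflexive (≡.cong ⟦_⟧ eq)) (∑-⟦⟧ (f ∘ suc))) (+-identityˡ _))

  card-some : ∀ {n} (f : Fin n → Bool) w → f w ≡ true → ∃[ k ] card f ≡ suc k
  card-some {suc n} f zero    fw with f zero
  ... | true = _ , ≡.refl
  card-some {suc n} f (suc w) fw with f zero | card-some (f ∘ suc) w fw
  ... | true  | k , e = suc k , ≡.cong suc e
  ... | false | k , e = k , e

  square≈0 : ∀ {x} → x * x ≈ 0# → x ≈ 0#
  square≈0 {x} e = ∣x∣≤0⇒x≈0 (∣∣-square-≤ ≤-refl (≤-reflexive (trans e (sym (zeroˡ 0#)))))

  ½ : Carrier
  ½ = 1/suc 1

  ½+½ : ι 2 * ½ ≈ 1#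
  ½+½ = 1/suc-inverse 1

  -- The reciprocal, with value 0 at 0: it gives weight 0 to the vertices that are not centers.
  κ : ℕ → Carrier
  κ zero    = 0#
  κ (suc k) = 1/suc k

  κ-nonNeg : ∀ k → 0# ≤ κ k
  κ-nonNeg zero    = ≤-refl
  κ-nonNeg (suc k) = 1/suc-nonNeg k

  κ-inverse : ∀ {k j} → k ≡ suc j → κ k * ι k ≈ 1#
  κ-inverse {j = j} ≡.refl = trans (*-comm _ _) (1/suc-inverse j)

  module Partition {n} (G : Graph n) {r} (P : StarPartition G r) where
    open Graph G
    open StarPartition P renaming (parent to p)

    -- Indicators of the non-roots, of the centers and of the other vertices.
    π χ χ̄ : Fin n → Carrier
    π v = 1# - δ r v
    χ v = ⟦ center v ⟧
    χ̄ v = ⟦ not (center v) ⟧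

    π-root : π r ≈ 0#
    π-root = trans (+-congˡ (-‿cong (reflexive (δ-diag r)))) (-‿inverseʳ 1#)

    π-nonroot : ∀ {v} → v ≢ r → π v ≈ 1#
    π-nonroot v≢r = trans (+-congˡ (-‿cong (reflexive (δ-off (v≢r ∘ ≡.sym))))) (trans (+-congˡ -0#≈0#) (+-identityʳ 1#))

    deeper : ∀ {v} → v ≢ r → p v ≢ v
    deeper {v} v≢r e = ℕ.1+n≢n (≡.sym (≡.trans (≡.cong depth (≡.sym e)) (≡.trans (≡.cong depth e) (≡.trans (depth-parent v v≢r) (≡.cong (suc ∘ depth) e)))))

    no-two-cycle : ∀ {u v} → u ≢ r → v ≢ r → p u ≡ v → p v ≢ u
    no-two-cycle {u} {v} u≢r v≢r ≡.refl e = ℕ.<⇒≢ (ℕ.m≤n⇒m≤1+n (ℕ.≤-refl {suc (depth u)}))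
      (≡.sym (≡.sym (≡.trans (depth-parent u u≢r) (≡.cong suc (≡.trans (depth-parent v v≢r) (≡.cong (suc ∘ depth) e))))))

    χ+χ̄ : ∀ v → χ v + χ̄ v ≈ 1#
    χ+χ̄ v with center v
    ... | true  = +-identityʳ 1#
    ... | false = +-identityˡ 1#

    χ̄²≈χ̄ : ∀ v → χ̄ v * χ̄ v ≈ χ̄ v
    χ̄²≈χ̄ v with center v
    ... | true  = zeroˡ 0#
    ... | false = *-identityˡ 1#

    πχ̄ : ∀ v → π v * χ̄ v ≈ χ̄ v
    πχ̄ v with center v in c
    ... | true  = zeroʳ _
    ... | false = trans (*-congʳ (π-nonroot (other≢r c))) (*-identityˡ 1#)

    χ̄χ̄-parent : ∀ v → χ̄ v * χ̄ (p v) ≈ 0#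
    χ̄χ̄-parent v with center v in cv | center (p v) in cp
    ... | true  | _     = zeroˡ _
    ... | false | true  = zeroʳ _
    ... | false | false with ≡.trans (≡.sym cv) (other-child (p v) cp v (other≢r cv) ≡.refl)
    ...   | ()

    star : Fin n → Fin n → Bool
    star c u = not (center u) ∧ does (p u Fin.≟ c)

    size : Fin n → ℕ
    size c = card (star c)

    -- The number of children in the star of c, and its square root.
    d a : Fin n → Carrier
    d c = ∑ λ u → χ̄ u * δ (p u) c
    a c = √ (size c)

    d≈size : ∀ c → d c ≈ ι (size c)
    d≈size c = trans (∑-cong λ u → term (center u) (p u Fin.≟ c)) (∑-⟦⟧ (star c))
      where
      open import Data.Bool.Base using (if_then_else_)
      term : ∀ b {A : Set} (D : Dec A) → ⟦ not b ⟧ * (if does D then 1# else 0#) ≈ ⟦ not b ∧ does D ⟧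
      term true  D       = zeroˡ _
      term false (yes _) = *-identityˡ 1#
      term false (no _)  = zeroʳ 1#

    a² : ∀ c → a c * a c ≈ d c
    a² c = trans (√-square (size c)) (sym (d≈size c))

    0≤a : ∀ c → 0# ≤ a c
    0≤a c = √-nonNeg (size c)

    0≤d : ∀ c → 0# ≤ d c
    0≤d c = ≤-respʳ (a² c) (square-nonNeg (a c))

    -- The children of such a vertex are all centers. Therefore `d` and `a` vanish off the centers,
    -- and sums over stars can run over all vertices.
    size-other : ∀ {c} → center c ≡ false → size c ≡ 0
    size-other {c} cc = card-none (star c) λ u → none u
      where
      none : ∀ u → star c u ≡ false
      none u with center u in cu | p u Fin.≟ c
      ... | true  | _      = ≡.refl
      ... | false | no _   = ≡.refl
      ... | false | yes pu with ≡.trans (≡.sym cu) (other-child c cc u (other≢r cu) pu)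
      ...   | ()

    star-member : ∀ {c u} → p u ≡ c → center u ≡ false → star c u ≡ true
    star-member {c} {u} pu≡c cu with center u | cu | p u Fin.≟ c
    ... | .false | ≡.refl | yes _   = ≡.refl
    ... | .false | ≡.refl | no pu≢c = ⊥-elim (pu≢c pu≡c)

    size-center : ∀ {c} → center c ≡ true → ∃[ k ] size c ≡ suc k
    size-center {c} cc with center-child c cc
    ... | u , _ , pu≡c , cu = card-some (star c) u (star-member pu≡c cu)

    a-other : ∀ {c} → center c ≡ false → a c ≈ 0#
    a-other {c} cc = square≈0 (trans (√-square (size c)) (reflexive (≡.cong ι (size-other cc))))

    χ̄a : ∀ c → χ̄ c * a c ≈ 0#
    χ̄a c with center c in cc
    ... | true  = zeroˡ _
    ... | false = trans (*-congˡ (a-other cc)) (zeroʳ _)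

    χa : ∀ c → χ c * a c ≈ a c
    χa c = trans (solve 3 (λ x y a → x :* a := (x :+ y) :* a :- y :* a) refl (χ c) (χ̄ c) (a c))
      (trans (+-cong (trans (*-congʳ (χ+χ̄ c)) (*-identityˡ _)) (-‿cong (χ̄a c)))
        (solve 1 (λ a → a :- :ι 0 := a) refl (a c)))

    χd : ∀ c → χ c * d c ≈ d c
    χd c = trans (*-congˡ (sym (a² c))) (trans (sym (*-assoc _ _ _)) (trans (*-congʳ (χa c)) (a² c)))

    κd : ∀ c → κ (size c) * d c ≈ χ c
    κd c with center c in cc
    ... | true  = trans (*-congˡ (d≈size c)) (κ-inverse (proj₂ (size-center cc)))
    ... | false = trans (*-congʳ (reflexive (≡.cong κ (size-other cc)))) (zeroˡ _)

    κχ : ∀ c → κ (size c) * χ c ≈ κ (size c)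
    κχ c with center c in cc
    ... | true  = *-identityʳ _
    ... | false = trans (zeroʳ _) (sym (reflexive (≡.cong κ (size-other cc))))

    α ν s : Carrier
    α = ∑ χ̄
    ν = ∑ χ
    s = ∑ a

    α+ν : α + ν ≈ ι n
    α+ν = trans (sym (∑-+ χ̄ χ)) (trans (∑-cong λ v → trans (+-comm _ _) (χ+χ̄ v))
      (trans (∑-const n 1#) (*-identityʳ _)))

    αℕ νℕ : ℕ
    αℕ = card (not ∘ center)
    νℕ = card center

    α≈ : α ≈ ι αℕ
    α≈ = ∑-⟦⟧ (not ∘ center)

    ν≈ : ν ≈ ι νℕ
    ν≈ = ∑-⟦⟧ center

    αℕ-suc : ∃[ k ] αℕ ≡ suc k
    αℕ-suc with center-child r center-root
    ... | u , _ , _ , cu = card-some (not ∘ center) u (≡.cong not cu)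

    -- Double counting: the other vertices are grouped by their parents, `d c` of them at `c`.
    by-star : ∀ (f : Fin n → Carrier) → ∑ (λ u → χ̄ u * f (p u)) ≈ ∑ λ c → d c * f c
    by-star f = begin-equality
      ∑ (λ u → χ̄ u * f (p u))
        ≈⟨ (∑-cong λ u → *-congˡ (sym (∑-δˡ (p u) f))) ⟩
      ∑ (λ u → χ̄ u * ∑ λ c → δ (p u) c * f c)
        ≈⟨ (∑-cong λ u → trans (*-∑ _ _) (∑-cong λ c → sym (*-assoc _ _ _))) ⟩
      ∑ (λ u → ∑ λ c → χ̄ u * δ (p u) c * f c)
        ≈⟨ ∑-comm _ ⟩
      ∑ (λ c → ∑ λ u → χ̄ u * δ (p u) c * f c)
        ≈⟨ (∑-cong λ c → sym (∑-* (f c) _)) ⟩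
      ∑ (λ c → d c * f c) ∎

    ∑d : ∑ d ≈ α
    ∑d = trans (∑-cong λ c → sym (*-identityʳ (d c))) (trans (sym (by-star (λ _ → 1#))) (∑-cong λ u → *-identityʳ (χ̄ u)))

    -- The indicator vector of `L_c`.
    X : Fin n → Fin n → Carrier
    X c i = χ̄ i * δ (p i) c

    h : Fin n → Carrier
    h i = χ̄ i + a i

    v : Fin n → Fin n → Carrier
    v c i = a c * δ c i - X c i

    aX : ∀ b c → a c * X b c ≈ 0#
    aX b c = trans (sym (*-assoc _ _ _)) (trans (*-congʳ (trans (*-comm _ _) (χ̄a c))) (zeroˡ _))

    ∑-XX : ∀ b c → ∑ (λ i → X b i * X c i) ≈ δ b c * d c
    ∑-XX b c = trans (∑-cong term) (sym (*-∑ (δ b c) _))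
      where
      term : ∀ i → X b i * X c i ≈ δ b c * (χ̄ i * δ (p i) c)
      term i = begin-equality
        χ̄ i * δ (p i) b * (χ̄ i * δ (p i) c)
          ≈⟨ solve 3 (λ x s t → x :* s :* (x :* t) := x :* x :* (t :* s)) refl (χ̄ i) (δ (p i) b) (δ (p i) c) ⟩
        χ̄ i * χ̄ i * (δ (p i) c * δ (p i) b)
          ≈⟨ *-cong (χ̄²≈χ̄ i) (*-congˡ (reflexive (δ-sym (p i) b))) ⟩
        χ̄ i * (δ (p i) c * δ b (p i))
          ≈⟨ *-congˡ (sym (δ-replace (p i) c (δ b))) ⟩
        χ̄ i * (δ (p i) c * δ b c)
          ≈⟨ solve 3 (λ x s t → x :* (s :* t) := t :* (x :* s)) refl (χ̄ i) (δ (p i) c) (δ b c) ⟩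
        δ b c * (χ̄ i * δ (p i) c) ∎

    -- The sets `L_b` and `L_c` are disjoint for different stars and contain no center; within one
    -- star, `e_c` and `L_c` contribute `d c` each.
    vv : ∀ b c → ∑ (λ i → v b i * v c i) ≈ δ b c * (ι 2 * d c)
    vv b c = begin-equality
      ∑ (λ i → (a b * δ b i - X b i) * (a c * δ c i - X c i))
        ≈⟨ (∑-cong λ i → solve 6 (λ a s x b t y → (a :* s :- x) :* (b :* t :- y) :=
              (s :* (a :* (b :* t)) :- s :* (a :* y)) :- (t :* (b :* x) :- x :* y)) refl (a b) (δ b i) (X b i) (a c) (δ c i) (X c i)) ⟩
      ∑ (λ i → (δ b i * (a b * (a c * δ c i)) - δ b i * (a b * X c i)) - (δ c i * (a c * X b i) - X b i * X c i))
        ≈⟨ trans (∑-sub _ _) (+-cong (∑-sub _ _) (-‿cong (∑-sub _ _))) ⟩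
      (∑ (λ i → δ b i * (a b * (a c * δ c i))) - ∑ (λ i → δ b i * (a b * X c i))) - (∑ (λ i → δ c i * (a c * X b i)) - ∑ (λ i → X b i * X c i))
        ≈⟨ +-cong (+-cong (∑-δˡ b _) (-‿cong (trans (∑-δˡ b _) (aX c b)))) (-‿cong (+-cong (trans (∑-δˡ c _) (aX b c)) (-‿cong (∑-XX b c)))) ⟩
      (a b * (a c * δ c b) - 0#) - (0# - δ b c * d c)
        ≈⟨ solve 5 (λ a b s t d → a :* (b :* s) :- :ι 0 :- (:ι 0 :- t :* d) := s :* a :* b :+ t :* d) refl (a b) (a c) (δ c b) (δ b c) (d c) ⟩
      δ c b * a b * a c + δ b c * d c
        ≈⟨ +-congʳ (trans (*-congʳ (δ-replace c b a)) (trans (*-assoc _ _ _) (trans (*-congˡ (a² c)) (*-congʳ (reflexive (δ-sym c b)))))) ⟩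
      δ b c * d c + δ b c * d c
        ≈⟨ solve 2 (λ s d → s :* d :+ s :* d := s :* (:ι 2 :* d)) refl (δ b c) (d c) ⟩
      δ b c * (ι 2 * d c) ∎

    hv : ∀ c → ∑ (λ i → h i * v c i) ≈ 0#
    hv c = begin-equality
      ∑ (λ i → (χ̄ i + a i) * (a c * δ c i - X c i))
        ≈⟨ (∑-cong λ i → trans (solve 5 (λ x b a s t → (x :+ b) :* (a :* s :- x :* t) := s :* ((x :+ b) :* a) :- (x :* x :* t :+ x :* b :* t)) refl
              (χ̄ i) (a i) (a c) (δ c i) (δ (p i) c))
            (+-congˡ (-‿cong (trans (+-cong (*-congʳ (χ̄²≈χ̄ i)) (trans (*-congʳ (χ̄a i)) (zeroˡ _))) (+-identityʳ _))))) ⟩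
      ∑ (λ i → δ c i * ((χ̄ i + a i) * a c) - X c i)
        ≈⟨ trans (∑-sub _ _) (+-congʳ (∑-δˡ c _)) ⟩
      (χ̄ c + a c) * a c - d c
        ≈⟨ +-congʳ (trans (distribʳ _ _ _) (trans (+-cong (χ̄a c) (a² c)) (+-identityˡ _))) ⟩
      d c - d c ≈⟨ -‿inverseʳ _ ⟩
      0# ∎

    ∑h² : ∑ (λ i → h i * h i) ≈ ι 2 * α
    ∑h² = begin-equality
      ∑ (λ i → h i * h i)
        ≈⟨ (∑-cong λ i → trans (solve 2 (λ x b → (x :+ b) :* (x :+ b) := x :* x :+ b :* b :+ :ι 2 :* (x :* b)) refl (χ̄ i) (a i))
             (trans (+-cong (+-cong (χ̄²≈χ̄ i) (a² i)) (trans (*-congˡ (χ̄a i)) (zeroʳ _))) (+-identityʳ _))) ⟩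
      ∑ (λ i → χ̄ i + d i)     ≈⟨ trans (∑-+ χ̄ d) (+-congˡ ∑d) ⟩
      α + α                     ≈⟨ solve 1 (λ x → x :+ x := :ι 2 :* x) refl α ⟩
      ι 2 * α ∎

    -- Half the quadratic form of the adjacency matrix.
    Q : (Fin n → Carrier) → Carrier
    Q w = ∑ λ i → π i * (w i * w (p i))

    -- The edges at a non-root center, towards its parent.
    Se : Carrier
    Se = ∑ λ i → π i * (a i * h (p i))

    ∑da : Carrier
    ∑da = ∑ λ c → d c * a c

    parent-yes : ∀ {i j} → i ≢ r → p i ≡ j → π i * δ (p i) j ≈ 1#
    parent-yes {i} i≢r ≡.refl = trans (*-cong (π-nonroot i≢r) (reflexive (δ-diag (p i)))) (*-identityˡ 1#)

    parent-no : ∀ {i j} → ¬ (i ≢ r × p i ≡ j) → π i * δ (p i) j ≈ 0#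
    parent-no {i} {j} no-edge with i Fin.≟ r
    ... | yes ≡.refl = trans (*-congʳ π-root) (zeroˡ _)
    ... | no i≢r     = trans (*-congˡ (reflexive (δ-off λ pi≡j → no-edge (i≢r , pi≡j)))) (zeroʳ _)

    -- An edge joins a vertex to its parent in exactly one direction, since depth excludes
    -- two-cycles. A sum over edges thus becomes a sum over the non-roots.
    adjacency : ∀ i j → ⟦ adj i j ⟧ ≈ π i * δ (p i) j + π j * δ (p j) i
    adjacency i j with adj i j in eq
    ... | false = sym (trans (+-cong
        (parent-no λ (i≢r , e) → absurd (≡.subst (Adj i) e (adj-parent i i≢r)))
        (parent-no λ (j≢r , e) → absurd (≡.subst T (adj-sym j i) (≡.subst (Adj j) e (adj-parent j j≢r)))))
        (+-identityˡ 0#))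
      where
      absurd : ¬ Adj i j
      absurd t = ≡.subst T eq t
    ... | true with adj-only i j (Equivalence.from T-≡ eq)
    ...   | inj₁ (i≢r , pi≡j) = sym (trans (+-cong (parent-yes i≢r pi≡j)
              (parent-no λ (j≢r , pj≡i) → no-two-cycle i≢r j≢r pi≡j pj≡i)) (+-identityʳ 1#))
    ...   | inj₂ (j≢r , pj≡i) = sym (trans (+-cong (parent-no λ (i≢r , pi≡j) → no-two-cycle j≢r i≢r pj≡i pi≡j)
              (parent-yes j≢r pj≡i)) (+-identityˡ 1#))

    ∑∑-edges : ∀ (w : Fin n → Carrier) → ∑ (λ i → ∑ λ j → π i * δ (p i) j * (w i * w j)) ≈ Q w
    ∑∑-edges w = ∑-cong λ i → trans
      (∑-cong λ j → solve 4 (λ q e x y → q :* e :* (x :* y) := e :* (q :* (x :* y))) refl (π i) (δ (p i) j) (w i) (w j))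
      (∑-δˡ (p i) λ j → π i * (w i * w j))

    module SeidelMatrix (S : Matrix n) (seidel-entry : ∀ i j → S i j ≈ 1# - δ i j - ι 2 * ⟦ adj i j ⟧) where

      -- `S = J - I - 2A`, and each edge occurs twice in the form of `A`.
      seidel-form : ∀ w → form S w ≈ ∑ w * ∑ w - ∑ (λ i → w i * w i) - ι 4 * Q w
      seidel-form w = begin-equality
        ∑ (λ i → ∑ λ j → w i * S i j * w j)
          ≈⟨ (∑-cong λ i → ∑-cong λ j → trans
               (*-congʳ (*-congˡ (trans (seidel-entry i j) (+-congˡ (-‿cong (*-congˡ (adjacency i j)))))))
               (solve 5 (λ x y e f g → x :* (:ι 1 :- e :- :ι 2 :* (f :+ g)) :* y :=
                  (x :* y :- e :* (x :* y)) :- (:ι 2 :* (f :* (x :* y)) :+ :ι 2 :* (g :* (y :* x))))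
                  refl (w i) (w j) (δ i j) (π i * δ (p i) j) (π j * δ (p j) i))) ⟩
        ∑ (λ i → ∑ λ j → (w i * w j - δ i j * (w i * w j)) - (ι 2 * F i j + ι 2 * F j i))
          ≈⟨ (∑-cong λ i → trans (∑-sub _ _) (+-cong (∑-sub _ _) (-‿cong (∑-+ _ _)))) ⟩
        ∑ (λ i → (∑ (λ j → w i * w j) - ∑ (λ j → δ i j * (w i * w j))) - (∑ (λ j → ι 2 * F i j) + ∑ (λ j → ι 2 * F j i)))
          ≈⟨ trans (∑-sub _ _) (+-cong (∑-sub _ _) (-‿cong (∑-+ _ _))) ⟩
        (∑ (λ i → ∑ (λ j → w i * w j)) - ∑ (λ i → ∑ (λ j → δ i j * (w i * w j)))) - (∑ (λ i → ∑ λ j → ι 2 * F i j) + ∑ (λ i → ∑ (λ j → ι 2 * F j i)))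
          ≈⟨ +-cong (+-cong (trans (∑-cong λ i → sym (*-∑ (w i) w)) (sym (∑-* (∑ w) w)))
                            (-‿cong (∑-cong λ i → ∑-δˡ i λ j → w i * w j)))
                    (-‿cong (+-cong F-sum (trans (∑-comm _) F-sum))) ⟩
        ∑ w * ∑ w - ∑ (λ i → w i * w i) - (ι 2 * Q w + ι 2 * Q w)
          ≈⟨ +-congˡ (-‿cong (solve 1 (λ q → :ι 2 :* q :+ :ι 2 :* q := :ι 4 :* q) refl (Q w))) ⟩
        ∑ w * ∑ w - ∑ (λ i → w i * w i) - ι 4 * Q w ∎
        where
        F : Fin n → Fin n → Carrier
        F i j = π i * δ (p i) j * (w i * w j)
        F-sum : ∑ (λ i → ∑ λ j → ι 2 * F i j) ≈ ι 2 * Q w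
        F-sum = trans (∑-cong λ i → sym (*-∑ (ι 2) _)) (trans (sym (*-∑ (ι 2) _)) (*-congˡ (∑∑-edges w)))

      ∑v : ∀ c → ∑ (v c) ≈ a c - d c
      ∑v c = trans (∑-sub _ _) (+-congʳ (trans (∑-cong λ i → *-comm _ _) (∑-δˡ c λ _ → a c)))

      ∑h : ∑ h ≈ α + s
      ∑h = ∑-+ χ̄ a

      -- The support of `v c` is one star, whose only edges are the `d c` edges from `c` to `L_c`;
      -- each contributes `- a c`.
      Qv : ∀ c → Q (v c) ≈ - (a c * d c)
      Qv c = begin-equality
        ∑ (λ i → π i * (v c i * v c (p i)))
          ≈⟨ (∑-cong λ i → term i) ⟩
        ∑ (λ i → - (a c * X c i))
          ≈⟨ trans (∑-neg _) (-‿cong (sym (*-∑ (a c) _))) ⟩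
        - (a c * d c) ∎
        where
        Term : Fin n → Set
        Term i = π i * (v c i * v c (p i)) ≈ - (a c * X c i)
        X≈0 : ∀ {i} → p i ≢ c → X c i ≈ 0#
        X≈0 pi≢c = trans (*-congˡ (reflexive (δ-off pi≢c))) (zeroʳ _)
        vanish : ∀ {i} → π i * (v c i * v c (p i)) ≈ 0# → X c i ≈ 0# → Term i
        vanish e x = trans e (sym (trans (-‿cong (trans (*-congˡ x) (zeroʳ _))) -0#≈0#))
        at-root : Term r
        at-root = vanish (trans (*-congʳ π-root) (zeroˡ _))
          (trans (*-congʳ (reflexive (≡.cong (⟦_⟧ ∘ not) center-root))) (zeroˡ _))
        -- The edge from `i = c` to its parent: if the parent belonged to `L_c`, it would also be a
        -- child of `c`.
        no-loop : ∀ {i} → i ≢ r → Dec (c ≡ i) → ∀ b → center (p i) ≡ b → Dec (p (p i) ≡ c) →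
          a c * δ c i * X c (p i) ≈ 0#
        no-loop i≢r (no c≢i) _ _ _ = trans (*-congʳ (trans (*-congˡ (reflexive (δ-off c≢i))) (zeroʳ _))) (zeroˡ _)
        no-loop i≢r (yes _) true cpi _ = trans (*-congˡ (trans (*-congʳ (reflexive (≡.cong (⟦_⟧ ∘ not) cpi))) (zeroˡ _))) (zeroʳ _)
        no-loop i≢r (yes _) false cpi (no ppi≢c) = trans (*-congˡ (X≈0 ppi≢c)) (zeroʳ _)
        no-loop i≢r (yes ≡.refl) false cpi (yes ppi≡i) = ⊥-elim (no-two-cycle i≢r (other≢r cpi) ≡.refl ppi≡i)
        above : ∀ {i} → i ≢ r → p i ≢ c → Term i
        above {i} i≢r pi≢c = vanish (trans (*-congˡ (begin-equality
          (a c * δ c i - X c i) * (a c * δ c (p i) - X c (p i))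
            ≈⟨ *-cong (+-congˡ (-‿cong (X≈0 pi≢c))) (+-congʳ (*-congˡ (reflexive (δ-off (pi≢c ∘ ≡.sym))))) ⟩
          (a c * δ c i - 0#) * (a c * 0# - X c (p i))
            ≈⟨ solve 3 (λ a s x → (a :* s :- :ι 0) :* (a :* :ι 0 :- x) := :- (a :* s :* x)) refl (a c) (δ c i) (X c (p i)) ⟩
          - (a c * δ c i * X c (p i))
            ≈⟨ trans (-‿cong (no-loop i≢r (c Fin.≟ i) (center (p i)) ≡.refl (p (p i) Fin.≟ c))) -0#≈0# ⟩
          0# ∎)) (zeroʳ _)) (X≈0 pi≢c)
        X-self : ∀ b → center c ≡ b → X c c ≈ 0#
        X-self true  cc = trans (*-congʳ (reflexive (≡.cong (⟦_⟧ ∘ not) cc))) (zeroˡ _)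
        X-self false cc = X≈0 (deeper (other≢r cc))
        below : ∀ {i} → i ≢ r → p i ≡ c → Term i
        below {i} i≢r ≡.refl = trans (*-cong (π-nonroot i≢r) (*-cong
            (+-congʳ (trans (*-congˡ (reflexive (δ-off (deeper i≢r)))) (zeroʳ _)))
            (+-cong (trans (*-congˡ (reflexive (δ-diag c))) (*-identityʳ _)) (-‿cong (X-self (center c) ≡.refl)))))
          (solve 2 (λ a x → :ι 1 :* ((:ι 0 :- x) :* (a :- :ι 0)) := :- (a :* x)) refl (a c) (X c i))
        cases : ∀ {i} → Dec (i ≡ r) → Dec (p i ≡ c) → Term i
        cases (yes ≡.refl) _        = at-root
        cases (no i≢r) (no pi≢c)    = above i≢r pi≢c
        cases (no i≢r) (yes pi≡c)   = below i≢r pi≡c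
        term : ∀ i → Term i
        term i = cases (i Fin.≟ r) (p i Fin.≟ c)

      -- Edges are sorted by their lower end. If it is not a center, the edge lies inside a star and
      -- contributes `√d_c`; if it is a center, the edge joins two stars and is counted by `Se`.
      Qh : Q h ≈ ∑da + Se
      Qh = begin-equality
        ∑ (λ i → π i * ((χ̄ i + a i) * (χ̄ (p i) + a (p i))))
          ≈⟨ (∑-cong λ i → trans (solve 5 (λ q x y z w → q :* ((x :+ y) :* (z :+ w)) := q :* (x :* z) :+ q :* x :* w :+ q :* (y :* (z :+ w))) refl
                (π i) (χ̄ i) (a i) (χ̄ (p i)) (a (p i)))
              (+-congʳ (trans (+-cong (trans (*-congˡ (χ̄χ̄-parent i)) (zeroʳ _)) (*-congʳ (πχ̄ i))) (+-identityˡ _)))) ⟩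
        ∑ (λ i → χ̄ i * a (p i) + π i * (a i * h (p i)))
          ≈⟨ trans (∑-+ _ _) (+-congʳ (by-star a)) ⟩
        ∑da + Se ∎

      form-v : ∀ c → form S (v c) ≈ d c * d c - d c + ι 2 * (a c * d c)
      form-v c = begin-equality
        form S (v c)
          ≈⟨ seidel-form (v c) ⟩
        ∑ (v c) * ∑ (v c) - ∑ (λ i → v c i * v c i) - ι 4 * Q (v c)
          ≈⟨ +-cong (+-cong (*-cong (∑v c) (∑v c)) (-‿cong (trans (vv c c) (trans (*-congʳ (reflexive (δ-diag c))) (*-identityˡ _))))) (-‿cong (*-congˡ (Qv c))) ⟩
        (a c - d c) * (a c - d c) - ι 2 * d c - ι 4 * - (a c * d c)
          ≈⟨ solve 2 (λ a d → (a :- d) :* (a :- d) :- :ι 2 :* d :- :ι 4 :* (:- (a :* d)) := a :* a :+ d :* d :- :ι 2 :* d :+ :ι 2 :* (a :* d)) refl (a c) (d c) ⟩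
        a c * a c + d c * d c - ι 2 * d c + ι 2 * (a c * d c)
          ≈⟨ +-congʳ (+-congʳ (+-congʳ (a² c))) ⟩
        d c + d c * d c - ι 2 * d c + ι 2 * (a c * d c)
          ≈⟨ solve 2 (λ d x → d :+ d :* d :- :ι 2 :* d :+ :ι 2 :* x := d :* d :- d :+ :ι 2 :* x) refl (d c) (a c * d c) ⟩
        d c * d c - d c + ι 2 * (a c * d c) ∎

      κ-form-v : ∀ c → κ (size c) * form S (v c) ≈ d c - χ c + ι 2 * a c
      κ-form-v c = begin-equality
        k * form S (v c)                        ≈⟨ *-congˡ (form-v c) ⟩
        k * (d c * d c - d c + ι 2 * (a c * d c))
          ≈⟨ solve 3 (λ k d a → k :* (d :* d :- d :+ :ι 2 :* (a :* d)) := (k :* d) :* d :- k :* d :+ :ι 2 :* ((k :* d) :* a)) refl k (d c) (a c) ⟩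
        k * d c * d c - k * d c + ι 2 * (k * d c * a c)
          ≈⟨ +-cong (+-cong (trans (*-congʳ (κd c)) (χd c)) (-‿cong (κd c))) (*-congˡ (trans (*-congʳ (κd c)) (χa c))) ⟩
        d c - χ c + ι 2 * a c ∎
        where k = κ (size c)

      form-h : form S h ≈ (α + s) * (α + s) - ι 2 * α - ι 4 * (∑da + Se)
      form-h = trans (seidel-form h) (+-cong (+-cong (*-cong ∑h ∑h) (-‿cong ∑h²)) (-‿cong (*-congˡ Qh)))

      S-diagonal : ∀ i → S i i ≈ 0#
      S-diagonal i = trans (seidel-entry i i) (trans
        (+-cong (+-congˡ (-‿cong (reflexive (δ-diag i)))) (-‿cong (*-congˡ (reflexive (≡.cong ⟦_⟧ (adj-irrefl i))))))
        (solve 1 (λ x → :ι 1 :- :ι 1 :- :ι 2 :* :ι 0 := :ι 0) refl 0#))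

      S-symmetric : ∀ i j → S i j ≈ S j i
      S-symmetric i j = trans (seidel-entry i j) (trans
        (+-cong (+-congˡ (-‿cong (reflexive (δ-sym i j)))) (-‿cong (*-congˡ (reflexive (≡.cong ⟦_⟧ (adj-sym i j))))))
        (sym (seidel-entry j i)))

      S≤1 : ∀ i j → 0# ≤ 1# - S i j
      S≤1 i j = ≤-respʳ (sym (trans (+-congˡ (-‿cong (seidel-entry i j)))
          (solve 2 (λ e b → :ι 1 :- (:ι 1 :- e :- :ι 2 :* b) := e :+ :ι 2 :* b) refl (δ i j) ⟦ adj i j ⟧)))
        (+-nonNeg (δ-nonNeg i j) (*-nonNeg (ι-nonNeg 2) (⟦⟧-nonNeg (adj i j))))
        where
        δ-nonNeg : ∀ (i j : Fin n) → 0# ≤ δ i j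
        δ-nonNeg i j with i Fin.≟ j
        ... | yes _ = 0≤1
        ... | no  _ = ≤-refl

      -1≤S : ∀ i j → 0# ≤ 1# + S i j
      -1≤S i j = ≤-respʳ (sym (+-congˡ (seidel-entry i j))) nonneg
        where
        nonneg : 0# ≤ 1# + (1# - δ i j - ι 2 * ⟦ adj i j ⟧)
        nonneg with i Fin.≟ j | adj i j in eq
        ... | no _       | true  = ≤-reflexive (solve 1 (λ x → :ι 0 := :ι 1 :+ (:ι 1 :- :ι 0 :- :ι 2 :* :ι 1)) refl 0#)
        ... | no _       | false = ≤-respʳ (solve 1 (λ x → :ι 2 := :ι 1 :+ (:ι 1 :- :ι 0 :- :ι 2 :* :ι 0)) refl 0#) (ι-nonNeg 2)
        ... | yes ≡.refl | false = ≤-respʳ (solve 1 (λ x → :ι 1 := :ι 1 :+ (:ι 1 :- :ι 1 :- :ι 2 :* :ι 0)) refl 0#) 0≤1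
        ... | yes ≡.refl | true with ≡.trans (≡.sym eq) (adj-irrefl i)
        ...   | ()

      S² : ∀ i j → S i j * S i j ≈ 1# - δ i j
      S² i j = trans (*-cong (seidel-entry i j) (seidel-entry i j)) square
        where
        square : (1# - δ i j - ι 2 * ⟦ adj i j ⟧) * (1# - δ i j - ι 2 * ⟦ adj i j ⟧) ≈ 1# - δ i j
        square with i Fin.≟ j | adj i j in eq
        ... | no _       | true  = solve 1 (λ x → (:ι 1 :- :ι 0 :- :ι 2 :* :ι 1) :* (:ι 1 :- :ι 0 :- :ι 2 :* :ι 1) := :ι 1 :- :ι 0) refl 0#
        ... | no _       | false = solve 1 (λ x → (:ι 1 :- :ι 0 :- :ι 2 :* :ι 0) :* (:ι 1 :- :ι 0 :- :ι 2 :* :ι 0) := :ι 1 :- :ι 0) refl 0#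
        ... | yes ≡.refl | false = solve 1 (λ x → (:ι 1 :- :ι 1 :- :ι 2 :* :ι 0) :* (:ι 1 :- :ι 1 :- :ι 2 :* :ι 0) := :ι 1 :- :ι 1) refl 0#
        ... | yes ≡.refl | true with ≡.trans (≡.sym eq) (adj-irrefl i)
        ...   | ()

      module Eigenvalues (μ : Fin n → Carrier) (spectrum : ∀ x → charpoly S x ≈ product (λ i → x - μ i)) where

        E : Carrier
        E = ∑ λ i → ∣ μ i ∣

        w : Fin (suc n) → Fin n → Carrier
        w zero    = h
        w (suc c) = v c

        -- The inverse squared norms `1 / 2α` and `1 / 2d_c`; `κ` turns the latter into 0 if `c` is
        -- not a center.
        weight : Fin (suc n) → Carrier
        weight zero    = ½ * κ αℕ
        weight (suc c) = ½ * κ (size c)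

        weight-nonNeg : ∀ j → 0# ≤ weight j
        weight-nonNeg zero    = *-nonNeg (1/suc-nonNeg 1) (κ-nonNeg αℕ)
        weight-nonNeg (suc c) = *-nonNeg (1/suc-nonNeg 1) (κ-nonNeg (size c))

        orthogonal : ∀ j k → weight j * weight k * ∑ (λ i → w j i * w k i) ≈ weight j * δ j k
        orthogonal zero zero = trans (*-congˡ ∑h²) (trans
          (solve 3 (λ h k x → (h :* k) :* (h :* k) :* (:ι 2 :* x) := h :* k :* (:ι 2 :* h) :* (k :* x)) refl ½ (κ αℕ) α)
          (trans (*-cong (trans (*-congˡ ½+½) (*-identityʳ _)) (trans (*-congˡ α≈) (κ-inverse (proj₂ αℕ-suc)))) refl))
        orthogonal zero (suc c) = trans (*-congˡ (hv c)) (trans (zeroʳ _) (sym (zeroʳ _)))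
        orthogonal (suc b) zero = trans (*-congˡ (trans (∑-cong λ i → *-comm _ _) (hv b))) (trans (zeroʳ _) (sym (zeroʳ _)))
        orthogonal (suc b) (suc c) = begin-equality
          ½ * κ (size b) * (½ * κ (size c)) * ∑ (λ i → v b i * v c i)
            ≈⟨ *-congˡ (vv b c) ⟩
          ½ * κ (size b) * (½ * κ (size c)) * (δ b c * (ι 2 * d c))
            ≈⟨ solve 5 (λ h k l s x → h :* k :* (h :* l) :* (s :* (:ι 2 :* x)) := h :* (:ι 2 :* h) :* (s :* (k :* (l :* x)))) refl ½ (κ (size b)) (κ (size c)) (δ b c) (d c) ⟩
          ½ * (ι 2 * ½) * (δ b c * (κ (size b) * (κ (size c) * d c)))
            ≈⟨ *-cong (trans (*-congˡ ½+½) (*-identityʳ _)) (trans (δ-replace b c (λ c → κ (size b) * (κ (size c) * d c)))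
                 (trans (*-congˡ (trans (*-congˡ (κd b)) (κχ b))) (*-comm _ _))) ⟩
          ½ * (κ (size b) * δ b c)
            ≈⟨ trans (sym (*-assoc _ _ _)) (*-congˡ (reflexive (≡.sym (δ-suc b c)))) ⟩
          ½ * κ (size b) * δ (suc b) (suc c) ∎

        -- Ky Fan's inequality multiplied by `α`, as `tr S = 0`. Each star contributes
        -- `d_c - 1 + 2 √d_c` through `v c`, and `h` contributes its form divided by `α`.
        energy-bound : α * (α - ν + ι 2 * s) + ((α + s) * (α + s) - ι 2 * α - ι 4 * (∑da + Se)) ≤ α * E
        energy-bound = ≤-respˡ eq (≤-respʳ (*-congˡ (trans (+-congˡ (∑-0 S-diagonal)) (+-identityʳ E))) (*-monoˡ-≤ (≤-respʳ (sym α≈) (ι-nonNeg αℕ))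
          (ky-fan S S-symmetric S≤1 -1≤S μ spectrum w weight weight-nonNeg orthogonal)))
          where
          half : ∀ k x → ι 2 * (½ * k * x) ≈ k * x
          half k x = trans (solve 3 (λ h k x → :ι 2 :* (h :* k :* x) := (:ι 2 :* h) :* (k :* x)) refl ½ k x)
            (trans (*-congʳ ½+½) (*-identityˡ _))
          energy-term : ι 2 * ∑ (λ j → weight j * form S (w j)) ≈ κ αℕ * form S h + (α - ν + ι 2 * s)
          energy-term = begin-equality
            ι 2 * ∑ (λ j → weight j * form S (w j))
              ≈⟨ *-congˡ (∑-suc _) ⟩
            ι 2 * (½ * κ αℕ * form S h + ∑ (λ c → ½ * κ (size c) * form S (v c)))
              ≈⟨ trans (distribˡ _ _ _) (+-cong (half _ _) (trans (*-∑ _ _) (∑-cong λ c → trans (half _ _) (κ-form-v c)))) ⟩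
            κ αℕ * form S h + ∑ (λ c → d c - χ c + ι 2 * a c)
              ≈⟨ +-congˡ (trans (∑-+ _ _) (+-cong (trans (∑-sub d χ) (+-congʳ ∑d)) (sym (*-∑ (ι 2) a)))) ⟩
            κ αℕ * form S h + (α - ν + ι 2 * s) ∎
          eq : α * (ι 2 * ∑ (λ j → weight j * form S (w j))) ≈ _
          eq = begin-equality
            α * (ι 2 * ∑ (λ j → weight j * form S (w j)))
              ≈⟨ *-congˡ energy-term ⟩
            α * (κ αℕ * form S h + (α - ν + ι 2 * s))
              ≈⟨ solve 4 (λ x k f y → x :* (k :* f :+ y) := x :* y :+ (k :* x) :* f) refl α (κ αℕ) (form S h) (α - ν + ι 2 * s) ⟩
            α * (α - ν + ι 2 * s) + κ αℕ * α * form S h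
              ≈⟨ +-congˡ (trans (*-congʳ (trans (*-congˡ α≈) (κ-inverse (proj₂ αℕ-suc)))) (trans (*-identityˡ _) form-h)) ⟩
            _ ∎

-- Leaves, the largest star and the edges between stars.

module EdgeBounds (𝓡 : RealRing) where
  open Order 𝓡 hiding (∣_∣)
  open Counting
  open Rooting using (argmax)
  open Labelling
  open StarVectors 𝓡
  open import Data.Bool.Base using (Bool; true; false; not; _∧_; _xor_; if_then_else_)
  open import Data.Bool.Properties using (T-≡)
  open import Data.Empty using (⊥-elim)
  open import Data.Fin.Base as Fin using (Fin; zero; suc)
  import Data.Fin.Properties as Fin
  open import Data.Fin.Subset using (∣_∣; _∩_)
  open import Data.Fin.Subset.Properties using (∣p∣≤n)
  import Data.Nat.Properties as ℕ
  import Data.Vec.Base as Vec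
  open import Data.Vec.Functional using (foldr)
  open import Function.Base using (_∘_)
  open import Function.Bundles using (Equivalence)
  open import Relation.Binary.PropositionalEquality as ≡ using (_≡_; _≢_)
  open import Relation.Nullary using (¬_; Dec; yes; no; does)
  open import Relation.Nullary.Decidable using (_×-dec_; ¬?)

  ≤-foldr-⊔ : ∀ {n} (f : Fin n → ℕ) i → f i ℕ.≤ foldr ℕ._⊔_ 0 f
  ≤-foldr-⊔ f zero    = ℕ.m≤m⊔n (f zero) _
  ≤-foldr-⊔ f (suc i) = ℕ.≤-trans (≤-foldr-⊔ (f ∘ suc) i) (ℕ.m≤n⊔m (f zero) _)

  foldr-⊔-≤ : ∀ {n} (f : Fin n → ℕ) {b} → (∀ i → f i ℕ.≤ b) → foldr ℕ._⊔_ 0 f ℕ.≤ b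
  foldr-⊔-≤ {zero}  f f≤b = ℕ.z≤n
  foldr-⊔-≤ {suc n} f f≤b = ℕ.⊔-lub (f≤b zero) (foldr-⊔-≤ (f ∘ suc) (f≤b ∘ suc))

  card-∩ : ∀ {n} (f g : Fin n → Bool) → ∣ Vec.tabulate f ∩ Vec.tabulate g ∣ ≡ card (λ i → f i ∧ g i)
  card-∩ {zero}  f g = ≡.refl
  card-∩ {suc n} f g with f zero ∧ g zero
  ... | true  = ≡.cong suc (card-∩ (f ∘ suc) (g ∘ suc))
  ... | false = card-∩ (f ∘ suc) (g ∘ suc)

  ι-∸ : ∀ {m n} → n ℕ.≤ m → ι (m ℕ.∸ n) ≈ ι m - ι n
  ι-∸ {m} {n} n≤m = trans (solve 2 (λ x y → x := x :+ y :- y) refl (ι (m ℕ.∸ n)) (ι n))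
    (+-congʳ (trans (sym (ι-+ (m ℕ.∸ n) n)) (reflexive (≡.cong ι (ℕ.m∸n+n≡m n≤m)))))

  module LeafCount {n} (G : Graph n) where
    open Graph G

    isLeaf : Fin n → Bool
    isLeaf v = does (degree v ℕ.≟ 1)

    isLeaf-yes : ∀ {v} → degree v ≡ 1 → isLeaf v ≡ true
    isLeaf-yes e = ≡.cong (λ k → does (k ℕ.≟ 1)) e

    leaves-at≤D : ∀ w → ∑ (λ u → ⟦ adj w u ∧ isLeaf u ⟧) ≤ ι D
    leaves-at≤D w = ≤-respˡ (sym (trans (∑-⟦⟧ _) (reflexive (≡.cong ι (≡.sym (card-∩ (adj w) isLeaf))))))
      (ι-mono {∣ neighbours w ∩ leaves ∣} {D} (≤-foldr-⊔ (λ w → ∣ neighbours w ∩ leaves ∣) w))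

    -- This makes the truncated `n ∸ D` a genuine difference in the reals.
    D≤n : D ℕ.≤ n
    D≤n = foldr-⊔-≤ (λ w → ∣ neighbours w ∩ leaves ∣) (λ w → ∣p∣≤n (neighbours w ∩ leaves))

    1≤D : ∀ {w ℓ} → Adj w ℓ → degree ℓ ≡ 1 → 1# ≤ ι D
    1≤D {w} {ℓ} w~ℓ deg = ≤-trans (≤-respˡ (reflexive (≡.cong₂ (λ x y → ⟦ x ∧ y ⟧) (Equivalence.to T-≡ w~ℓ) (isLeaf-yes deg)))
      (term≤∑ (λ u → ⟦⟧-nonNeg (adj w u ∧ isLeaf u)) ℓ)) (leaves-at≤D w)

  module LargestStar {n} (G : Graph n) {r} (P : StarPartition G r) where
    open Graph G
    open LeafCount G
    open StarPartition P using (rooted; center; center-root; other-child; other≢r; depth; depth-parent; adj-parent)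
      renaming (parent to p)
    open Partition G P

    largest : ∃[ c ] (∀ u → size u ℕ.≤ size c)
    largest = argmax r size

    c★ : Fin n
    c★ = proj₁ largest

    M : Carrier
    M = a c★

    M² : M * M ≈ d c★
    M² = a² c★

    c★-center : center c★ ≡ true
    c★-center = by-cases (center c★) ≡.refl
      where
      by-cases : ∀ b → center c★ ≡ b → b ≡ true
      by-cases true  _ = ≡.refl
      by-cases false e with ≡.subst (ℕ._≤ size c★) (proj₂ (size-center center-root)) (proj₂ largest r)
      ... | 1≤ with ≡.subst (1 ℕ.≤_) (size-other e) (ℕ.≤-trans (ℕ.s≤s ℕ.z≤n) 1≤)
      ...   | ()

    a≤M : ∀ c → a c ≤ M
    a≤M c = square-cancel-≤ (0≤a c★) (≤-respˡ (sym (√-square (size c))) (≤-respʳ (sym (√-square (size c★))) (ι-mono {size c} (proj₂ largest c))))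

    0≤M : 0# ≤ M
    0≤M = 0≤a c★

    1≤a : ∀ {c} → center c ≡ true → 1# ≤ a c
    1≤a {c} cc with size-center cc
    ... | k , e = square-cancel-≤ (0≤a c) (≤-respˡ (sym (*-identityˡ 1#)) (≤-respʳ (sym (trans (√-square (size c)) (reflexive (≡.cong ι e))))
      (ι-mono {1} {suc k} (ℕ.s≤s ℕ.z≤n))))

    1≤M : 1# ≤ M
    1≤M = 1≤a c★-center

    -- This counts the stars other than the largest (`∑χ′`) and also the non-root centers (`∑πχ`),
    -- that is, the edges between stars. The two roles are played by different sets of centers.
    m : Carrier
    m = ν - 1#

    χ′ : Fin n → Carrier
    χ′ c = χ c - δ c★ c

    χ-c★ : χ c★ ≈ 1#
    χ-c★ = reflexive (≡.cong ⟦_⟧ c★-center)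

    ∑-χ′ : ∀ f → ∑ (λ c → χ′ c * f c) ≈ ∑ (λ c → χ c * f c) - f c★
    ∑-χ′ f = trans (∑-cong λ c → solve 3 (λ x e f → (x :- e) :* f := x :* f :- e :* f) refl (χ c) (δ c★ c) (f c))
      (trans (∑-sub _ _) (+-congˡ (-‿cong (∑-δˡ c★ f))))

    ∑χ′ : ∑ χ′ ≈ m
    ∑χ′ = trans (∑-sub χ _) (+-congˡ (-‿cong (trans (∑-cong λ c → sym (*-identityʳ _)) (∑-δˡ c★ (λ _ → 1#)))))

    data Kind (c : Fin n) : Set where
      largest-star : c ≡ c★ → χ′ c ≈ 0# → Kind c
      other-star   : c ≢ c★ → center c ≡ true → χ′ c ≈ 1# → Kind c
      no-star      : center c ≡ false → χ′ c ≈ 0# → Kind c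

    kind : ∀ c → Kind c
    kind c = by-cases (c Fin.≟ c★) (center c) ≡.refl
      where
      by-cases : Dec (c ≡ c★) → ∀ b → center c ≡ b → Kind c
      by-cases (yes ≡.refl) _ _  = largest-star ≡.refl (trans (+-cong χ-c★ (-‿cong (reflexive (δ-diag c★)))) (-‿inverseʳ 1#))
      by-cases (no c≢) true  cc = other-star c≢ cc (trans (+-cong (reflexive (≡.cong ⟦_⟧ cc)) (-‿cong (reflexive (δ-off (c≢ ∘ ≡.sym)))))
        (solve 1 (λ x → :ι 1 :- :ι 0 := :ι 1) refl 0#))
      by-cases (no c≢) false cc = no-star cc (trans (+-cong (reflexive (≡.cong ⟦_⟧ cc)) (-‿cong (reflexive (δ-off (c≢ ∘ ≡.sym)))))
        (-‿inverseʳ 0#))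

    χ′-nonNeg : ∀ c → 0# ≤ χ′ c
    χ′-nonNeg c with kind c
    ... | largest-star _ e = ≤-reflexive (sym e)
    ... | other-star _ _ e = ≤-respʳ (sym e) 0≤1
    ... | no-star _ e      = ≤-reflexive (sym e)

    0≤m : 0# ≤ m
    0≤m = ≤-respʳ ∑χ′ (∑-nonNeg χ′-nonNeg)

    ∑πχ : ∑ (λ c → π c * χ c) ≈ m
    ∑πχ = trans (∑-cong λ c → solve 2 (λ e x → (:ι 1 :- e) :* x := x :- e :* x) refl (δ r c) (χ c))
      (trans (∑-sub _ _) (+-congˡ (-‿cong (trans (∑-δˡ r χ) (reflexive (≡.cong ⟦_⟧ center-root))))))

    π-cases : ∀ (Z : Fin n → Set) → Z r → (∀ i → i ≢ r → Z i) → ∀ i → Z i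
    π-cases Z Zr Zi i with i Fin.≟ r
    ... | yes ≡.refl = Zr
    ... | no i≢r     = Zi i i≢r

    0≤π : ∀ i → 0# ≤ π i
    0≤π = π-cases (λ i → 0# ≤ π i) (≤-reflexive (sym π-root)) (λ i i≢r → ≤-respʳ (sym (π-nonroot i≢r)) 0≤1)

    data Member (c i : Fin n) : Set where
      inside  : center i ≡ false → p i ≡ c → X c i ≈ 1# → Member c i
      outside : X c i ≈ 0# → Member c i

    member : ∀ c i → Member c i
    member c i = by-cases (center i) ≡.refl (p i Fin.≟ c)
      where
      by-cases : ∀ b → center i ≡ b → Dec (p i ≡ c) → Member c i
      by-cases true  ci _          = outside (trans (*-congʳ (reflexive (≡.cong (⟦_⟧ ∘ not) ci))) (zeroˡ _))
      by-cases false ci (yes pi≡c) = inside ci pi≡c (trans (*-cong (reflexive (≡.cong (⟦_⟧ ∘ not) ci))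
        (trans (reflexive (≡.cong (λ q → δ q c) pi≡c)) (reflexive (δ-diag c)))) (*-identityˡ 1#))
      by-cases false ci (no pi≢c)  = outside (trans (*-congˡ (reflexive (δ-off pi≢c))) (zeroʳ _))

    0≤X : ∀ c i → 0# ≤ X c i
    0≤X c i with member c i
    ... | inside _ _ e = ≤-respʳ (sym e) 0≤1
    ... | outside e    = ≤-reflexive (sym e)

    X≤1 : ∀ c i → X c i ≤ 1#
    X≤1 c i with member c i
    ... | inside _ _ e = ≤-reflexive e
    ... | outside e    = ≤-respˡ (sym e) 0≤1

    -- The number of non-root centers whose parent is in the largest star but
    -- not its center.
    τ : Carrier
    τ = ∑ λ c → π c * χ c * X c★ (p c)

    0≤πχ : ∀ c → 0# ≤ π c * χ c
    0≤πχ c = *-nonNeg (0≤π c) (⟦⟧-nonNeg (center c))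

    0≤τ : 0# ≤ τ
    0≤τ = ∑-nonNeg λ c → *-nonNeg (0≤πχ c) (0≤X c★ (p c))

    τ≤m : τ ≤ m
    τ≤m = ≤-respʳ ∑πχ (∑-mono λ c → ≤-respʳ (*-identityʳ _) (*-monoˡ-≤ (0≤πχ c) (X≤1 c★ (p c))))

    -- A vertex of the largest star other than its center is a leaf or has a child, a center.
    d★≤D+τ : d c★ ≤ ι D + τ
    d★≤D+τ = begin
      d c★
        ≲⟨ ∑-mono pointwise ⟩
      ∑ (λ u → ⟦ adj c★ u ∧ isLeaf u ⟧ + X c★ u * K u)
        ≈⟨ ∑-+ _ _ ⟩
      ∑ (λ u → ⟦ adj c★ u ∧ isLeaf u ⟧) + ∑ (λ u → X c★ u * K u)
        ≲⟨ +-mono-≤ (leaves-at≤D c★) (≤-reflexive K-sum) ⟩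
      ι D + τ ∎
      where
      K : Fin n → Carrier
      K u = ∑ λ c → π c * χ c * δ (p c) u
      K-sum : ∑ (λ u → X c★ u * K u) ≈ τ
      K-sum = begin-equality
        ∑ (λ u → X c★ u * K u)
          ≈⟨ (∑-cong λ u → *-∑ _ _) ⟩
        ∑ (λ u → ∑ λ c → X c★ u * (π c * χ c * δ (p c) u))
          ≈⟨ ∑-comm _ ⟩
        ∑ (λ c → ∑ λ u → X c★ u * (π c * χ c * δ (p c) u))
          ≈⟨ (∑-cong λ c → trans (∑-cong λ u → solve 3 (λ x q e → x :* (q :* e) := e :* (q :* x)) refl (X c★ u) (π c * χ c) (δ (p c) u))
               (∑-δˡ (p c) λ u → π c * χ c * X c★ u)) ⟩
        τ ∎
      0≤δ : ∀ (i j : Fin n) → 0# ≤ δ i j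
      0≤δ i j with i Fin.≟ j
      ... | yes _ = 0≤1
      ... | no  _ = ≤-refl
      0≤K : ∀ u → ∀ c → 0# ≤ π c * χ c * δ (p c) u
      0≤K u c = *-nonNeg (0≤πχ c) (0≤δ (p c) u)
      Bound : Fin n → Set
      Bound u = X c★ u ≤ ⟦ adj c★ u ∧ isLeaf u ⟧ + X c★ u * K u
      leaf-or-child : ∀ u → center u ≡ false → p u ≡ c★ → X c★ u ≈ 1# →
        Dec (∃[ c ] (c ≢ r × p c ≡ u)) → Bound u
      leaf-or-child u cu pu≡c★ Xu (yes (c , c≢r , pc≡u)) = ≤-respˡ (+-identityˡ _) (+-mono-≤ (⟦⟧-nonNeg (adj c★ u ∧ isLeaf u))
        (≤-respˡ (*-identityʳ _) (*-monoˡ-≤ (0≤X c★ u) (≤-trans (≤-reflexive (sym one)) (term≤∑ (0≤K u) c)))))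
        where
        one : π c * χ c * δ (p c) u ≈ 1#
        one = trans (*-cong (trans (*-cong (π-nonroot c≢r) (reflexive (≡.cong ⟦_⟧ (other-child u cu c c≢r pc≡u)))) (*-identityˡ 1#))
          (trans (reflexive (≡.cong (λ q → δ q u) pc≡u)) (reflexive (δ-diag u)))) (*-identityˡ 1#)
      leaf-or-child u cu pu≡c★ Xu (no none) = ≤-respˡ (+-identityʳ _) (+-mono-≤
        (≤-reflexive (trans Xu (reflexive (≡.sym (≡.cong₂ (λ x y → ⟦ x ∧ y ⟧) adjacent leaf)))))
        (*-nonNeg (0≤X c★ u) (∑-nonNeg (0≤K u))))
        where
        u≢r = other≢r cu
        up : Adj u c★
        up = ≡.subst (Adj u) pu≡c★ (adj-parent u u≢r)
        adjacent : adj c★ u ≡ true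
        adjacent = ≡.trans (adj-sym c★ u) (Equivalence.to T-≡ up)
        leaf : isLeaf u ≡ true
        leaf = isLeaf-yes (degree-one G u (p u) (adj-parent u u≢r)
          (childless-neighbour G rooted u u≢r λ c c≢r pc≡u → none (c , c≢r , pc≡u)))
      pointwise : ∀ u → Bound u
      pointwise u with member c★ u
      ... | outside e = ≤-respˡ (sym e) (+-nonNeg (⟦⟧-nonNeg (adj c★ u ∧ isLeaf u)) (*-nonNeg (0≤X c★ u) (∑-nonNeg (0≤K u))))
      ... | inside cu pu≡c★ e = leaf-or-child u cu pu≡c★ e (Fin.any? λ c → ¬? (c Fin.≟ r) ×-dec (p c Fin.≟ u))

    parent-center : ∀ {u} → center u ≡ false → center (p u) ≡ true
    parent-center {u} cu = by-cases (center (p u)) ≡.refl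
      where
      by-cases : ∀ b → center (p u) ≡ b → b ≡ true
      by-cases true  _ = ≡.refl
      by-cases false e with ≡.trans (≡.sym cu) (other-child (p u) e u (other≢r cu) ≡.refl)
      ... | ()

    h-center : ∀ {u} → center u ≡ true → h u ≈ a u
    h-center cu = trans (+-congʳ (reflexive (≡.cong (⟦_⟧ ∘ not) cu))) (+-identityˡ _)

    h-other : ∀ {u} → center u ≡ false → h u ≈ 1#
    h-other cu = trans (+-cong (reflexive (≡.cong (⟦_⟧ ∘ not) cu)) (a-other cu)) (+-identityʳ 1#)

    owner : Fin n → Fin n
    owner u = if center u then u else p u

    -- Colour the stars alternately; every edge counted by Se joins two colours.
    colour′ : ℕ → Fin n → Bool
    colour′ zero    u = false
    colour′ (suc k) u = center u xor colour′ k (p u)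

    colour : Fin n → Bool
    colour u = colour′ (depth u) u

    colour-parent : ∀ {u} → u ≢ r → colour u ≡ center u xor colour (p u)
    colour-parent {u} u≢r = ≡.cong (λ k → colour′ k u) (depth-parent u u≢r)

    data Owner (u : Fin n) : Set where
      owned : h u ≤ a (owner u) → colour (owner u) ≡ colour u → depth (owner u) ℕ.≤ depth u → Owner u

    ownership : ∀ u → Owner u
    ownership u = by-cases (center u) ≡.refl
      where
      by-cases : ∀ b → center u ≡ b → Owner u
      by-cases true  cu = owned (≡.subst (λ o → h u ≤ a o) (≡.sym o≡) (≤-reflexive (h-center cu)))
          (≡.cong colour o≡) (ℕ.≤-reflexive (≡.cong depth o≡))
        where
        o≡ : owner u ≡ u
        o≡ = ≡.cong (if_then u else p u) cu
      by-cases false cu = owned (≡.subst (λ o → h u ≤ a o) (≡.sym o≡) (≤-respˡ (sym (h-other cu)) (1≤a (parent-center cu))))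
          (≡.trans (≡.cong colour o≡) (≡.sym (≡.trans (colour-parent (other≢r cu)) (≡.cong (_xor colour (p u)) cu))))
          (ℕ.≤-trans (ℕ.≤-reflexive (≡.cong depth o≡)) (ℕ.≤-trans (ℕ.n≤1+n _) (ℕ.≤-reflexive (≡.sym (depth-parent u (other≢r cu))))))
        where
        o≡ : owner u ≡ p u
        o≡ = ≡.cong (if_then u else p u) cu

    -- The center of the star to which the star of a non-root center `i` is attached.
    g : Fin n → Fin n
    g i = owner (p i)

    σ : Fin n → Carrier
    σ i = if colour i then - 1# else 1#

    -- An edge from the center `i` to its parent weighs at most `a i * a (g i)`, and such edges join
    -- stars of different colours, each pair at most once. If the colour classes have total weights
    -- `x` and `y`, the edges sum to at most `x y`, and `4 x y = s² - t²` with `s = x + y` and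
    -- `t = x - y`.
    4Se≤s² : ι 4 * Se ≤ s * s
    4Se≤s² = begin
      ι 4 * Se
        ≲⟨ *-monoˡ-≤ (ι-nonNeg 4) (∑-mono λ i → *-monoˡ-≤ (0≤π i) (*-monoˡ-≤ (0≤a i) (h≤ (p i)))) ⟩
      ι 4 * ∑ (λ i → π i * (a i * a (g i)))
        ≈⟨ *-congˡ (∑-cong λ i → trans (sym (∑-δˡ (g i) λ j → π i * (a i * a j)))
             (∑-cong λ j → solve 4 (λ e q x y → e :* (q :* (x :* y)) := q :* e :* (x :* y)) refl (δ (g i) j) (π i) (a i) (a j))) ⟩
      ι 4 * ∑ (λ i → ∑ λ j → F i j)
        ≈⟨ solve 1 (λ x → :ι 4 :* x := :ι 2 :* (x :+ x)) refl _ ⟩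
      ι 2 * (∑ (λ i → ∑ λ j → F i j) + ∑ (λ i → ∑ λ j → F i j))
        ≈⟨ *-congˡ (+-congˡ (∑-comm _)) ⟩
      ι 2 * (∑ (λ i → ∑ λ j → F i j) + ∑ (λ i → ∑ λ j → F j i))
        ≈⟨ *-congˡ (trans (sym (∑-+ _ _)) (∑-cong λ i → sym (∑-+ _ _))) ⟩
      ι 2 * ∑ (λ i → ∑ λ j → F i j + F j i)
        ≈⟨ trans (*-∑ _ _) (∑-cong λ i → *-∑ _ _) ⟩
      ∑ (λ i → ∑ λ j → ι 2 * (F i j + F j i))
        ≲⟨ (∑-mono λ i → ∑-mono λ j → pair i j (center i) ≡.refl (center j) ≡.refl (edge? i j) (edge? j i)) ⟩
      ∑ (λ i → ∑ λ j → (1# - σ i * σ j) * (a i * a j))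
        ≈⟨ (∑-cong λ i → trans (∑-cong λ j → solve 4 (λ x y b c → (:ι 1 :- x :* y) :* (b :* c) := b :* c :- x :* b :* (y :* c)) refl (σ i) (σ j) (a i) (a j))
             (trans (∑-sub _ _) (+-cong (sym (*-∑ (a i) a)) (-‿cong (sym (*-∑ _ _)))))) ⟩
      ∑ (λ i → a i * s - σ i * a i * t)
        ≈⟨ trans (∑-sub _ _) (+-cong (sym (∑-* s a)) (-‿cong (sym (∑-* t _)))) ⟩
      s * s - t * t
        ≲⟨ ≤-by (t * t) (square-nonNeg t) (solve 2 (λ s t → s :* s := s :* s :- t :* t :+ t :* t) refl s t) ⟩
      s * s ∎
      where
      t : Carrier
      t = ∑ λ i → σ i * a i
      F : Fin n → Fin n → Carrier
      F i j = π i * δ (g i) j * (a i * a j)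
      h≤ : ∀ u → h u ≤ a (owner u)
      h≤ u with ownership u
      ... | owned e _ _ = e
      Edge : Fin n → Fin n → Set
      Edge i j = i ≢ r × g i ≡ j
      edge? : ∀ i j → Dec (Edge i j)
      edge? i j = ¬? (i Fin.≟ r) ×-dec (g i Fin.≟ j)
      depth-g : ∀ {i j} → Edge i j → depth j ℕ.< depth i
      depth-g {i} (i≢r , ≡.refl) with ownership (p i)
      ... | owned _ _ le = ℕ.≤-trans (ℕ.s≤s le) (ℕ.≤-reflexive (≡.sym (depth-parent i i≢r)))
      colour-g : ∀ {i j} → center i ≡ true → Edge i j → colour i ≡ not (colour j)
      colour-g {i} ci (i≢r , ≡.refl) with ownership (p i)
      ... | owned _ c≡ _ = ≡.trans (colour-parent i≢r) (≡.trans (≡.cong (_xor colour (p i)) ci) (≡.cong not (≡.sym c≡)))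
      πδ-yes : ∀ {i j} → Edge i j → π i * δ (g i) j ≈ 1#
      πδ-yes {i} (i≢r , ≡.refl) = trans (*-cong (π-nonroot i≢r) (reflexive (δ-diag (g i)))) (*-identityˡ 1#)
      πδ-no : ∀ {i j} → ¬ Edge i j → π i * δ (g i) j ≈ 0#
      πδ-no {i} {j} = π-cases (λ i → ¬ Edge i j → π i * δ (g i) j ≈ 0#) (λ _ → trans (*-congʳ π-root) (zeroˡ _))
        (λ i i≢r ¬e → trans (*-congˡ (reflexive (δ-off λ gi≡j → ¬e (i≢r , gi≡j)))) (zeroʳ _)) i
      opposite : ∀ x → (if not x then - 1# else 1#) * (if x then - 1# else 1#) ≈ - 1#
      opposite true  = *-identityˡ _
      opposite false = *-identityʳ _
      σσ≤1 : ∀ i j → 0# ≤ 1# - σ i * σ j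
      σσ≤1 i j with colour i | colour j
      ... | true  | true  = ≤-reflexive (solve 1 (λ x → :ι 0 := :ι 1 :- (:- :ι 1) :* (:- :ι 1)) refl 0#)
      ... | false | false = ≤-reflexive (solve 1 (λ x → :ι 0 := :ι 1 :- :ι 1 :* :ι 1) refl 0#)
      ... | true  | false = ≤-respʳ (solve 1 (λ x → :ι 2 := :ι 1 :- (:- :ι 1) :* :ι 1) refl 0#) (ι-nonNeg 2)
      ... | false | true  = ≤-respʳ (solve 1 (λ x → :ι 2 := :ι 1 :- :ι 1 :* (:- :ι 1)) refl 0#) (ι-nonNeg 2)
      Pair : Fin n → Fin n → Set
      Pair i j = ι 2 * (F i j + F j i) ≤ (1# - σ i * σ j) * (a i * a j)
      values : ∀ {i j x y} → π i * δ (g i) j ≈ x → π j * δ (g j) i ≈ y →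
        ι 2 * ((x + y) * (a i * a j)) ≤ (1# - σ i * σ j) * (a i * a j) → Pair i j
      values {i} {j} {x} {y} ex ey = ≤-respˡ (sym (*-congˡ (trans (+-cong (*-congʳ ex) (*-congʳ ey))
        (solve 4 (λ x y b c → x :* (b :* c) :+ y :* (c :* b) := (x :+ y) :* (b :* c)) refl x y (a i) (a j)))))
      vanish : ∀ {i j} → a i * a j ≈ 0# → Pair i j
      vanish {i} {j} e = ≤-reflexive (trans (*-congˡ (+-cong (trans (*-congˡ e) (zeroʳ _)) (trans (*-congˡ (trans (*-comm _ _) e)) (zeroʳ _))))
        (trans (solve 1 (λ x → :ι 2 :* (:ι 0 :+ :ι 0) := :ι 0) refl 0#) (sym (trans (*-congˡ e) (zeroʳ _)))))
      joined : ∀ {i j} → σ i * σ j ≈ - 1# → ∀ {x y} → x + y ≈ 1# → ι 2 * ((x + y) * (a i * a j)) ≤ (1# - σ i * σ j) * (a i * a j)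
      joined {i} {j} e x+y = ≤-reflexive (trans (*-congˡ (*-congʳ x+y)) (trans
        (solve 1 (λ z → :ι 2 :* (:ι 1 :* z) := (:ι 1 :- :- :ι 1) :* z) refl (a i * a j)) (*-congʳ (+-congˡ (-‿cong (sym e))))))
      pair : ∀ i j b → center i ≡ b → ∀ b′ → center j ≡ b′ → Dec (Edge i j) → Dec (Edge j i) → Pair i j
      pair i j false ci _     _  _ _ = vanish (trans (*-congʳ (a-other ci)) (zeroˡ _))
      pair i j true  _  false cj _ _ = vanish (trans (*-congˡ (a-other cj)) (zeroʳ _))
      pair i j true  ci true  cj (yes e) (yes f) = ⊥-elim (ℕ.<-asym (depth-g e) (depth-g f))
      pair i j true  ci true  cj (yes e) (no ¬f) = values (πδ-yes e) (πδ-no ¬f)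
        (joined (trans (*-congʳ (reflexive (≡.cong (if_then - 1# else 1#) (colour-g ci e)))) (opposite (colour j))) (+-identityʳ 1#))
      pair i j true  ci true  cj (no ¬e) (yes f) = values (πδ-no ¬e) (πδ-yes f)
        (joined (trans (*-comm _ _) (trans (*-congʳ (reflexive (≡.cong (if_then - 1# else 1#) (colour-g cj f)))) (opposite (colour i)))) (+-identityˡ 1#))
      pair i j true  ci true  cj (no ¬e) (no ¬f) = values (πδ-no ¬e) (πδ-no ¬f)
        (≤-respˡ (solve 1 (λ z → :ι 0 := :ι 2 :* ((:ι 0 :+ :ι 0) :* z)) refl (a i * a j)) (*-nonNeg (σσ≤1 i j) (*-nonNeg (0≤a i) (0≤a j))))

    -- If all other stars are single edges, the edges at the parents counted by τ
    -- contribute only 1 to Se.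
    module SingleEdges (single : ∀ c → c ≢ c★ → center c ≡ true → a c ≈ 1#) where

      Se≤ : Se ≤ m * M - τ * (M - 1#)
      Se≤ = ≤-respʳ eq (∑-mono pointwise)
        where
        eq : ∑ (λ i → π i * χ i * (M - X c★ (p i) * (M - 1#))) ≈ m * M - τ * (M - 1#)
        eq = trans (∑-cong λ i → solve 4 (λ q M x N → q :* (M :- x :* N) := q :* M :- q :* x :* N) refl (π i * χ i) M (X c★ (p i)) (M - 1#))
          (trans (∑-sub _ _) (+-cong (trans (sym (∑-* M _)) (*-congʳ ∑πχ)) (-‿cong (sym (∑-* _ _)))))
        Bound : Fin n → Set
        Bound i = π i * (a i * h (p i)) ≤ π i * χ i * (M - X c★ (p i) * (M - 1#))
        core : ∀ i → i ≢ r → center i ≡ true → a i * h (p i) ≤ M - X c★ (p i) * (M - 1#)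
        core i i≢r ci with member c★ (p i)
        ... | inside cp pp≡c★ e = ≤-reflexive (trans (*-cong (single i i≢c★ ci) (h-other cp))
            (trans (solve 1 (λ M → :ι 1 :* :ι 1 := M :- :ι 1 :* (M :- :ι 1)) refl M) (+-congˡ (-‿cong (*-congʳ (sym e))))))
          where
          i≢c★ : i ≢ c★
          i≢c★ ≡.refl = no-two-cycle i≢r (other≢r cp) ≡.refl pp≡c★
        ... | outside e = ≤-respʳ (trans (solve 2 (λ M N → M := M :- :ι 0 :* N) refl M (M - 1#)) (+-congˡ (-‿cong (*-congʳ (sym e)))))
            (outer (center (p i)) ≡.refl (i Fin.≟ c★))
          where
          -- If the parent is not a center, `h` is 1 there. If it is, at most one of the two centers
          -- is `c★`, and the other has `a` equal to 1. In both cases one factor is 1 and the other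
          -- at most `M`.
          outer : ∀ b → center (p i) ≡ b → Dec (i ≡ c★) → a i * h (p i) ≤ M
          outer false cp _ = ≤-respˡ (sym (trans (*-congˡ (h-other cp)) (*-identityʳ _))) (a≤M i)
          outer true cp (no i≢c★) = ≤-respˡ (sym (trans (*-cong (single i i≢c★ ci) (h-center cp)) (*-identityˡ _))) (a≤M (p i))
          outer true cp (yes i≡c★) = ≤-respˡ (sym (trans (*-congˡ (trans (h-center cp) (single (p i) pi≢c★ cp))) (*-identityʳ _))) (a≤M i)
            where
            pi≢c★ : p i ≢ c★
            pi≢c★ pi≡c★ = deeper i≢r (≡.trans pi≡c★ (≡.sym i≡c★))
        pointwise : ∀ i → Bound i
        pointwise = π-cases Bound
          (≤-reflexive (trans (trans (*-congʳ π-root) (zeroˡ _)) (sym (trans (*-congʳ (trans (*-congʳ π-root) (zeroˡ _))) (zeroˡ _)))))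
          (λ i i≢r → by-cases i i≢r (center i) ≡.refl)
          where
          by-cases : ∀ i → i ≢ r → ∀ b → center i ≡ b → Bound i
          by-cases i i≢r false ci = ≤-reflexive (trans (trans (*-congˡ (trans (*-congʳ (a-other ci)) (zeroˡ _))) (zeroʳ _))
            (sym (trans (*-congʳ (trans (*-congˡ (reflexive (≡.cong ⟦_⟧ ci))) (zeroʳ _))) (zeroˡ _))))
          by-cases i i≢r true ci = ≤-respʳ (sym (*-congʳ (trans (*-congˡ (reflexive (≡.cong ⟦_⟧ ci))) (*-identityʳ _))))
            (*-monoˡ-≤ (0≤π i) (core i i≢r ci))

-- Numerical estimates of the excess over `2n - 6`.

module Estimate (𝓡 : RealRing) where
  open Order 𝓡
  open Labelling
  open StarVectors 𝓡
  open EdgeBounds 𝓡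
  open PowerTraces 𝓡 using (charpoly)
  open Spectral 𝓡 using (energy²)
  open Det commutativeRing using (Matrix)
  open import Algebra.Definitions.RawMonoid *-rawMonoid using () renaming (sum to product)
  open import Data.Bool.Base using (Bool; true)
  open import Data.Bool.Properties using (_≟_)
  open import Data.Empty using (⊥-elim)
  open import Data.Fin.Base as Fin using (Fin; zero; suc)
  import Data.Fin.Properties as Fin
  import Data.Nat.Properties as ℕ
  open import Relation.Binary.PropositionalEquality as ≡ using (_≡_; _≢_)
  open import Relation.Nullary using (Dec; yes; no)
  open import Relation.Nullary.Decidable using (_×-dec_; ¬?)

  -- A rational stand-in for `√2`, from `49 ≤ 50`.
  7/5≤√ : ∀ {x} → 0# ≤ x → ι 2 ≤ x * x → ι 7 ≤ ι 5 * x
  7/5≤√ {x} 0≤x 2≤x² = square-cancel-≤ (*-nonNeg (ι-nonNeg 5) 0≤x) (begin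
    ι 7 * ι 7            ≈⟨ sym (ι-* 7 7) ⟩
    ι 49                 ≲⟨ ι-mono {49} {50} (ℕ.n≤1+n 49) ⟩
    ι 50                 ≈⟨ ι-* 25 2 ⟩
    ι 25 * ι 2           ≲⟨ *-monoˡ-≤ (ι-nonNeg 25) 2≤x² ⟩
    ι 25 * (x * x)       ≈⟨ solve 1 (λ x → :ι 25 :* (x :* x) := (:ι 5 :* x) :* (:ι 5 :* x)) refl x ⟩
    (ι 5 * x) * (ι 5 * x) ∎)

  module Bound {n} (G : Graph n) {r} (P : StarPartition G r) {ℓ}
    (r~ℓ : Graph.Adj G r ℓ) (ℓ-leaf : Graph.degree G ℓ ≡ 1)
    (S : Matrix n) (seidel-entry : ∀ i j → S i j ≈ 1# - δ i j - ι 2 * ⟦ Graph.adj G i j ⟧)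
    (μ : Fin n → Carrier) (spectrum : ∀ x → charpoly S x ≈ product (λ i → x - μ i)) where

    open Graph G
    open LeafCount G
    open StarPartition P using (center)
    open Partition G P
    open LargestStar G P
    open SeidelMatrix S seidel-entry
    open Eigenvalues μ spectrum

    N q : Carrier
    N = ι n
    q = √ (2 ℕ.* (n ℕ.∸ D))

    q² : q * q ≈ ι 2 * (α + ν - ι D)
    q² = trans (√-square _) (trans (ι-* 2 (n ℕ.∸ D)) (*-congˡ (trans (ι-∸ {n} {D} D≤n) (+-congʳ (sym α+ν)))))

    Goal : Set
    Goal = ι 2 * N - ι 6 + q ≤ E

    excess : Carrier
    excess = E - (ι 2 * (α + ν) - ι 6)

    from-excess : q ≤ excess → Goal
    from-excess h = ≤-respʳ (solve 2 (λ x e → x :+ (e :- x) := e) refl (ι 2 * N - ι 6) E)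
      (+-monoʳ-≤ _ (≤-respʳ (+-congˡ (-‿cong (+-congʳ (*-congˡ α+ν)))) h))

    α-cancel : ∀ {x y} → α * x ≤ α * y → x ≤ y
    α-cancel {x} {y} h = ι-cancel-≤ (proj₁ αℕ-suc) (≤-respˡ (*-congʳ α≈′) (≤-respʳ (*-congʳ α≈′) h))
      where
      α≈′ : α ≈ ι (suc (proj₁ αℕ-suc))
      α≈′ = trans α≈ (reflexive (≡.cong ι (proj₂ αℕ-suc)))

    -- Y / (k + 1) is a lower bound of the excess and an upper bound of q.
    finish : ∀ k Y → 0# ≤ Y → α * Y ≤ ι (suc k) * (α * excess) →
      ι (suc k) * ι (suc k) * (ι 2 * (α + ν - ι D)) ≤ Y * Y → Goal
    finish k Y 0≤Y low high = from-excess (ι-cancel-≤ k (≤-trans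
      (square-cancel-≤ 0≤Y (≤-respˡ (trans (*-congˡ (sym q²))
        (solve 2 (λ k q → k :* k :* (q :* q) := (k :* q) :* (k :* q)) refl (ι (suc k)) q)) high))
      (α-cancel (≤-respʳ (solve 3 (λ k a e → k :* (a :* e) := a :* (k :* e)) refl (ι (suc k)) α excess) low))))

    ν≈1+m : ν ≈ 1# + m
    ν≈1+m = solve 1 (λ v → v := :ι 1 :+ (v :- :ι 1)) refl ν

    n-D≤ : α + ν - ι D ≤ (α - d c★) + (1# + m) + τ
    n-D≤ = ≤-by (ι D + τ - d c★) (x≤y⇒0≤y-x d★≤D+τ)
      (trans (solve 5 (λ a v t x D → a :- x :+ v :+ t := a :+ v :- D :+ (D :+ t :- x)) refl α (1# + m) τ (d c★) (ι D))
        (+-congʳ (+-congʳ (+-congˡ (sym ν≈1+m)))))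

    -- `4 √d_c - 3` is what a star other than the largest adds to the lower bound of the excess; it
    -- is at least 1.
    module Generic (b : Fin n → Carrier) (b≈ : ∀ c → b c ≈ χ′ c * (ι 4 * a c - ι 3)) where

      B : Carrier
      B = ∑ b

      χ′≤b : ∀ c → χ′ c ≤ b c
      χ′≤b c with kind c
      ... | largest-star _ e = ≤-reflexive (trans e (sym (trans (b≈ c) (trans (*-congʳ e) (zeroˡ _)))))
      ... | no-star _ e      = ≤-reflexive (trans e (sym (trans (b≈ c) (trans (*-congʳ e) (zeroˡ _)))))
      ... | other-star _ cc e = ≤-respʳ (sym (b≈ c)) (≤-by (χ′ c * (ι 4 * (a c - 1#)))
          (*-nonNeg (χ′-nonNeg c) (*-nonNeg (ι-nonNeg 4) (x≤y⇒0≤y-x (1≤a cc))))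
          (solve 2 (λ x a → x :* (:ι 4 :* a :- :ι 3) := x :+ x :* (:ι 4 :* (a :- :ι 1))) refl (χ′ c) (a c)))

      0≤b : ∀ c → 0# ≤ b c
      0≤b c = ≤-trans (χ′-nonNeg c) (χ′≤b c)

      m≤B : m ≤ B
      m≤B = ≤-respˡ ∑χ′ (∑-mono χ′≤b)

      B≈ : B ≈ ι 4 * (s - M) - ι 3 * m
      B≈ = begin-equality
        ∑ b
          ≈⟨ (∑-cong λ c → trans (b≈ c) (solve 2 (λ x a → x :* (:ι 4 :* a :- :ι 3) := :ι 4 :* (x :* a) :- :ι 3 :* x) refl (χ′ c) (a c))) ⟩
        ∑ (λ c → ι 4 * (χ′ c * a c) - ι 3 * χ′ c)
          ≈⟨ trans (∑-sub _ _) (+-cong (sym (*-∑ _ _)) (-‿cong (trans (sym (*-∑ _ _)) (*-congˡ ∑χ′)))) ⟩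
        ι 4 * ∑ (λ c → χ′ c * a c) - ι 3 * m
          ≈⟨ +-congʳ (*-congˡ (trans (∑-χ′ a) (+-congʳ (∑-cong χa)))) ⟩
        ι 4 * (s - M) - ι 3 * m ∎

      ∑b² : Carrier
      ∑b² = ∑ λ c → b c * b c

      -- 2 d ≤ b² - b + 2 for b = 4 √d - 3: the difference is 14 (√d - 1)².
      sizes : ι 2 * (α - d c★) ≤ ∑b² - B + ι 2 * m
      sizes = begin
        ι 2 * (α - d c★)
          ≈⟨ *-congˡ (trans (+-congʳ (trans (sym ∑d) (∑-cong λ c → sym (χd c)))) (sym (∑-χ′ d))) ⟩
        ι 2 * ∑ (λ c → χ′ c * d c)
          ≈⟨ *-∑ _ _ ⟩
        ∑ (λ c → ι 2 * (χ′ c * d c))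
          ≲⟨ ∑-mono term ⟩
        ∑ (λ c → b c * b c - b c + ι 2 * χ′ c)
          ≈⟨ trans (∑-+ _ _) (+-cong (∑-sub _ _) (trans (sym (*-∑ _ _)) (*-congˡ ∑χ′))) ⟩
        ∑b² - B + ι 2 * m ∎
        where
        vanish : ∀ c → χ′ c ≈ 0# → ι 2 * (χ′ c * d c) ≤ b c * b c - b c + ι 2 * χ′ c
        vanish c e = ≤-reflexive (trans (*-congˡ (trans (*-congʳ e) (zeroˡ _))) (trans
          (solve 1 (λ x → :ι 2 :* :ι 0 := :ι 0 :* :ι 0 :- :ι 0 :+ :ι 2 :* :ι 0) refl 0#)
          (sym (+-cong (+-cong (*-cong b0 b0) (-‿cong b0)) (*-congˡ e)))))
          where
          b0 : b c ≈ 0#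
          b0 = trans (b≈ c) (trans (*-congʳ e) (zeroˡ _))
        term : ∀ c → ι 2 * (χ′ c * d c) ≤ b c * b c - b c + ι 2 * χ′ c
        term c with kind c
        ... | largest-star _ e = vanish c e
        ... | no-star _ e      = vanish c e
        ... | other-star _ _ e = ≤-respˡ (sym (*-congˡ (trans (*-congʳ e) (trans (*-identityˡ _) (sym (a² c))))))
          (≤-by (ι 14 * ((a c - 1#) * (a c - 1#))) (*-nonNeg (ι-nonNeg 14) (square-nonNeg _))
            (trans (+-cong (+-cong (*-cong b1 b1) (-‿cong b1)) (*-congˡ e))
              (solve 1 (λ x → (:ι 4 :* x :- :ι 3) :* (:ι 4 :* x :- :ι 3) :- (:ι 4 :* x :- :ι 3) :+ :ι 2 :* :ι 1 :=
                 :ι 2 :* (x :* x) :+ :ι 14 :* ((x :- :ι 1) :* (x :- :ι 1))) refl (a c))))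
          where
          b1 : b c ≈ ι 4 * a c - ι 3
          b1 = trans (b≈ c) (trans (*-congʳ e) (*-identityˡ _))

      -- The products of different terms are the sum of `b c * (B - b c)`. As `b c` is at least 1 on
      -- each of the `m` stars, lowering that factor to 1 leaves `m B - B`.
      cross-terms : ∑b² ≤ B * B - (m * B - B)
      cross-terms = ≤-by (∑ (λ c → (b c - χ′ c) * (B - b c)))
        (∑-nonNeg λ c → *-nonNeg (x≤y⇒0≤y-x (χ′≤b c)) (x≤y⇒0≤y-x (term≤∑ 0≤b c)))
        (begin-equality
          B * B - (m * B - B)
            ≈⟨ solve 3 (λ B m Q → B :* B :- (m :* B :- B) := Q :+ ((B :* B :- Q) :- (m :* B :- B))) refl B m ∑b² ⟩
          ∑b² + ((B * B - ∑b²) - (m * B - B))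
            ≈⟨ +-congˡ (sym expand) ⟩
          ∑b² + ∑ (λ c → (b c - χ′ c) * (B - b c)) ∎)
        where
        χ′b : ∀ c → χ′ c * b c ≈ b c
        χ′b c = trans (*-congˡ (b≈ c)) (trans (sym (*-assoc _ _ _)) (trans (*-congʳ idem) (sym (b≈ c))))
          where
          idem : χ′ c * χ′ c ≈ χ′ c
          idem with kind c
          ... | largest-star _ e = trans (*-cong e e) (trans (zeroˡ 0#) (sym e))
          ... | no-star _ e      = trans (*-cong e e) (trans (zeroˡ 0#) (sym e))
          ... | other-star _ _ e = trans (*-cong e e) (trans (*-identityˡ 1#) (sym e))
        expand : ∑ (λ c → (b c - χ′ c) * (B - b c)) ≈ (B * B - ∑b²) - (m * B - B)
        expand = trans (∑-cong λ c → trans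
            (solve 3 (λ b x B → (b :- x) :* (B :- b) := (b :* B :- b :* b) :- (x :* B :- x :* b)) refl (b c) (χ′ c) B)
            (+-congˡ (-‿cong (+-congˡ (-‿cong (χ′b c))))))
          (trans (∑-sub _ _) (+-cong (trans (∑-sub _ _) (+-congʳ (sym (∑-* B b))))
            (-‿cong (trans (∑-sub _ _) (+-congʳ (trans (sym (∑-* B χ′)) (*-congʳ ∑χ′)))))))

      ∑da≤ : ∑da ≤ M * α
      ∑da≤ = ≤-respʳ (trans (sym (∑-* M d)) (trans (*-congʳ ∑d) (*-comm _ _)))
        (∑-mono λ c → *-monoˡ-≤ (0≤d c) (a≤M c))

      -- `energy-bound` with `4 Se` raised to `s²` and `∑da` to `M α`: after division by `α` nothing
      -- depends on `α` any more, and `4 (s - M) - 3 m + 1` is left.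
      excess≥ : α * (1# + B) ≤ α * excess
      excess≥ = ≤-by (α * E - low + ((s * s - ι 4 * Se) + ι 4 * (M * α - ∑da)))
        (+-nonNeg (x≤y⇒0≤y-x energy-bound) (+-nonNeg (x≤y⇒0≤y-x 4Se≤s²) (*-nonNeg (ι-nonNeg 4) (x≤y⇒0≤y-x ∑da≤))))
        (trans (solve 8 (λ A E v s M S Q m′ →
            A :* (E :- (:ι 2 :* (A :+ v) :- :ι 6)) :=
            A :* (:ι 1 :+ (:ι 4 :* (s :- M) :- :ι 3 :* (v :- :ι 1))) :+
            (A :* E :- (A :* (A :- v :+ :ι 2 :* s) :+ ((A :+ s) :* (A :+ s) :- :ι 2 :* A :- :ι 4 :* (Q :+ S))) :+
              ((s :* s :- :ι 4 :* S) :+ :ι 4 :* (M :* A :- Q)))) refl α E ν s M Se ∑da m)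
          (+-congʳ (*-congˡ (+-congˡ (sym B≈)))))
        where
        low = α * (α - ν + ι 2 * s) + ((α + s) * (α + s) - ι 2 * α - ι 4 * (∑da + Se))

      -- With `B ≥ m` alone, the difference `(m + 2) B - 6 m - 1` of the squares could be negative
      -- for small `m`. A second star with two children raises `B` to at least `m + 8/5`, which
      -- suffices for every `m`.
      large-star : ∀ {c} → c ≢ c★ → center c ≡ true → ι 2 ≤ d c → Goal
      large-star {c} c≢c★ cc 2≤d = finish 0 (1# + B) (+-nonNeg 0≤1 (≤-trans 0≤m m≤B))
        (≤-respʳ (sym (*-identityˡ _)) excess≥) (≤-respˡ (sym (trans (*-congʳ (*-identityˡ 1#)) (*-identityˡ _))) main)
        where
        χ′c : χ′ c ≈ 1#
        χ′c with kind c
        ... | largest-star c≡c★ _ = ⊥-elim (c≢c★ c≡c★)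
        ... | other-star _ _ e    = e
        ... | no-star cc′ _ with ≡.trans (≡.sym cc) cc′
        ...   | ()
        -- b c ≥ 4 · 7/5 - 3 = 13/5
        5B≥ : ι 5 * m + ι 8 ≤ ι 5 * B
        5B≥ = begin
          ι 5 * m + ι 8
            ≲⟨ +-monoʳ-≤ _ (≤-respʳ (solve 1 (λ x → :ι 4 :* (:ι 5 :* x) :- :ι 20 := :ι 5 :* (:ι 4 :* x :- :ι 3 :- :ι 1)) refl (a c))
                 (≤-respˡ (solve 1 (λ x → :ι 4 :* :ι 7 :- :ι 20 := :ι 8) refl 0#)
                   (+-monoˡ-≤ (- ι 20) (*-monoˡ-≤ (ι-nonNeg 4) (7/5≤√ (0≤a c) (≤-respʳ (sym (a² c)) 2≤d)))))) ⟩
          ι 5 * m + ι 5 * (ι 4 * a c - ι 3 - 1#)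
            ≈⟨ +-congˡ (*-congˡ (+-cong (trans (sym (*-identityˡ _)) (trans (*-congʳ (sym χ′c)) (sym (b≈ c)))) (-‿cong (sym χ′c)))) ⟩
          ι 5 * m + ι 5 * (b c - χ′ c)
            ≲⟨ +-monoʳ-≤ _ (*-monoˡ-≤ (ι-nonNeg 5) (term≤∑ (λ c → x≤y⇒0≤y-x (χ′≤b c)) c)) ⟩
          ι 5 * m + ι 5 * ∑ (λ c → b c - χ′ c)
            ≈⟨ +-congˡ (*-congˡ (trans (∑-sub b χ′) (+-congˡ (-‿cong ∑χ′)))) ⟩
          ι 5 * m + ι 5 * (B - m)
            ≈⟨ solve 2 (λ m B → :ι 5 :* m :+ :ι 5 :* (B :- m) := :ι 5 :* B) refl m B ⟩
          ι 5 * B ∎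
        -- 25 ((m + 2) B - 6 m - 1) = 5 (m + 2) (5 B - 5 m - 8) + (5 m - 6)² + 19
        slack : 0# ≤ (m + ι 2) * B - ι 6 * m - 1#
        slack = ι-cancel-≤ 24 (≤-respˡ (sym (zeroʳ _)) (≤-respʳ
          (solve 2 (λ m B → :ι 5 :* (m :+ :ι 2) :* (:ι 5 :* B :- (:ι 5 :* m :+ :ι 8)) :+ ((:ι 5 :* m :- :ι 6) :* (:ι 5 :* m :- :ι 6) :+ :ι 19) :=
              :ι 25 :* ((m :+ :ι 2) :* B :- :ι 6 :* m :- :ι 1)) refl m B)
          (+-nonNeg (*-nonNeg (*-nonNeg (ι-nonNeg 5) (+-nonNeg 0≤m (ι-nonNeg 2))) (x≤y⇒0≤y-x 5B≥))
            (+-nonNeg (square-nonNeg _) (ι-nonNeg 19)))))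
        main : ι 2 * (α + ν - ι D) ≤ (1# + B) * (1# + B)
        main = begin
          ι 2 * (α + ν - ι D)
            ≲⟨ *-monoˡ-≤ (ι-nonNeg 2) (≤-trans n-D≤ (+-monoʳ-≤ _ τ≤m)) ⟩
          ι 2 * ((α - d c★) + (1# + m) + m)
            ≈⟨ solve 2 (λ x m → :ι 2 :* (x :+ (:ι 1 :+ m) :+ m) := :ι 2 :* x :+ (:ι 4 :* m :+ :ι 2)) refl (α - d c★) m ⟩
          ι 2 * (α - d c★) + (ι 4 * m + ι 2)
            ≲⟨ +-monoˡ-≤ _ (≤-trans sizes (+-monoˡ-≤ _ (+-monoˡ-≤ _ cross-terms))) ⟩
          (B * B - (m * B - B) - B + ι 2 * m) + (ι 4 * m + ι 2)
            ≲⟨ ≤-by ((m + ι 2) * B - ι 6 * m - 1#) slack (solve 2 (λ m B →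
                 (:ι 1 :+ B) :* (:ι 1 :+ B) := (B :* B :- (m :* B :- B) :- B :+ :ι 2 :* m) :+ (:ι 4 :* m :+ :ι 2) :+
                 ((m :+ :ι 2) :* B :- :ι 6 :* m :- :ι 1)) refl m B) ⟩
          (1# + B) * (1# + B) ∎

    module Single (single : ∀ c → c ≢ c★ → center c ≡ true → a c ≈ 1#) where
      open SingleEdges single

      χ′-power : ∀ (f : Fin n → Carrier) → (∀ c → c ≢ c★ → center c ≡ true → f c ≈ 1#) → ∑ (λ c → χ c * f c) ≈ f c★ + m
      χ′-power f f≈1 = begin-equality
        ∑ (λ c → χ c * f c)                           ≈⟨ solve 2 (λ x y → x := y :+ (x :- y)) refl _ (f c★) ⟩
        f c★ + (∑ (λ c → χ c * f c) - f c★)           ≈⟨ +-congˡ (trans (sym (∑-χ′ f)) (trans (∑-cong term) ∑χ′)) ⟩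
        f c★ + m ∎
        where
        term : ∀ c → χ′ c * f c ≈ χ′ c
        term c with kind c
        ... | largest-star _ e  = trans (*-congʳ e) (trans (zeroˡ _) (sym e))
        ... | no-star _ e       = trans (*-congʳ e) (trans (zeroˡ _) (sym e))
        ... | other-star c≢ cc e = trans (*-congˡ (f≈1 c c≢ cc)) (*-identityʳ _)

      d≈1 : ∀ c → c ≢ c★ → center c ≡ true → d c ≈ 1#
      d≈1 c c≢ cc = trans (sym (a² c)) (trans (*-cong (single c c≢ cc) (single c c≢ cc)) (*-identityˡ 1#))

      s≈ : s ≈ M + m
      s≈ = trans (∑-cong λ c → sym (χa c)) (χ′-power a single)

      α≈M²+m : α ≈ M * M + m
      α≈M²+m = trans (sym ∑d) (trans (∑-cong λ c → sym (χd c)) (trans (χ′-power d d≈1) (+-congʳ (sym M²))))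

      ∑da≈ : ∑da ≈ M * M * M + m
      ∑da≈ = trans (∑-cong λ c → trans (*-congʳ (sym (χd c))) (*-assoc _ _ _))
        (trans (χ′-power (λ c → d c * a c) λ c c≢ cc → trans (*-cong (d≈1 c c≢ cc) (single c c≢ cc)) (*-identityˡ 1#))
          (+-congʳ (*-congʳ (sym M²))))

      -- `α` times the gain over `1 + m`: what `4Se≤s²` and `∑da≤` would give away is retained. With
      -- `s = M + m`, the bound of `SingleEdges` for `Se` leaves `s² - 4 m M + 4 τ (M - 1)`, and
      -- `4 (M α - ∑da)` is `4 m (M - 1)`.
      X₀ : Carrier
      X₀ = M * M + ι 2 * M * m + m * m - ι 4 * m + ι 4 * (τ * (M - 1#))

      excess≥ : (M * M + m) * (1# + m) + X₀ ≤ α * excess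
      excess≥ = ≤-by (α * E - low + ι 4 * (m * M - τ * (M - 1#) - Se))
        (+-nonNeg (x≤y⇒0≤y-x energy-bound) (*-nonNeg (ι-nonNeg 4) (x≤y⇒0≤y-x Se≤)))
        (begin-equality
          α * (E - (ι 2 * (α + ν) - ι 6))
            ≈⟨ solve 6 (λ A v s E Q S → A :* (E :- (:ι 2 :* (A :+ v) :- :ι 6)) :=
                 (A :* (A :- v :+ :ι 2 :* s) :+ ((A :+ s) :* (A :+ s) :- :ι 2 :* A :- :ι 4 :* Q)) :- A :* (:ι 2 :* (A :+ v) :- :ι 6) :+
                 (A :* E :- (A :* (A :- v :+ :ι 2 :* s) :+ ((A :+ s) :* (A :+ s) :- :ι 2 :* A :- :ι 4 :* (Q :+ S))) :- :ι 4 :* S))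
                 refl α ν s E ∑da Se ⟩
          (α * (α - ν + ι 2 * s) + ((α + s) * (α + s) - ι 2 * α - ι 4 * ∑da)) - α * (ι 2 * (α + ν) - ι 6) + (α * E - low - ι 4 * Se)
            ≈⟨ +-congʳ main ⟩
          (M * M + m) * (1# + m) + X₀ - ι 4 * (τ * (M - 1#)) + ι 4 * (m * M) + (α * E - low - ι 4 * Se)
            ≈⟨ solve 6 (λ z y x L S e → z :+ x :- :ι 4 :* y :+ :ι 4 :* L :+ (e :- :ι 4 :* S) := z :+ x :+ (e :+ :ι 4 :* (L :- y :- S)))
                 refl ((M * M + m) * (1# + m)) (τ * (M - 1#)) X₀ (m * M) Se (α * E - low) ⟩
          (M * M + m) * (1# + m) + X₀ + (α * E - low + ι 4 * (m * M - τ * (M - 1#) - Se)) ∎)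
        where
        low = α * (α - ν + ι 2 * s) + ((α + s) * (α + s) - ι 2 * α - ι 4 * (∑da + Se))
        main : (α * (α - ν + ι 2 * s) + ((α + s) * (α + s) - ι 2 * α - ι 4 * ∑da)) - α * (ι 2 * (α + ν) - ι 6) ≈
          (M * M + m) * (1# + m) + X₀ - ι 4 * (τ * (M - 1#)) + ι 4 * (m * M)
        main = trans (+-cong (+-cong (*-cong A (+-cong (+-cong A (-‿cong ν≈1+m)) (*-congˡ s≈)))
              (+-cong (+-cong (*-cong (+-cong A s≈) (+-cong A s≈)) (-‿cong (*-congˡ A))) (-‿cong (*-congˡ ∑da≈))))
              (-‿cong (*-cong A (+-congʳ (*-congˡ (+-cong A ν≈1+m))))))
          (solve 3 (λ M m t → let A = M :* M :+ m; s = M :+ m; v = :ι 1 :+ m in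
             (A :* (A :- v :+ :ι 2 :* s) :+ ((A :+ s) :* (A :+ s) :- :ι 2 :* A :- :ι 4 :* (M :* M :* M :+ m))) :- A :* (:ι 2 :* (A :+ v) :- :ι 6) :=
             A :* v :+ (M :* M :+ :ι 2 :* M :* m :+ m :* m :- :ι 4 :* m :+ :ι 4 :* t) :- :ι 4 :* t :+ :ι 4 :* (m :* M)) refl M m (τ * (M - 1#)))
          where
          A = α≈M²+m

      0≤τM : 0# ≤ τ * (M - 1#)
      0≤τM = *-nonNeg 0≤τ (x≤y⇒0≤y-x 1≤M)

      n-D≤′ : α + ν - ι D ≤ ι 2 * m + 1# + τ
      n-D≤′ = ≤-respʳ (trans (+-congʳ (+-congʳ (+-cong α≈M²+m (-‿cong (sym M²)))))
        (solve 3 (λ x m t → x :+ m :- x :+ (:ι 1 :+ m) :+ t := :ι 2 :* m :+ :ι 1 :+ t) refl (M * M) m τ)) n-D≤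

      -- This is finish with Y = (k + 1) (1 + m) + y.
      finish′ : ∀ k y → 0# ≤ y → (M * M + m) * y ≤ ι (suc k) * X₀ →
        ∀ {z} → α + ν - ι D ≤ z → ι (suc k) * ι (suc k) * (ι 2 * z) ≤ (ι (suc k) * (1# + m) + y) * (ι (suc k) * (1# + m) + y) → Goal
      finish′ k y 0≤y h z≥ high = finish k (ι (suc k) * (1# + m) + y)
        (+-nonNeg (*-nonNeg (ι-nonNeg (suc k)) (+-nonNeg 0≤1 0≤m)) 0≤y)
        (begin
          α * (ι (suc k) * (1# + m) + y)                        ≈⟨ *-congʳ α≈M²+m ⟩
          (M * M + m) * (ι (suc k) * (1# + m) + y)
            ≈⟨ solve 4 (λ A k m y → A :* (k :* (:ι 1 :+ m) :+ y) := k :* (A :* (:ι 1 :+ m)) :+ A :* y) refl (M * M + m) (ι (suc k)) m y ⟩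
          ι (suc k) * ((M * M + m) * (1# + m)) + (M * M + m) * y ≲⟨ +-monoʳ-≤ _ h ⟩
          ι (suc k) * ((M * M + m) * (1# + m)) + ι (suc k) * X₀  ≈⟨ sym (distribˡ _ _ _) ⟩
          ι (suc k) * ((M * M + m) * (1# + m) + X₀)              ≲⟨ *-monoˡ-≤ (ι-nonNeg (suc k)) excess≥ ⟩
          ι (suc k) * (α * excess) ∎)
        (≤-trans (*-monoˡ-≤ (*-nonNeg (ι-nonNeg (suc k)) (ι-nonNeg (suc k))) (*-monoˡ-≤ (ι-nonNeg 2) z≥)) high)

      -- m = 0 or m ≥ 3.
      generic : 0# ≤ m * (m - ι 3) → Goal
      generic m-gap = finish′ 0 1# 0≤1
        (≤-by (m * (m - ι 3) + ι 2 * m * (M - 1#) + ι 4 * (τ * (M - 1#)))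
          (+-nonNeg (+-nonNeg m-gap (*-nonNeg (*-nonNeg (ι-nonNeg 2) 0≤m) (x≤y⇒0≤y-x 1≤M))) (*-nonNeg (ι-nonNeg 4) 0≤τM))
          (solve 3 (λ M m t → :ι 1 :* (M :* M :+ :ι 2 :* M :* m :+ m :* m :- :ι 4 :* m :+ :ι 4 :* t) :=
             (M :* M :+ m) :* :ι 1 :+ (m :* (m :- :ι 3) :+ :ι 2 :* m :* (M :- :ι 1) :+ :ι 4 :* t)) refl M m (τ * (M - 1#))))
        (≤-trans n-D≤′ (+-monoʳ-≤ _ τ≤m))
        (≤-by ((m - 1#) * (m - 1#) + 1#) (+-nonNeg (square-nonNeg _) 0≤1)
          (solve 1 (λ m → (:ι 1 :* (:ι 1 :+ m) :+ :ι 1) :* (:ι 1 :* (:ι 1 :+ m) :+ :ι 1) :=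
             :ι 1 :* :ι 1 :* (:ι 2 :* (:ι 2 :* m :+ :ι 1 :+ m)) :+ ((m :- :ι 1) :* (m :- :ι 1) :+ :ι 1)) refl m))

      5M≥7 : ι 2 ≤ M * M → ι 7 ≤ ι 5 * M
      5M≥7 = 7/5≤√ 0≤M

      -- The leaf at the root gives `D ≥ 1`. When `M = 1` this improves `n-D≤′` by dropping `τ`.
      n-D≤n-1 : α + ν - ι D ≤ M * M + ι 2 * m
      n-D≤n-1 = ≤-by (ι D - 1#) (x≤y⇒0≤y-x (1≤D r~ℓ ℓ-leaf))
        (trans (solve 3 (λ A m D → A :+ :ι 2 :* m := (A :+ m) :+ (:ι 1 :+ m) :- D :+ (D :- :ι 1)) refl (M * M) m (ι D))
          (+-congʳ (+-congʳ (+-cong (sym α≈M²+m) (sym ν≈1+m)))))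

      -- Six vertices with `α = 3` and `X₀ = 1`: the excess is at least `3 + 1/3`, and
      -- `(10/3)² ≥ 10`, while `n - D ≤ 5`.
      two-others-single : m ≈ ι 2 → M ≈ 1# → Goal
      two-others-single m≈ M≈ = finish′ 2 1# 0≤1
        (≤-by (ι 12 * (τ * (M - 1#))) (*-nonNeg (ι-nonNeg 12) 0≤τM) (begin-equality
          ι 3 * X₀
            ≈⟨ *-congˡ (+-congʳ (+-cong (+-cong (+-cong (*-cong M≈ M≈) (*-cong (*-congˡ M≈) m≈)) (*-cong m≈ m≈)) (-‿cong (*-congˡ m≈)))) ⟩
          ι 3 * (1# * 1# + ι 2 * 1# * ι 2 + ι 2 * ι 2 - ι 4 * ι 2 + ι 4 * (τ * (M - 1#)))
            ≈⟨ solve 1 (λ t → :ι 3 :* (:ι 1 :* :ι 1 :+ :ι 2 :* :ι 1 :* :ι 2 :+ :ι 2 :* :ι 2 :- :ι 4 :* :ι 2 :+ :ι 4 :* t) := (:ι 1 :* :ι 1 :+ :ι 2) :* :ι 1 :+ :ι 12 :* t) refl (τ * (M - 1#)) ⟩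
          (1# * 1# + ι 2) * 1# + ι 12 * (τ * (M - 1#))
            ≈⟨ +-congʳ (*-congʳ (+-cong (*-cong (sym M≈) (sym M≈)) (sym m≈))) ⟩
          (M * M + m) * 1# + ι 12 * (τ * (M - 1#)) ∎))
        (≤-respʳ (trans (+-cong (*-cong M≈ M≈) (*-congˡ m≈)) (solve 1 (λ x → :ι 1 :* :ι 1 :+ :ι 2 :* :ι 2 := :ι 5) refl 0#)) n-D≤n-1)
        (≤-by (ι 10) (ι-nonNeg 10) (trans (*-cong Y≈ Y≈)
          (solve 1 (λ x → :ι 10 :* :ι 10 := :ι 3 :* :ι 3 :* (:ι 2 :* :ι 5) :+ :ι 10) refl 0#)))
        where
        Y≈ : ι 3 * (1# + m) + 1# ≈ ι 10
        Y≈ = trans (+-congʳ (*-congˡ (+-congˡ m≈))) (solve 1 (λ x → :ι 3 :* (:ι 1 :+ :ι 2) :+ :ι 1 := :ι 10) refl 0#)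

      -- Since `n - D ≤ 7`, an excess of `√14` is asked for. The value `15/4` lies just above it,
      -- and the gain of `3/4` over `1 + m` is available for all `M ≥ √2`.
      two-others-large : m ≈ ι 2 → ι 2 ≤ M * M → Goal
      two-others-large m≈ 2≤M² = finish′ 3 (ι 3) (ι-nonNeg 3)
        (≤-by slack 0≤slack (begin-equality
          ι 4 * X₀
            ≈⟨ *-congˡ (+-congʳ (+-cong (+-cong (+-congˡ (*-congˡ m≈)) (*-cong m≈ m≈)) (-‿cong (*-congˡ m≈)))) ⟩
          ι 4 * (M * M + ι 2 * M * ι 2 + ι 2 * ι 2 - ι 4 * ι 2 + ι 4 * (τ * (M - 1#)))
            ≈⟨ trans (solve 2 (λ M t → :ι 4 :* (M :* M :+ :ι 2 :* M :* :ι 2 :+ :ι 2 :* :ι 2 :- :ι 4 :* :ι 2 :+ :ι 4 :* t) :=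
                 (M :* M :+ :ι 2) :* :ι 3 :+ ((M :* M :- :ι 2) :+ :ι 3 :* (:ι 5 :* M :- :ι 7) :+ (M :- :ι 1) :+ :ι 2 :+ :ι 16 :* t)) refl M (τ * (M - 1#)))
                 (+-congʳ (*-congʳ (+-congˡ (sym m≈)))) ⟩
          (M * M + m) * ι 3 + slack ∎))
        (≤-respʳ (trans (+-cong (+-congʳ (*-congˡ m≈)) m≈) (solve 1 (λ x → :ι 2 :* :ι 2 :+ :ι 1 :+ :ι 2 := :ι 7) refl 0#)) (≤-trans n-D≤′ (+-monoʳ-≤ _ τ≤m)))
        (≤-by 1# 0≤1 (trans (*-cong Y≈ Y≈)
          (solve 1 (λ x → :ι 15 :* :ι 15 := :ι 4 :* :ι 4 :* (:ι 2 :* :ι 7) :+ :ι 1) refl 0#)))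
        where
        slack = (M * M - ι 2) + ι 3 * (ι 5 * M - ι 7) + (M - 1#) + ι 2 + ι 16 * (τ * (M - 1#))
        0≤slack : 0# ≤ slack
        0≤slack = +-nonNeg (+-nonNeg (+-nonNeg (+-nonNeg (x≤y⇒0≤y-x 2≤M²) (*-nonNeg (ι-nonNeg 3) (x≤y⇒0≤y-x (5M≥7 2≤M²))))
          (x≤y⇒0≤y-x 1≤M)) (ι-nonNeg 2)) (*-nonNeg (ι-nonNeg 16) 0≤τM)
        Y≈ : ι 4 * (1# + m) + ι 3 ≈ ι 15
        Y≈ = trans (+-congʳ (*-congˡ (+-congˡ m≈))) (solve 1 (λ x → :ι 4 :* (:ι 1 :+ :ι 2) :+ :ι 3 := :ι 15) refl 0#)

      -- Here the excess is at least 5/2 + τ/3, and (5/2 + τ/3)² = 6 + 2τ + (1/2 - τ/3)².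
      one-other-large : m ≈ 1# → ι 2 ≤ M * M → Goal
      one-other-large m≈ 2≤M² = finish′ 5 (ι 3 + ι 2 * τ) (+-nonNeg (ι-nonNeg 3) (*-nonNeg (ι-nonNeg 2) 0≤τ))
        (≤-by slack 0≤slack (begin-equality
          ι 6 * X₀
            ≈⟨ *-congˡ (+-congʳ (+-cong (+-cong (+-congˡ (*-congˡ m≈)) (*-cong m≈ m≈)) (-‿cong (*-congˡ m≈)))) ⟩
          ι 6 * (M * M + ι 2 * M * 1# + 1# * 1# - ι 4 * 1# + ι 4 * (τ * (M - 1#)))
            ≈⟨ trans (solve 2 (λ M t → :ι 6 :* (M :* M :+ :ι 2 :* M :* :ι 1 :+ :ι 1 :* :ι 1 :- :ι 4 :* :ι 1 :+ :ι 4 :* (t :* (M :- :ι 1))) :=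
                 (M :* M :+ :ι 1) :* (:ι 3 :+ :ι 2 :* t) :+
                 ((:ι 1 :- t) :* (:ι 3 :* (M :* M :- :ι 2) :+ :ι 2 :* (:ι 5 :* M :- :ι 7) :+ :ι 2 :* (M :- :ι 1) :+ :ι 1) :+
                  t :* ((M :* M :- :ι 2) :+ :ι 7 :* (:ι 5 :* M :- :ι 7) :+ (M :- :ι 1) :+ :ι 5))) refl M τ)
                 (+-congʳ (*-congʳ (+-congˡ (sym m≈)))) ⟩
          (M * M + m) * (ι 3 + ι 2 * τ) + slack ∎))
        (≤-respʳ (+-congʳ (trans (+-congʳ (*-congˡ m≈)) (solve 1 (λ x → :ι 2 :* :ι 1 :+ :ι 1 := :ι 3) refl 0#))) n-D≤′)
        (≤-by ((ι 3 - ι 2 * τ) * (ι 3 - ι 2 * τ)) (square-nonNeg _) (trans (*-cong Y≈ Y≈)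
          (solve 1 (λ t → (:ι 15 :+ :ι 2 :* t) :* (:ι 15 :+ :ι 2 :* t) :=
             :ι 6 :* :ι 6 :* (:ι 2 :* (:ι 3 :+ t)) :+ (:ι 3 :- :ι 2 :* t) :* (:ι 3 :- :ι 2 :* t)) refl τ)))
        where
        slack = (1# - τ) * (ι 3 * (M * M - ι 2) + ι 2 * (ι 5 * M - ι 7) + ι 2 * (M - 1#) + 1#) +
          τ * ((M * M - ι 2) + ι 7 * (ι 5 * M - ι 7) + (M - 1#) + ι 5)
        0≤5M-7 = x≤y⇒0≤y-x (5M≥7 2≤M²)
        0≤slack : 0# ≤ slack
        0≤slack = +-nonNeg
          (*-nonNeg (x≤y⇒0≤y-x (≤-respʳ m≈ τ≤m)) (+-nonNeg (+-nonNeg (+-nonNeg (*-nonNeg (ι-nonNeg 3) (x≤y⇒0≤y-x 2≤M²))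
            (*-nonNeg (ι-nonNeg 2) 0≤5M-7)) (*-nonNeg (ι-nonNeg 2) (x≤y⇒0≤y-x 1≤M))) 0≤1))
          (*-nonNeg 0≤τ (+-nonNeg (+-nonNeg (+-nonNeg (x≤y⇒0≤y-x 2≤M²) (*-nonNeg (ι-nonNeg 7) 0≤5M-7)) (x≤y⇒0≤y-x 1≤M)) (ι-nonNeg 5)))
        Y≈ : ι 6 * (1# + m) + (ι 3 + ι 2 * τ) ≈ ι 15 + ι 2 * τ
        Y≈ = trans (+-congʳ (*-congˡ (+-congˡ m≈))) (solve 1 (λ t → :ι 6 :* (:ι 1 :+ :ι 1) :+ (:ι 3 :+ :ι 2 :* t) := :ι 15 :+ :ι 2 :* t) refl τ)

      -- Four vertices: E² ≥ 2 tr S² = 24.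
      one-other-single : m ≈ 1# → M ≈ 1# → Goal
      one-other-single m≈ M≈ = from-excess (≤-respˡ (solve 1 (λ q → :ι 2 :+ q :- :ι 2 := q) refl q)
        (≤-respʳ (+-congˡ (-‿cong (trans (solve 1 (λ x → :ι 2 := :ι 2 :* :ι 4 :- :ι 6) refl 0#) (+-congʳ (*-congˡ (sym α+ν≈4))))))
          (+-monoˡ-≤ (- ι 2) 2+q≤E)))
        where
        α+ν≈4 : α + ν ≈ ι 4
        α+ν≈4 = trans (+-cong (trans α≈M²+m (+-cong (*-cong M≈ M≈) m≈)) (trans ν≈1+m (+-congˡ m≈)))
          (solve 1 (λ x → (:ι 1 :* :ι 1 :+ :ι 1) :+ (:ι 1 :+ :ι 1) := :ι 4) refl 0#)
        q²≤6 : q * q ≤ ι 6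
        q²≤6 = ≤-respˡ (sym q²) (≤-respʳ (solve 1 (λ x → :ι 2 :* :ι 3 := :ι 6) refl 0#) (*-monoˡ-≤ (ι-nonNeg 2)
          (≤-respʳ (trans (+-cong (*-cong M≈ M≈) (*-congˡ m≈)) (solve 1 (λ x → :ι 1 :* :ι 1 :+ :ι 2 :* :ι 1 := :ι 3) refl 0#)) n-D≤n-1)))
        -- Here `X₀` is 0, so the test vectors yield only an excess of 2, less than `√6`. With
        -- `q ≤ 5/2` and `q² ≤ 6` one gets `(2 + q)² ≤ 20`, below 24.
        2q≤5 : ι 2 * q ≤ ι 5
        2q≤5 = square-cancel-≤ (ι-nonNeg 5) (begin
          (ι 2 * q) * (ι 2 * q)  ≈⟨ solve 1 (λ q → (:ι 2 :* q) :* (:ι 2 :* q) := :ι 4 :* (q :* q)) refl q ⟩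
          ι 4 * (q * q)          ≲⟨ *-monoˡ-≤ (ι-nonNeg 4) q²≤6 ⟩
          ι 4 * ι 6              ≲⟨ ≤-by 1# 0≤1 (solve 1 (λ x → :ι 5 :* :ι 5 := :ι 4 :* :ι 6 :+ :ι 1) refl 0#) ⟩
          ι 5 * ι 5 ∎)
        trace-square : ∑ (λ i → ∑ λ j → S i j * S i j) ≈ ι 12
        trace-square = begin-equality
          ∑ (λ i → ∑ λ j → S i j * S i j)
            ≈⟨ (∑-cong λ i → trans (∑-cong λ j → S² i j) (trans (∑-sub _ _)
                 (+-cong (∑-const n 1#) (-‿cong (trans (∑-cong λ j → sym (*-identityʳ _)) (∑-δˡ i λ _ → 1#)))))) ⟩
          ∑ {n} (λ i → N * 1# - 1#)
            ≈⟨ ∑-const n _ ⟩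
          N * (N * 1# - 1#)
            ≈⟨ trans (*-cong N≈4 (+-congʳ (*-congʳ N≈4))) (solve 1 (λ x → :ι 4 :* (:ι 4 :* :ι 1 :- :ι 1) := :ι 12) refl 0#) ⟩
          ι 12 ∎
          where
          N≈4 : N ≈ ι 4
          N≈4 = trans (sym α+ν) α+ν≈4
        2+q≤E : ι 2 + q ≤ E
        2+q≤E = square-cancel-≤ (∑-nonNeg λ i → ∣∣-nonNeg (μ i)) (≤-trans (ι-cancel-≤ 3 (begin
          ι 4 * ((ι 2 + q) * (ι 2 + q))
            ≈⟨ solve 1 (λ q → :ι 4 :* ((:ι 2 :+ q) :* (:ι 2 :+ q)) := :ι 16 :+ :ι 8 :* (:ι 2 :* q) :+ :ι 4 :* (q :* q)) refl q ⟩
          ι 16 + ι 8 * (ι 2 * q) + ι 4 * (q * q)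
            ≲⟨ +-mono-≤ (+-monoʳ-≤ _ (*-monoˡ-≤ (ι-nonNeg 8) 2q≤5)) (*-monoˡ-≤ (ι-nonNeg 4) q²≤6) ⟩
          ι 16 + ι 8 * ι 5 + ι 4 * ι 6
            ≲⟨ ≤-by (ι 16) (ι-nonNeg 16) (solve 1 (λ x → :ι 4 :* (:ι 2 :* :ι 12) := :ι 16 :+ :ι 8 :* :ι 5 :+ :ι 4 :* :ι 6 :+ :ι 16) refl 0#) ⟩
          ι 4 * (ι 2 * ι 12) ∎))
          (≤-respˡ (*-congˡ trace-square) (energy² S S-symmetric S≤1 -1≤S μ spectrum (∑-0 S-diagonal))))

    conclusion : Goal
    conclusion = by-cases (Fin.any? λ c → ¬? (c Fin.≟ c★) ×-dec ((center c ≟ true) ×-dec (2 ℕ.≤? size c)))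
      where
      by-cases : Dec (∃[ c ] (c ≢ c★ × center c ≡ true × 2 ℕ.≤ size c)) → Goal
      by-cases (yes (c , c≢ , cc , 2≤)) = Generic.large-star (λ c → χ′ c * (ι 4 * a c - ι 3)) (λ _ → refl) c≢ cc
        (≤-respʳ (sym (d≈size c)) (ι-mono {2} {size c} 2≤))
      by-cases (no none) = small νℕ ≡.refl (size c★) ≡.refl
        where
        √1 : ∀ {k} → k ≡ 1 → √ k ≈ 1#
        √1 ≡.refl = ≤-antisym
          (square-cancel-≤ 0≤1 (≤-reflexive (trans (√-square 1) (sym (*-identityˡ 1#)))))
          (square-cancel-≤ (√-nonNeg 1) (≤-reflexive (trans (*-identityˡ 1#) (sym (√-square 1)))))
        size≡1 : ∀ c → c ≢ c★ → center c ≡ true → size c ≡ 1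
        size≡1 c c≢ cc with size-center cc
        ... | zero  , e = e
        ... | suc k , e = ⊥-elim (none (c , c≢ , cc , ℕ.≤-trans (ℕ.s≤s (ℕ.s≤s ℕ.z≤n)) (ℕ.≤-reflexive (≡.sym e))))
        open Single (λ c c≢ cc → √1 (size≡1 c c≢ cc))
        m≈ : ∀ {k} → νℕ ≡ suc k → m ≈ ι k
        m≈ {k} e = trans (+-congʳ (trans ν≈ (trans (reflexive (≡.cong ι e)) (ι-suc k))))
          (solve 1 (λ x → :ι 1 :+ x :- :ι 1 := x) refl (ι k))
        2≤M² : ∀ {k} → size c★ ≡ suc (suc k) → ι 2 ≤ M * M
        2≤M² {k} e = ≤-respʳ (sym (trans (√-square (size c★)) (reflexive (≡.cong ι e)))) (ι-mono {2} {suc (suc k)} (ℕ.s≤s (ℕ.s≤s ℕ.z≤n)))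
        small : ∀ k → νℕ ≡ k → ∀ l → size c★ ≡ l → Goal
        small zero e l _ with ≡.trans (≡.sym e) (proj₂ (card-some center c★ c★-center))
        ... | ()
        small (suc k) _ zero e with ≡.trans (≡.sym e) (proj₂ (size-center c★-center))
        ... | ()
        -- The indices are the number `m + 1` of stars and the size of the largest star. Only two
        -- and three stars escape `generic`.
        small 1 e _ _ = generic (≤-reflexive (sym (trans (*-congʳ (m≈ e)) (zeroˡ _))))
        small 2 e 1 e′ = one-other-single (m≈ e) (√1 e′)
        small 2 e (suc (suc l)) e′ = one-other-large (m≈ e) (2≤M² e′)
        small 3 e 1 e′ = two-others-single (m≈ e) (√1 e′)
        small 3 e (suc (suc l)) e′ = two-others-large (m≈ e) (2≤M² e′)
        small (suc (suc (suc (suc k)))) e _ _ = generic (*-nonNeg 0≤m (x≤y⇒0≤y-x (≤-respʳ (sym (m≈ e)) (ι-mono {3} {suc (suc (suc k))} (ℕ.s≤s (ℕ.s≤s (ℕ.s≤s ℕ.z≤n)))))))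

-- The bound over an abstract real ring.

module Main (𝓡 : RealRing) where
  open Order 𝓡
  open StarVectors 𝓡 using (⟦_⟧)
  open Estimate 𝓡 using (module Bound)
  open Labelling using (leaf-partition)
  open PowerTraces 𝓡 using (charpoly; product-cong)
  open import Algebra.Definitions.RawMonoid *-rawMonoid using () renaming (sum to product)
  open import Algebra.Properties.Semiring.Exp semiring using (_^_)
  open Det commutativeRing using (Matrix; det; det-cong)
  open import Function.Base using (_∘_)
  open import Relation.Binary.PropositionalEquality as ≡ using (_≡_; _≢_)
  open import Data.Bool.Base using (true; false; if_then_else_)
  open import Data.Fin.Base as Fin using (Fin; zero; suc; toℕ; punchIn)
  import Data.Fin.Properties as Fin
  import Data.Nat.Properties as ℕ
  open import Relation.Nullary using (yes; no; does)

  module _ {n} (G : Graph n) (S : Matrix n) (S≈ : ∀ i j →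
    S i j ≈ (if does (i Fin.≟ j) then 0# else if Graph.adj G i j then - 1# else 1#)) where
    open Graph G

    seidel-entry : ∀ i j → S i j ≈ 1# - δ i j - ι 2 * ⟦ adj i j ⟧
    seidel-entry i j = trans (S≈ i j) entry
      where
      entry : (if does (i Fin.≟ j) then 0# else if adj i j then - 1# else 1#) ≈ 1# - δ i j - ι 2 * ⟦ adj i j ⟧
      entry with i Fin.≟ j | adj i j in eq
      ... | no _       | true  = solve 1 (λ x → :- :ι 1 := :ι 1 :- :ι 0 :- :ι 2 :* :ι 1) refl 0#
      ... | no _       | false = solve 1 (λ x → :ι 1 := :ι 1 :- :ι 0 :- :ι 2 :* :ι 0) refl 0#
      ... | yes ≡.refl | false = solve 1 (λ x → :ι 0 := :ι 1 :- :ι 1 :- :ι 2 :* :ι 0) refl 0#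
      ... | yes ≡.refl | true with ≡.trans (≡.sym eq) (adj-irrefl i)
      ...   | ()

    seidel-energy-≥ : IsTree → (μ : Fin n → Carrier) →
      (∀ x → charpoly S x ≈ product (λ i → x - μ i)) →
      ι 2 * ι n - ι 6 + √ (2 ℕ.* (n ∸ D)) ≤ ∑ (λ i → ∣ μ i ∣)
    seidel-energy-≥ tree μ spectrum = by-size n ≡.refl
      where
      two-vertices : ∀ {x y : Fin n} → x ≢ y → ι 2 * ι n - ι 6 + √ (2 ℕ.* (n ∸ D)) ≤ ∑ (λ i → ∣ μ i ∣)
      two-vertices x≢y with leaf-partition G tree x≢y
      ... | r , ℓ , P , r~ℓ , leaf = Bound.conclusion G P r~ℓ leaf S seidel-entry μ
        spectrum
      -- The bound is negative here: `√ k ≤ 2` holds whatever the value of `D`.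
      one-vertex : ι 2 * ι 1 - ι 6 + √ (2 ℕ.* (1 ∸ D)) ≤ ∑ (λ i → ∣ μ i ∣)
      one-vertex = ≤-trans (≤-by (ι 2 - √ k + ι 2) (+-nonNeg (x≤y⇒0≤y-x √k≤2) (ι-nonNeg 2))
          (solve 1 (λ q → :ι 0 := :ι 2 :* :ι 1 :- :ι 6 :+ q :+ (:ι 2 :- q :+ :ι 2)) refl (√ k)))
        (∑-nonNeg λ i → ∣∣-nonNeg (μ i))
        where
        k = 2 ℕ.* (1 ∸ D)
        √k≤2 : √ k ≤ ι 2
        √k≤2 = square-cancel-≤ (ι-nonNeg 2) (≤-respˡ (sym (√-square k)) (≤-respʳ (ι-* 2 2)
          (ι-mono {k} {4} (ℕ.≤-trans (ℕ.*-monoʳ-≤ 2 (ℕ.m∸n≤m 1 D)) (ℕ.s≤s (ℕ.s≤s ℕ.z≤n))))))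
      distinct : ∀ {k} → n ≡ suc (suc k) → ∃[ x ] ∃[ y ] _≢_ {A = Fin n} x y
      distinct ≡.refl = zero , suc zero , λ ()
      by-size : ∀ k → n ≡ k → ι 2 * ι n - ι 6 + √ (2 ℕ.* (n ∸ D)) ≤ ∑ (λ i → ∣ μ i ∣)
      by-size zero e with ≡.subst Fin e (proj₁ (IsTree.connected tree))
      ... | ()
      by-size (suc zero) e = ≡.subst (λ k → ι 2 * ι k - ι 6 + √ (2 ℕ.* (k ∸ D)) ≤ ∑ (λ i → ∣ μ i ∣)) (≡.sym e) one-vertex
      by-size (suc (suc k)) e with distinct e
      ... | x , y , x≢y = two-vertices x≢y

  -- Sums, products, powers and determinants are determined by their recursion equations.
  module Recursive
    (sum′ : ∀ {n} → (Fin n → Carrier) → Carrier)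
    (sum′-zero : ∀ (f : Fin 0 → Carrier) → sum′ f ≈ 0#)
    (sum′-suc : ∀ {n} (f : Fin (suc n) → Carrier) → sum′ f ≈ f zero + sum′ (f ∘ suc))
    (product′ : ∀ {n} → (Fin n → Carrier) → Carrier)
    (product′-zero : ∀ (f : Fin 0 → Carrier) → product′ f ≈ 1#)
    (product′-suc : ∀ {n} (f : Fin (suc n) → Carrier) → product′ f ≈ f zero * product′ (f ∘ suc))
    (_^′_ : Carrier → ℕ → Carrier)
    (^′-zero : ∀ x → x ^′ 0 ≈ 1#)
    (^′-suc : ∀ x k → x ^′ suc k ≈ x * x ^′ k)
    (-1′ : Carrier)
    (-1′≈ : -1′ ≈ - 1#)
    (det′ : ∀ {n} → Matrix n → Carrier)
    (det′-zero : ∀ (A : Matrix 0) → det′ A ≈ 1#)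
    (term : ∀ {n} → Matrix (suc n) → Fin (suc n) → Carrier)
    (term≈ : ∀ {n} (A : Matrix (suc n)) j →
      term A j ≈ -1′ ^′ toℕ j * A zero j * det′ (λ i k → A (suc i) (punchIn j k)))
    (det′-suc : ∀ {n} (A : Matrix (suc n)) → det′ A ≈ sum′ (term A)) where

    sum′≈ : ∀ {n} (f : Fin n → Carrier) → sum′ f ≈ ∑ f
    sum′≈ {zero}  f = trans (sum′-zero f) (sym (∑-zero f))
    sum′≈ {suc n} f = trans (sum′-suc f) (trans (+-congˡ (sum′≈ (f ∘ suc))) (sym (∑-suc f)))

    product′≈ : ∀ {n} (f : Fin n → Carrier) → product′ f ≈ product f
    product′≈ {zero}  f = product′-zero f
    product′≈ {suc n} f = trans (product′-suc f) (*-congˡ (product′≈ (f ∘ suc)))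

    ^′≈ : ∀ k → -1′ ^′ k ≈ (- 1#) ^ k
    ^′≈ zero    = ^′-zero -1′
    ^′≈ (suc k) = trans (^′-suc -1′ k) (*-cong -1′≈ (^′≈ k))

    det′≈ : ∀ {n} (A : Matrix n) → det′ A ≈ det A
    det′≈ {zero}  A = det′-zero A
    det′≈ {suc n} A = trans (det′-suc A) (trans (sum′≈ (term A))
      (∑-cong λ j → trans (term≈ A j) (*-cong (*-congʳ (^′≈ (toℕ j))) (det′≈ (λ i k → A (suc i) (punchIn j k))))))

    sign-cong : ∀ b c → (if b then 0# else if c then -1′ else 1#) ≈ (if b then 0# else if c then - 1# else 1#)
    sign-cong true  _     = refl
    sign-cong false true  = -1′≈
    sign-cong false false = refl

    -- Every notion of the statement enters as a variable with its defining equation up to `≈`. The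
    -- Cauchy reals are then plugged in notion by notion, which keeps conversion checks between
    -- large concrete sequences out of the argument.
    lower-bound : ∀ {n} (G : Graph n) → let open Graph G in IsTree → (μ : Fin n → Carrier)
      (I : Matrix n) → (∀ i j → I i j ≈ (if does (i Fin.≟ j) then 1# else 0#)) →
      (S : Matrix n) → (∀ i j → S i j ≈ (if does (i Fin.≟ j) then 0# else if adj i j then -1′ else 1#)) →
      (C : Carrier → Matrix n) → (∀ x i j → C x i j ≈ x * I i j - S i j) →
      (f : Carrier → Fin n → Carrier) → (∀ x i → f x i ≈ x - μ i) →
      (χ ψ : Carrier → Carrier) → (∀ x → χ x ≈ det′ (C x)) → (∀ x → ψ x ≈ product′ (f x)) → (∀ x → χ x ≈ ψ x) →
      ∀ e → e ≈ sum′ (λ i → ∣ μ i ∣) →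
      (num : ℕ → Carrier) → (∀ k → ι k ≈ num k) →
      ∀ b → b ≈ num 2 * num n - num 6 + √ (2 ℕ.* (n ∸ D)) → b ≤ e
    lower-bound {n} G tree μ I I≈ S S≈ C C≈ f f≈ χ ψ χ≈ ψ≈ spectrum e e≈ num num≈ b b≈ = ≤-respˡ
      (trans (+-congʳ (+-cong (*-cong (num≈ 2) (num≈ n)) (-‿cong (num≈ 6)))) (sym b≈))
      (≤-respʳ (trans (sym (sum′≈ _)) (sym e≈))
        (seidel-energy-≥ G S (λ i j → trans (S≈ i j) (sign-cong (does (i Fin.≟ j)) (Graph.adj G i j))) tree μ λ x → trans
          (det-cong (λ i j → sym (trans (C≈ x i j) (+-congʳ (*-congˡ (I≈ i j))))))
          (trans (sym (trans (χ≈ x) (det′≈ (C x)))) (trans (spectrum x) (trans (ψ≈ x) (trans (product′≈ (f x)) (product-cong (f≈ x))))))))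

open import Defs

-- The Cauchy reals satisfy the axioms.

module CauchyReals where
  open Cauchy-Lemmas
  open √-Lemmas using (/-mono-≤; /-distrib-+; /-*) renaming (archimedean to archimedeanℚ)
  open import Data.Integer.Base using (+_; -[1+_]; +[1+_]; +<+)
  open import Data.Rational.Base as ℚ using (ℚ; mkℚ; 0ℚ; 1ℚ; ½)
  import Data.Rational.Properties as ℚ
  open import Data.Rational.Solver using (module +-*-Solver)
  open +-*-Solver using (solve; _:+_; _:*_; _:-_; :-_; _:=_)
  open import Data.Empty using (⊥-elim)
  open import Relation.Binary.PropositionalEquality as ≡ using (_≡_)
  open import Data.Sum.Base using (inj₁; inj₂)
  open import Relation.Nullary using (yes; no)
  import Data.Nat.Properties as ℕ

  p≤∣p∣ : ∀ p → p ℚ.≤ ℚ.∣ p ∣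
  p≤∣p∣ p with ℚ.∣p∣≡p∨∣p∣≡-p p
  ... | inj₁ e = ℚ.≤-reflexive (≡.sym e)
  ... | inj₂ e = ℚ.≤-trans (≡.subst (ℚ._≤ 0ℚ) (solve 1 (λ p → :- :- p := p) ≡.refl p)
    (ℚ.neg-antimono-≤ (≡.subst (0ℚ ℚ.≤_) e (ℚ.0≤∣p∣ p)))) (ℚ.0≤∣p∣ p)

  p≤q⇒p≤q+ε : ∀ {p q ε} → p ℚ.≤ q → 0ℚ ℚ.< ε → p ℚ.≤ q ℚ.+ ε
  p≤q⇒p≤q+ε {p} {q} {ε} p≤q 0<ε = ℚ.≤-trans p≤q
    (≡.subst (ℚ._≤ q ℚ.+ ε) (ℚ.+-identityʳ q) (ℚ.+-monoʳ-≤ q (ℚ.<⇒≤ 0<ε)))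

  pointwise-≤ : ∀ {x y} → (∀ i → seq x i ℚ.≤ seq y i) → x ≤ y
  pointwise-≤ h ε 0<ε = 0 , λ i _ → p≤q⇒p≤q+ε (h i) 0<ε

  ∣p-q∣≤r⇒p≤q+r : ∀ p q {r} → ℚ.∣ p ℚ.- q ∣ ℚ.≤ r → p ℚ.≤ q ℚ.+ r
  ∣p-q∣≤r⇒p≤q+r p q h = ≡.subst (ℚ._≤ q ℚ.+ _) (solve 2 (λ p q → q :+ (p :- q) := p) ≡.refl p q)
    (ℚ.+-monoʳ-≤ q (ℚ.≤-trans (p≤∣p∣ (p ℚ.- q)) h))

  ≤-reflexive : ∀ {x y} → x ≈ y → x ≤ y
  ≤-reflexive {x} {y} h ε 0<ε with h ε 0<ε
  ... | N , close = N , λ i N≤i → ∣p-q∣≤r⇒p≤q+r (seq x i) (seq y i) (close i N≤i)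

  ≤-antisym : ∀ {x y} → x ≤ y → y ≤ x → x ≈ y
  ≤-antisym x≤y y≤x ε 0<ε with x≤y ε 0<ε | y≤x ε 0<ε
  ... | M , h | N , k = M ℕ.⊔ N , λ i i≥ → ∣p-q∣≤r (h i (≤-max₁ {M} i≥)) (k i (≤-max₂ {M} i≥))

  ≤-trans : ∀ {x y z} → x ≤ y → y ≤ z → x ≤ z
  ≤-trans {x} {y} {z} x≤y y≤z ε 0<ε with x≤y (½ ℚ.* ε) (0<½ε 0<ε) | y≤z (½ ℚ.* ε) (0<½ε 0<ε)
  ... | M , h | N , k = M ℕ.⊔ N , λ i i≥ → begin
    seq x i                                      ≤⟨ h i (≤-max₁ {M} i≥) ⟩
    seq y i ℚ.+ ½ ℚ.* ε                          ≤⟨ ℚ.+-monoˡ-≤ (½ ℚ.* ε) (k i (≤-max₂ {M} i≥)) ⟩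
    (seq z i ℚ.+ ½ ℚ.* ε) ℚ.+ ½ ℚ.* ε            ≡⟨ ≡.trans (ℚ.+-assoc (seq z i) _ _) (≡.cong (seq z i ℚ.+_) (½+½ ε)) ⟩
    seq z i ℚ.+ ε ∎
    where open ℚ.≤-Reasoning

  ≈-sym : ∀ {x y} → x ≈ y → y ≈ x
  ≈-sym {x} {y} h ε 0<ε with h ε 0<ε
  ... | N , close = N , λ i N≤i → ≡.subst (ℚ._≤ ε) (∣p-q∣-comm (seq x i) (seq y i)) (close i N≤i)

  ≈-trans : ∀ {x y z} → x ≈ y → y ≈ z → x ≈ z
  ≈-trans {x} {y} {z} x≈y y≈z = ≤-antisym {x} {z}
    (≤-trans {x} {y} {z} (≤-reflexive {x} {y} x≈y) (≤-reflexive {y} {z} y≈z))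
    (≤-trans {z} {y} {x} (≤-reflexive {z} {y} (≈-sym {y} {z} y≈z)) (≤-reflexive {y} {x} (≈-sym {x} {y} x≈y)))

  pointwise-≈ : ∀ {x y} → (∀ i → seq x i ≡ seq y i) → x ≈ y
  pointwise-≈ {x} {y} h = ≤-antisym {x} {y} (pointwise-≤ {x} {y} (λ i → ℚ.≤-reflexive (h i)))
    (pointwise-≤ {y} {x} (λ i → ℚ.≤-reflexive (≡.sym (h i))))

  +-mono-≤ : ∀ {x y u v} → x ≤ y → u ≤ v → x + u ≤ y + v
  +-mono-≤ {x} {y} {u} {v} x≤y u≤v ε 0<ε with x≤y (½ ℚ.* ε) (0<½ε 0<ε) | u≤v (½ ℚ.* ε) (0<½ε 0<ε)
  ... | M , h | N , k = M ℕ.⊔ N , λ i i≥ → ≡.subst (seq x i ℚ.+ seq u i ℚ.≤_)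
    (≡.trans (solve 3 (λ y v e → (y :+ e) :+ (v :+ e) := (y :+ v) :+ (e :+ e)) ≡.refl (seq y i) (seq v i) (½ ℚ.* ε))
      (≡.cong (seq y i ℚ.+ seq v i ℚ.+_) (½+½ ε)))
    (ℚ.+-mono-≤ (h i (≤-max₁ {M} i≥)) (k i (≤-max₂ {M} i≥)))

  +-cong : ∀ {x y u v} → x ≈ y → u ≈ v → x + u ≈ y + v
  +-cong {x} {y} {u} {v} x≈y u≈v = ≤-antisym {x + u} {y + v}
    (+-mono-≤ {x} {y} {u} {v} (≤-reflexive {x} {y} x≈y) (≤-reflexive {u} {v} u≈v))
    (+-mono-≤ {y} {x} {v} {u} (≤-reflexive {y} {x} (≈-sym {x} {y} x≈y)) (≤-reflexive {v} {u} (≈-sym {u} {v} u≈v)))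

  -‿cong : ∀ {x y} → x ≈ y → - x ≈ - y
  -‿cong {x} {y} h ε 0<ε with h ε 0<ε
  ... | N , close = N , λ i N≤i → ≡.subst (ℚ._≤ ε)
    (≡.trans (∣p-q∣-comm (seq x i) (seq y i))
      (≡.cong ℚ.∣_∣ (solve 2 (λ p q → q :- p := :- p :- :- q) ≡.refl (seq x i) (seq y i))))
    (close i N≤i)

  *-cong : ∀ {x y u v} → x ≈ y → u ≈ v → x * u ≈ y * v
  *-cong {x} {y} {u} {v} x≈y u≈v ε 0<ε =
    let A , 0<A , K , hA = bounded {seq x} (cauchy x)
        B , 0<B , L , hB = bounded {seq v} (cauchy v)
        α , 0<α , Aα = scale A 0<A (½ ℚ.* ε) (0<½ε {ε} 0<ε)
        β , 0<β , Bβ = scale B 0<B (½ ℚ.* ε) (0<½ε {ε} 0<ε)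
        M , hx = x≈y β 0<β
        N , hu = u≈v α 0<α
    in (K ℕ.⊔ L) ℕ.⊔ (M ℕ.⊔ N) , λ i i≥ → ≡.subst (ℚ.∣ seq x i ℚ.* seq u i ℚ.- seq y i ℚ.* seq v i ∣ ℚ.≤_)
      (≡.trans (≡.cong₂ ℚ._+_ Aα Bβ) (½+½ ε))
      (*-close (seq x i) (seq u i) (seq y i) (seq v i) A B α β 0<A 0<B
        (hA i (≤-max₁ {K} {L} (≤-max₁ {K ℕ.⊔ L} {M ℕ.⊔ N} i≥)))
        (hB i (≤-max₂ {K} {L} (≤-max₁ {K ℕ.⊔ L} {M ℕ.⊔ N} i≥)))
        (hu i (≤-max₂ {M} {N} (≤-max₂ {K ℕ.⊔ L} {M ℕ.⊔ N} i≥)))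
        (hx i (≤-max₁ {M} {N} (≤-max₂ {K ℕ.⊔ L} {M ℕ.⊔ N} i≥))))

  -- The ring laws hold term by term for rational sequences; only the congruences and the laws of
  -- `≈` involve limits. The implicit sequences are given explicitly because `≈` unfolds and does
  -- not determine them.
  ℝ-commutativeRing : CommutativeRing 0ℓ 0ℓ
  ℝ-commutativeRing = record
    { Carrier = ℝ ; _≈_ = _≈_ ; _+_ = _+_ ; _*_ = _*_ ; -_ = -_ ; 0# = 0ℝ ; 1# = 1ℝ
    ; isCommutativeRing = record
      { isRing = record
        { +-isAbelianGroup = record
          { isGroup = record
            { isMonoid = record
              { isSemigroup = record
                { isMagma = record
                  { isEquivalence = record
                    { refl  = λ {x} → pointwise-≈ {x} {x} λ _ → ≡.refl
                    ; sym   = λ {x} {y} → ≈-sym {x} {y}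
                    ; trans = λ {x} {y} {z} → ≈-trans {x} {y} {z} }
                  ; ∙-cong = λ {x} {y} {u} {v} → +-cong {x} {y} {u} {v} }
                ; assoc = λ x y z → pointwise-≈ {(x + y) + z} {x + (y + z)} λ i → ℚ.+-assoc (seq x i) (seq y i) (seq z i) }
              ; identity = (λ x → pointwise-≈ {0ℝ + x} {x} λ i → ℚ.+-identityˡ (seq x i))
                         , (λ x → pointwise-≈ {x + 0ℝ} {x} λ i → ℚ.+-identityʳ (seq x i)) }
            ; inverse = (λ x → pointwise-≈ { - x + x} {0ℝ} λ i → ℚ.+-inverseˡ (seq x i))
                      , (λ x → pointwise-≈ {x - x} {0ℝ} λ i → ℚ.+-inverseʳ (seq x i))
            ; ⁻¹-cong = λ {x} {y} → -‿cong {x} {y} }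
          ; comm = λ x y → pointwise-≈ {x + y} {y + x} λ i → ℚ.+-comm (seq x i) (seq y i) }
        ; *-cong = λ {x} {y} {u} {v} → *-cong {x} {y} {u} {v}
        ; *-assoc = λ x y z → pointwise-≈ {(x * y) * z} {x * (y * z)} λ i → ℚ.*-assoc (seq x i) (seq y i) (seq z i)
        ; *-identity = (λ x → pointwise-≈ {1ℝ * x} {x} λ i → ℚ.*-identityˡ (seq x i))
                     , (λ x → pointwise-≈ {x * 1ℝ} {x} λ i → ℚ.*-identityʳ (seq x i))
        ; distrib = (λ x y z → pointwise-≈ {x * (y + z)} {x * y + x * z} λ i → ℚ.*-distribˡ-+ (seq x i) (seq y i) (seq z i))
                  , (λ x y z → pointwise-≈ {(y + z) * x} {y * x + z * x} λ i → ℚ.*-distribʳ-+ (seq x i) (seq y i) (seq z i)) }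
      ; *-comm = λ x y → pointwise-≈ {x * y} {y * x} λ i → ℚ.*-comm (seq x i) (seq y i) } }

  open Integers ℝ-commutativeRing using (ι; ι-suc)

  ι≈fromℕ : ∀ n → ι n ≈ fromℕ n
  ι≈fromℕ zero    = pointwise-≈ {0ℝ} {fromℕ 0} λ _ → ≡.refl
  ι≈fromℕ (suc n) = ≈-trans {ι (suc n)} {1ℝ + ι n} {fromℕ (suc n)} (ι-suc n)
    (≈-trans {1ℝ + ι n} {1ℝ + fromℕ n} {fromℕ (suc n)}
      (+-cong {1ℝ} {1ℝ} {ι n} {fromℕ n} (pointwise-≈ {1ℝ} {1ℝ} λ _ → ≡.refl) (ι≈fromℕ n))
      (pointwise-≈ {1ℝ + fromℕ n} {fromℕ (suc n)} λ _ → ≡.sym (/-distrib-+ 1 n 0)))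

  ∣p∣*∣p∣≡p*p : ∀ p → ℚ.∣ p ∣ ℚ.* ℚ.∣ p ∣ ≡ p ℚ.* p
  ∣p∣*∣p∣≡p*p p with ℚ.∣p∣≡p∨∣p∣≡-p p
  ... | inj₁ e = ≡.cong₂ ℚ._*_ e e
  ... | inj₂ e = ≡.trans (≡.cong₂ ℚ._*_ e e) (solve 1 (λ p → :- p :* :- p := p :* p) ≡.refl p)

  0≤p*q : ∀ {p q} → 0ℚ ℚ.≤ p → 0ℚ ℚ.≤ q → 0ℚ ℚ.≤ p ℚ.* q
  0≤p*q {p} {q} 0≤p 0≤q = ≡.subst (ℚ._≤ p ℚ.* q) (ℚ.*-zeroʳ p) (ℚ.*-monoˡ-≤-nonNeg p {{ℚ.nonNegative 0≤p}} 0≤q)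

  -- A nonnegative real may have slightly negative terms. Replacing it by its absolute value makes
  -- the terms nonnegative, so that products can be compared termwise.
  ≈abs : ∀ {x} → 0ℝ ≤ x → x ≈ abs x
  ≈abs {x} 0≤x ε 0<ε with 0≤x (½ ℚ.* ε) (0<½ε 0<ε)
  ... | N , h = N , λ i N≤i → ∣p-q∣≤r (p≤q⇒p≤q+ε (p≤∣p∣ (seq x i)) 0<ε) (upper (seq x i) (h i N≤i))
    where
    upper : ∀ p → 0ℚ ℚ.≤ p ℚ.+ ½ ℚ.* ε → ℚ.∣ p ∣ ℚ.≤ p ℚ.+ ε
    upper p 0≤p+½ε with ℚ.∣p∣≡p∨∣p∣≡-p p
    ... | inj₁ e = ≡.subst (ℚ._≤ p ℚ.+ ε) (≡.sym e) (p≤q⇒p≤q+ε ℚ.≤-refl 0<ε)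
    ... | inj₂ e = ≡.subst (ℚ._≤ p ℚ.+ ε) (≡.trans (ℚ.+-identityʳ (ℚ.- p)) (≡.sym e))
      (≡.subst (ℚ.- p ℚ.+ 0ℚ ℚ.≤_)
        (≡.trans (solve 2 (λ p e → :- p :+ ((p :+ e) :+ (p :+ e)) := p :+ (e :+ e)) ≡.refl p (½ ℚ.* ε)) (≡.cong (p ℚ.+_) (½+½ ε)))
        (ℚ.+-monoʳ-≤ (ℚ.- p) (ℚ.+-mono-≤ 0≤p+½ε 0≤p+½ε)))

  *-nonNeg : ∀ {x y} → 0ℝ ≤ x → 0ℝ ≤ y → 0ℝ ≤ x * y
  *-nonNeg {x} {y} 0≤x 0≤y = ≤-trans {0ℝ} {abs x * abs y} {x * y}
    (pointwise-≤ {0ℝ} {abs x * abs y} λ i → 0≤p*q (ℚ.0≤∣p∣ (seq x i)) (ℚ.0≤∣p∣ (seq y i)))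
    (≤-reflexive {abs x * abs y} {x * y} (≈-sym {x * y} {abs x * abs y}
      (*-cong {x} {abs x} {y} {abs y} (≈abs {x} 0≤x) (≈abs {y} 0≤y))))

  square-nonNeg : ∀ x → 0ℝ ≤ x * x
  square-nonNeg x = pointwise-≤ {0ℝ} {x * x} λ i → ≡.subst (0ℚ ℚ.≤_) (∣p∣*∣p∣≡p*p (seq x i))
    (0≤p*q (ℚ.0≤∣p∣ (seq x i)) (ℚ.0≤∣p∣ (seq x i)))

  -- If p > q + ε and q ≥ - ε/4, then p² - q² = (p - q)(p + q) > ε · ε/2.
  square-cancelℚ : ∀ p q ε → 0ℚ ℚ.< ε → 0ℚ ℚ.≤ q ℚ.+ ½ ℚ.* (½ ℚ.* ε) →
    p ℚ.* p ℚ.≤ q ℚ.* q ℚ.+ ε ℚ.* (½ ℚ.* ε) → p ℚ.≤ q ℚ.+ ε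
  square-cancelℚ p q ε 0<ε low h with p ℚ.≤? q ℚ.+ ε
  ... | yes p≤ = p≤
  ... | no p≰ = ⊥-elim (ℚ.<-irrefl ≡.refl (ℚ.<-≤-trans strict (≡.subst (ℚ._≤ ε ℚ.* e) factor
          (p-q≤r {p ℚ.* p} {q ℚ.* q} h))))
    where
    e f : ℚ
    e = ½ ℚ.* ε
    f = ½ ℚ.* e
    0<e : 0ℚ ℚ.< e
    0<e = 0<½ε 0<ε
    ε<p-q : ε ℚ.< p ℚ.- q
    ε<p-q = ≡.subst (ℚ._< p ℚ.- q) (solve 2 (λ q e → (q :+ e) :- q := e) ≡.refl q ε) (ℚ.+-monoˡ-< (ℚ.- q) (ℚ.≰⇒> p≰))
    e≤p+q : e ℚ.≤ p ℚ.+ q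
    e≤p+q = begin
      e                                       ≡⟨ ≡.sym (ℚ.+-identityˡ e) ⟩
      (0ℚ ℚ.+ 0ℚ) ℚ.+ e                       ≤⟨ ℚ.+-monoˡ-≤ e (ℚ.+-mono-≤ low low) ⟩
      ((q ℚ.+ f) ℚ.+ (q ℚ.+ f)) ℚ.+ e         ≡⟨ solve 3 (λ q f e → ((q :+ f) :+ (q :+ f)) :+ e := (q :+ ((f :+ f) :+ e)) :+ q) ≡.refl q f e ⟩
      (q ℚ.+ ((f ℚ.+ f) ℚ.+ e)) ℚ.+ q         ≡⟨ ≡.cong (λ x → (q ℚ.+ x) ℚ.+ q) (≡.trans (≡.cong (ℚ._+ e) (½+½ e)) (½+½ ε)) ⟩
      (q ℚ.+ ε) ℚ.+ q                         ≤⟨ ℚ.+-monoˡ-≤ q (ℚ.<⇒≤ (ℚ.≰⇒> p≰)) ⟩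
      p ℚ.+ q ∎
      where open ℚ.≤-Reasoning
    factor : p ℚ.* p ℚ.- q ℚ.* q ≡ (p ℚ.- q) ℚ.* (p ℚ.+ q)
    factor = solve 2 (λ p q → p :* p :- q :* q := (p :- q) :* (p :+ q)) ≡.refl p q
    strict : ε ℚ.* e ℚ.< (p ℚ.- q) ℚ.* (p ℚ.+ q)
    strict = ℚ.<-≤-trans (ℚ.*-monoˡ-<-pos e {{ℚ.positive 0<e}} ε<p-q)
      (ℚ.*-monoˡ-≤-nonNeg (p ℚ.- q) {{ℚ.nonNegative (ℚ.<⇒≤ (ℚ.<-trans 0<ε ε<p-q))}} e≤p+q)

  square-cancel-≤ : ∀ {x y} → 0ℝ ≤ y → x * x ≤ y * y → x ≤ y
  square-cancel-≤ {x} {y} 0≤y h ε 0<ε with 0≤y (½ ℚ.* (½ ℚ.* ε)) (0<½ε (0<½ε 0<ε)) | h (ε ℚ.* (½ ℚ.* ε)) 0<εε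
    where
    0<εε : 0ℚ ℚ.< ε ℚ.* (½ ℚ.* ε)
    0<εε = ≡.subst (ℚ._< ε ℚ.* (½ ℚ.* ε)) (ℚ.*-zeroʳ ε) (ℚ.*-monoʳ-<-pos ε {{ℚ.positive 0<ε}} (0<½ε 0<ε))
  ... | M , low | N , sq = M ℕ.⊔ N , λ i i≥ → square-cancelℚ (seq x i) (seq y i) ε 0<ε (low i (≤-max₁ {M} i≥)) (sq i (≤-max₂ {M} i≥))

  1/suc : ℕ → ℝ
  1/suc k = fromℚ (+ 1 ℚ./ suc k)

  k/k≡1 : ∀ k → + suc k ℚ./ 1 ℚ.* (+ 1 ℚ./ suc k) ≡ 1ℚ
  k/k≡1 k = ≡.trans (/-* (suc k) 1 0 k) (ℚ.≤-antisym {+ (suc k ℕ.* 1) ℚ./ (1 ℕ.* suc k)} {+ 1 ℚ./ 1}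
    (/-mono-≤ {suc k ℕ.* 1} {1} (k ℕ.+ 0) 0 (ℕ.≤-reflexive (eq k)))
    (/-mono-≤ {1} {suc k ℕ.* 1} 0 (k ℕ.+ 0) (ℕ.≤-reflexive (≡.sym (eq k)))))
    where
    open import Data.Nat.Tactic.RingSolver using (solve-∀)
    eq : ∀ k → (suc k ℕ.* 1) ℕ.* 1 ≡ 1 ℕ.* suc (k ℕ.+ 0)
    eq = solve-∀

  1/suc-inverse : ∀ k → ι (suc k) * 1/suc k ≈ 1ℝ
  1/suc-inverse k = ≈-trans {ι (suc k) * 1/suc k} {fromℕ (suc k) * 1/suc k} {1ℝ}
    (*-cong {ι (suc k)} {fromℕ (suc k)} {1/suc k} {1/suc k} (ι≈fromℕ (suc k)) (pointwise-≈ {1/suc k} {1/suc k} λ _ → ≡.refl))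
    (pointwise-≈ {fromℕ (suc k) * 1/suc k} {1ℝ} λ _ → k/k≡1 k)

  archimedean : ∀ {x y} → (∀ k → x ≤ y + 1/suc k) → x ≤ y
  archimedean {x} {y} h ε 0<ε with archimedeanℚ 1 (½ ℚ.* ε) (0<½ε 0<ε)
  ... | K , small with h K (½ ℚ.* ε) (0<½ε 0<ε)
  ...   | N , close = N , λ i N≤i → ℚ.≤-trans (close i N≤i)
    (≡.subst (seq y i ℚ.+ + 1 ℚ./ suc K ℚ.+ ½ ℚ.* ε ℚ.≤_)
      (≡.trans (ℚ.+-assoc (seq y i) _ _) (≡.cong (seq y i ℚ.+_) (½+½ ε)))
      (ℚ.+-monoˡ-≤ (½ ℚ.* ε) (ℚ.+-monoʳ-≤ (seq y i) (small K ℕ.≤-refl))))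

  ℚ-bounded : ∀ q → 0ℚ ℚ.< q → ∃[ N ] q ℚ.≤ + N ℚ./ 1
  ℚ-bounded (mkℚ +[1+ p ] d cop) _ = suc p , ≡.subst (ℚ._≤ + suc p ℚ./ 1) (ℚ.↥p/↧p≡p (mkℚ +[1+ p ] d cop))
    (/-mono-≤ {suc p} {suc p} d 0 (ℕ.*-monoʳ-≤ (suc p) (ℕ.s≤s ℕ.z≤n)))
  ℚ-bounded (mkℚ (+ 0) d cop) (ℚ.*<* (+<+ ()))
  ℚ-bounded (mkℚ -[1+ p ] d cop) (ℚ.*<* ())

  fromℕ-bounded : ∀ x → ∃[ N ] x ≤ fromℕ N
  fromℕ-bounded x =
    let B , 0<B , K , ∣x∣≤B = bounded {seq x} (cauchy x)
        N , B≤N = ℚ-bounded B 0<B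
    in N , λ ε 0<ε → K , λ i K≤i → p≤q⇒p≤q+ε {seq x i} {+ N ℚ./ 1} {ε}
      (ℚ.≤-trans (p≤∣p∣ (seq x i)) (ℚ.≤-trans (∣x∣≤B i K≤i) B≤N)) 0<ε

  ℝ-bounded : ∀ x → ∃[ N ] x ≤ ι N
  ℝ-bounded x = let N , x≤N = fromℕ-bounded x in N , ≤-trans {x} {fromℕ N} {ι N} x≤N
    (≤-reflexive {fromℕ N} {ι N} (≈-sym {ι N} {fromℕ N} (ι≈fromℕ N)))

  ℝ-real : RealRing
  ℝ-real = record
    { commutativeRing = ℝ-commutativeRing
    ; _≤_             = _≤_
    ; ≤-reflexive     = λ {x} {y} → ≤-reflexive {x} {y}
    ; ≤-trans         = λ {x} {y} {z} → ≤-trans {x} {y} {z}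
    ; ≤-antisym       = λ {x} {y} → ≤-antisym {x} {y}
    ; +-mono-≤        = λ {x} {y} {u} {v} → +-mono-≤ {x} {y} {u} {v}
    ; *-nonNeg        = λ {x} {y} → *-nonNeg {x} {y}
    ; square-nonNeg   = square-nonNeg
    ; square-cancel-≤ = λ {x} {y} → square-cancel-≤ {x} {y}
    ; ∣_∣             = abs
    ; ∣∣-nonNeg       = λ x → pointwise-≤ {0ℝ} {abs x} λ i → ℚ.0≤∣p∣ (seq x i)
    ; ∣∣-square       = λ x → pointwise-≈ {abs x * abs x} {x * x} λ i → ∣p∣*∣p∣≡p*p (seq x i)
    ; 1/suc           = 1/suc
    ; 1/suc-inverse   = 1/suc-inverse
    ; archimedean     = λ {x} {y} → archimedean {x} {y}
    ; bounded         = ℝ-bounded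
    ; √               = √
    ; √-nonNeg        = 0≤√
    ; √-square        = λ n → ≈-trans {√ n * √ n} {fromℕ n} {ι n} (√-square n) (≈-sym {ι n} {fromℕ n} (ι≈fromℕ n))
    }

-- Recursion equations over the Cauchy reals.

module CauchyRecursion where
  open import Data.Fin.Base using (Fin; toℕ; zero; suc; punchIn)
  import Data.Fin.Properties as Fin
  open import Function.Base using (_∘_)
  open import Relation.Binary.PropositionalEquality using (refl)
  open CauchyReals
  module R = CommutativeRing ℝ-commutativeRing

  ≈-refl : ∀ x → x ≈ x
  ≈-refl x = pointwise-≈ {x} {x} λ _ → refl

  term : ∀ {n} → Matrix (suc n) → Fin (suc n) → ℝ
  term A j = (- 1ℝ) ^ toℕ j * A zero j * det (λ i k → A (suc i) (punchIn j k))

  term≈ : ∀ {n} (A : Matrix (suc n)) j →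
    term A j R.≈ (- 1ℝ) ^ toℕ j R.* A zero j R.* det (λ i k → A (suc i) (punchIn j k))
  term≈ A j = pointwise-≈ {term A j} {(- 1ℝ) ^ toℕ j R.* A zero j R.* det (λ i k → A (suc i) (punchIn j k))}
    λ i → refl {x = seq (term A j) i}

  det-suc : ∀ {n} (A : Matrix (suc n)) → det A R.≈ sum (term A)
  det-suc A = pointwise-≈ {det A} {sum (term A)} λ i → refl {x = seq (sum (term A)) i}

  sum-zero : ∀ (f : Fin 0 → ℝ) → sum f R.≈ R.0#
  sum-zero f = ≈-refl 0ℝ

  sum-suc : ∀ {n} (f : Fin (suc n) → ℝ) → sum f R.≈ f zero R.+ sum (f ∘ suc)
  sum-suc f = ≈-refl (sum f)

  product-zero : ∀ (f : Fin 0 → ℝ) → product f R.≈ R.1#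
  product-zero f = ≈-refl 1ℝ

  product-suc : ∀ {n} (f : Fin (suc n) → ℝ) → product f R.≈ f zero R.* product (f ∘ suc)
  product-suc f = ≈-refl (product f)

  ^-zero : ∀ x → x ^ 0 R.≈ R.1#
  ^-zero x = ≈-refl 1ℝ

  ^-suc : ∀ x k → x ^ (suc k) R.≈ x R.* x ^ k
  ^-suc x k = ≈-refl (x ^ (suc k))

  det-zero : ∀ (A : Matrix 0) → det A R.≈ R.1#
  det-zero A = ≈-refl 1ℝ

-- Transfer of the bound to the Cauchy reals.

module CauchyBridge where
  open import Data.Bool.Base using (if_then_else_)
  open import Data.Fin.Base using (Fin)
  import Data.Fin.Properties as Fin
  open import Relation.Nullary using (does)
  open CauchyRecursion
  open CauchyReals
  open Main.Recursive ℝ-real sum sum-zero sum-suc product product-zero product-suc _^_ ^-zero ^-suc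
    (- 1ℝ) (≈-refl (- 1ℝ)) det det-zero term term≈ det-suc public

  entry : ∀ x y z → x * y - z R.≈ x R.* y R.- z
  entry x y z = ≈-refl (x * y - z)

  difference : ∀ x y → x - y R.≈ x R.- y
  difference x y = ≈-refl (x - y)

  bound : ∀ a b c q → a * b - c + q R.≈ a R.* b R.- c R.+ q
  bound a b c q = ≈-refl (a * b - c + q)

  identity : ∀ {n} (i j : Fin n) → 1ᴹ i j R.≈ (if does (i Fin.≟ j) then R.1# else R.0#)
  identity i j = ≈-refl (1ᴹ i j)

  seidel-cases : ∀ {n} (T : Graph n) i j → Graph.seidel T i j R.≈
    (if does (i Fin.≟ j) then 0ℝ else if Graph.adj T i j then - 1ℝ else 1ℝ)
  seidel-cases T i j = ≈-refl (if does (i Fin.≟ j) then 0ℝ else if Graph.adj T i j then - 1ℝ else 1ℝ)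

  characteristic : ∀ {n} (S : Matrix n) x → charpoly S x R.≈ det (λ i j → x * 1ᴹ i j - S i j)
  characteristic S x = ≈-refl (charpoly S x)

  energy-lower-bound : ∀ {n} (T : Graph n) → let open Graph T in IsTree →
    (S : Matrix n) → (∀ i j → S i j R.≈ (if does (i Fin.≟ j) then 0ℝ else if adj i j then - 1ℝ else 1ℝ)) →
    ∀ e → IsEnergy S e → fromℕ 2 * fromℕ n - fromℕ 6 + √ (2 ℕ.* (n ∸ D)) ≤ e
  energy-lower-bound {n} T tree S S≈ e (μ , spectrum , e≈) = lower-bound T tree μ
    1ᴹ identity S S≈
    (λ x i j → x * 1ᴹ i j - S i j) (λ x i j → entry x (1ᴹ i j) (S i j))
    (λ x i → x - μ i) (λ x i → difference x (μ i))
    (charpoly S) (λ x → product (λ i → x - μ i)) (characteristic S)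
    (λ x → ≈-refl (product (λ i → x - μ i))) spectrum e e≈ fromℕ ι≈fromℕ
    (fromℕ 2 * fromℕ n - fromℕ 6 + √ (2 ℕ.* (n ∸ Graph.D T)))
    (bound (fromℕ 2) (fromℕ n) (fromℕ 6) (√ (2 ℕ.* (n ∸ Graph.D T))))

theorem1 : ∀ {n} (T : Graph n) → let open Graph T in
    IsTree → ∀ (e : ℝ) → IsEnergy (Graph.seidel T) e →
    fromℕ 2 * fromℕ n - fromℕ 6 + √ (2 ℕ.* (n ∸ D)) ≤ e
theorem1 T tree e energy = CauchyBridge.energy-lower-bound T tree
  (Graph.seidel T) (CauchyBridge.seidel-cases T) e energy
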